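{- Let $Z:\mathfrak{H}^0\to\mathbb{R}$ be a $\mathbb{Q}$-linear map which satisfies the double shuffle relation, the duality relation, and the regularization theorem $Z_{\sqcup\!\sqcup}(\mathbf{k};T)=\rho_Z\bigl(Z_*(\mathbf{k};T)\bigr)$ for every index $\mathbf{k}$ (equivalently, given the double shuffle relation, the integral-series identity $Z(\mu(\mathbf{k},\mathbf{l}))=Z(\mathbf{k}\circledast\mathbf{l}^\star)$ for all non-empty indices $\mathbf{k},\mathbf{l}$). Then $Z$ satisfies Kawashima's relation: for all non-empty indices $\mathbf{k},\mathbf{l}$ and every integer $m\ge1$, \[\sum_{\substack{p,q\ge1\\ p+q=m}}Z\bigl((\underbrace{1,\dots,1}_p)\circledast(\mathbf{k}^\vee)^\star\bigr)\,Z\bigl((\underbrace{1,\dots,1}_q)\circledast(\mathbf{l}^\vee)^\star\bigr)=-Z\bigl((\underbrace{1,\dots,1}_m)\circledast((\mathbf{k}\mathbin{\bar{*}}\mathbf{l})^\vee)^\star\bigr).\]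
   Context: Let $\mathfrak{H}=\mathbb{Q}\langle e_0,e_1\rangle$, $\mathfrak{H}^1=\mathbb{Q}+e_1\mathfrak{H}$, $\mathfrak{H}^0=\mathbb{Q}+e_1\mathfrak{H}e_0$, $e_k=e_1e_0^{k-1}$. Indices (finite possibly empty sequences $(k_1,\dots,k_r)$ of positive integers; admissible if empty or $k_r\ge2$) are identified with words $e_{k_1}\cdots e_{k_r}$ (empty $\leftrightarrow1$); maps are extended $\mathbb{Q}$-linearly. Shuffle $\sqcup\!\sqcup$: bilinear, $1\sqcup\!\sqcup w=w\sqcup\!\sqcup1=w$, $av\sqcup\!\sqcup bw=a(v\sqcup\!\sqcup bw)+b(av\sqcup\!\sqcup w)$ ($a,b\in\{e_0,e_1\}$). Harmonic $*$ on $\mathfrak{H}^1$: $1*w=w*1=w$, $e_kv*e_lw=e_k(v*e_lw)+e_l(e_kv*w)+e_{k+l}(v*w)$. Star-harmonic $\bar{*}$ on $\mathfrak{H}^1$: $1\mathbin{\bar*}w=w\mathbin{\bar*}1=w$, $e_kv\mathbin{\bar*}e_lw=e_k(v\mathbin{\bar*}e_lw)+e_l(e_kv\mathbin{\bar*}w)-e_{k+l}(v\mathbin{\bar*}w)$. Double shuffle relation: $Z(v\sqcup\!\sqcup w)=Z(v*w)=Z(v)Z(w)$ for all $v,w\in\mathfrak{H}^0$. Then $Z_{\sqcup\!\sqcup},Z_*:\mathfrak{H}^1\to\mathbb{R}[T]$ are the unique algebra homomorphisms for $\sqcup\!\sqcup$ resp. $*$ extending $Z$ with $e_1\mapsto T$.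 $A_Z(u)=\exp\bigl(\sum_{n\ge2}\frac{(-1)^n}{n}Z(e_n)u^n\bigr)$; $\rho_Z$ is the $\mathbb{R}$-linear map on $\mathbb{R}[T]$ with $\rho_Z(e^{Tu})=A_Z(u)e^{Tu}$ (coefficientwise in $u$). Duality relation: $Z(w)=Z(w^\dagger)$ for all $w\in\mathfrak{H}^0$, where $w\mapsto w^\dagger$ is the anti-automorphism of $\mathfrak{H}$ with $e_0^\dagger=e_1$, $e_1^\dagger=e_0$. $\circledast:e_1\mathfrak{H}\times e_1\mathfrak{H}\to e_1\mathfrak{H}e_0$ is bilinear with $ve_k\circledast we_l=(v*w)e_{k+l}$. For non-empty $\mathbf{k}=(k_1,\dots,k_r)$, $\mathbf{k}^\star$ is the sum of the $2^{r-1}$ indices $(k_1\bigcirc\cdots\bigcirc k_r)$, each $\bigcirc$ a comma or plus. Hoffman dual: for an index $\mathbf{k}=(k_1,\dots,k_r)$ of weight $k$, $\mathbf{k}^\vee=(k'_1,\dots,k'_{r'})$ is the index of weight $k$ with $\{1,\dots,k-1\}=\{k_1,k_1+k_2,\dots,k_1+\dots+k_{r-1}\}\sqcup\{k'_1,k'_1+k'_2,\dots,k'_1+\dots+k'_{r'-1}\}$ (disjoint union); extended linearly to $\mathfrak{H}^1$. For the parenthetical equivalent hypothesis: a 2-poset is a finite poset with labels $\delta:X\to\{0,1\}$; $W(X)$ is the sum over all linear extensions $x_1,\dots,x_n$ of $e_{\delta(x_1)}\cdots e_{\delta(x_n)}$. For non-empty $\mathbf{k}=(k_1,\dots,k_r)$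 of weight $K$ and non-empty $\mathbf{l}=(l_1,\dots,l_s)$, $\mu(\mathbf{k},\mathbf{l})=W(Q)$ where $Q$ has elements $a_1,\dots,a_K$, $b_{j,i}$ ($1\le j\le s$, $1\le i\le l_j$), order generated by $a_1<\cdots<a_K<b_{s,1}$, $b_{j,1}<\cdots<b_{j,l_j}$, $b_{j-1,1}<b_{j,l_j}$ ($2\le j\le s$), labels $\delta(a_t)=1$ iff $t\in\{1,k_1+1,\dots,k_1+\dots+k_{r-1}+1\}$ (else 0), $\delta(b_{s,1})=0$, $\delta(b_{j,1})=1$ ($j<s$), $\delta(b_{j,i})=0$ ($i\ge2$). -}

module Defs where

open import Level using (Level; _⊔_)
open import Data.Bool using (Bool; true; false; not)
open import Data.Nat using (ℕ; zero; suc; _∸_; _≤_) renaming (_+_ to _+ℕ_)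
open import Data.Nat.Combinatorics using (_P_)
open import Data.Integer as ℤ using (+_)
open import Data.Rational as ℚ using (ℚ; 1ℚ; _/_)
open import Data.List as List using (List; []; _∷_; _++_; [_]; replicate; map; concatMap; reverse)
open import Data.List.Relation.Unary.All using (All)
open import Data.Product using (_×_; _,_)
open import Data.Maybe using (Maybe; just; nothing)
open import Algebra.Bundles using (CommutativeRing)

-- Words in the letters e₀, e₁ (basis of 𝔥 = ℚ⟨e₀,e₁⟩)

data Letter : Set where
  x0 x1 : Letter

Word : Set
Word = List Letter

-- formal ℚ-linear combinations of words / of indices (elements of 𝔥)
LinW : Set
LinW = List (ℚ × Word)

Index : Set
Index = List ℕ

LinI : Set
LinI = List (ℚ × Index)

IsIndex : Index → Set
IsIndex k = All (λ n → 1 ≤ n) k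

lastOK : Index → Set
lastOK []           = Data.Unit.⊤ where import Data.Unit
lastOK (k ∷ [])     = 2 ≤ k
lastOK (_ ∷ l ∷ ks) = lastOK (l ∷ ks)

IsAdmissible : Index → Set
IsAdmissible k = IsIndex k × lastOK k

eW : ℕ → Word
eW k = x1 ∷ replicate (k ∸ 1) x0

toW : Index → Word
toW = concatMap eW

scaleL : {A : Set} → ℚ → List (ℚ × A) → List (ℚ × A)
scaleL q = map (λ { (c , a) → (q ℚ.* c , a) })

mapL : {A B : Set} → (A → B) → List (ℚ × A) → List (ℚ × B)
mapL f = map (λ { (c , a) → (c , f a) })

extL : {A B : Set} → (A → List (ℚ × B)) → List (ℚ × A) → List (ℚ × B)
extL f = concatMap (λ { (c , a) → scaleL c (f a) })

ext2L : {A B C : Set} → (A → B → List (ℚ × C)) →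
        List (ℚ × A) → List (ℚ × B) → List (ℚ × C)
ext2L f xs ys = concatMap (λ { (c , a) → concatMap (λ { (d , b) → scaleL (c ℚ.* d) (f a b) }) ys }) xs

shuffle : Word → Word → LinW
shuffle []       w        = (1ℚ , w) ∷ []
shuffle (a ∷ v)  []       = (1ℚ , a ∷ v) ∷ []
shuffle (a ∷ v)  (b ∷ w)  =
  mapL (a ∷_) (shuffle v (b ∷ w)) ++ mapL (b ∷_) (shuffle (a ∷ v) w)

harm : Index → Index → LinI
harm []       w        = (1ℚ , w) ∷ []
harm (k ∷ v)  []       = (1ℚ , k ∷ v) ∷ []
harm (k ∷ v)  (l ∷ w)  =
  mapL (k ∷_) (harm v (l ∷ w)) ++ mapL (l ∷_) (harm (k ∷ v) w)
  ++ mapL ((k +ℕ l) ∷_) (harm v w)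

sharm : Index → Index → LinI
sharm []       w        = (1ℚ , w) ∷ []
sharm (k ∷ v)  []       = (1ℚ , k ∷ v) ∷ []
sharm (k ∷ v)  (l ∷ w)  =
  mapL (k ∷_) (sharm v (l ∷ w)) ++ mapL (l ∷_) (sharm (k ∷ v) w)
  ++ scaleL (ℚ.- 1ℚ) (mapL ((k +ℕ l) ∷_) (sharm v w))

-- v e_k ⊛ w e_l = (v * w) e_{k+l}  (junk value 0 if an argument is empty)

initLast : Index → Maybe (Index × ℕ)
initLast []       = nothing
initLast (k ∷ ks) with initLast ks
... | nothing       = just ([] , k)
... | just (v , l)  = just (k ∷ v , l)

circ : Index → Index → LinI
circ a b with initLast a | initLast b
... | just (v , k) | just (w , l) = mapL (_++ [ k +ℕ l ]) (harm v w)
... | _            | _            = []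

circL : LinI → LinI → LinI
circL = ext2L circ

-- k^⋆ : sum over all ways of replacing commas by plus signs
-- starC k ks = (k ∷ ks)^⋆
starC : ℕ → Index → LinI
starC k []       = (1ℚ , k ∷ []) ∷ []
starC k (l ∷ ks) = mapL (k ∷_) (starC l ks) ++ starC (k +ℕ l) ks

star : Index → LinI
star []       = (1ℚ , []) ∷ []
star (k ∷ ks) = starC k ks

starL : LinI → LinI
starL = extL star

-- Hoffman dual.  An index (k₁,…,k_r) of weight K is encoded by the
-- Boolean list of length K-1 whose i-th entry (1 ≤ i ≤ K-1) is true iff
-- i ∈ {k₁, k₁+k₂, …, k₁+…+k_{r-1}}; the dual is obtained by complementing
-- this subset of {1,…,K-1}.
enc : Index → List Bool
enc []           = []
enc (k ∷ [])     = replicate (k ∸ 1) false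
enc (k ∷ l ∷ ks) = replicate (k ∸ 1) false ++ true ∷ enc (l ∷ ks)

dec : ℕ → List Bool → Index
dec c []            = c ∷ []
dec c (true ∷ bs)   = c ∷ dec 1 bs
dec c (false ∷ bs)  = dec (suc c) bs

hdual : Index → Index
hdual k = dec 1 (map not (enc k))

hdualL : LinI → LinI
hdualL = mapL hdual

ones : ℕ → Index
ones p = replicate p 1

swapL : Letter → Letter
swapL x0 = x1
swapL x1 = x0

dagger : Word → Word
dagger w = reverse (map swapL w)

-- Constructions over a commutative ring R with a map ι : ℚ → R
-- (in the theorem ι is required to be a ring homomorphism).

module _ {c ℓ : Level} (R : CommutativeRing c ℓ) (ι : ℚ → CommutativeRing.Carrier R) where
  open CommutativeRing R

  natR : ℕ → Carrier
  natR n = ι (+ n / 1)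

  ZW : (Word → Carrier) → LinW → Carrier
  ZW Z []             = 0#
  ZW Z ((q , w) ∷ xs) = ι q * Z w + ZW Z xs

  ZI : (Word → Carrier) → LinI → Carrier
  ZI Z xs = ZW Z (mapL toW xs)

  -- polynomials in T over R: coefficient lists (constant term first)
  Poly : Set c
  Poly = List Carrier

  coeff : Poly → ℕ → Carrier
  coeff []       _       = 0#
  coeff (a ∷ _)  zero    = a
  coeff (_ ∷ as) (suc n) = coeff as n

  _≈ₚ_ : Poly → Poly → Set ℓ
  p ≈ₚ q = ∀ n → coeff p n ≈ coeff q n

  _+ₚ_ : Poly → Poly → Poly
  []       +ₚ q        = q
  (a ∷ p)  +ₚ []       = a ∷ p
  (a ∷ p)  +ₚ (b ∷ q)  = (a + b) ∷ (p +ₚ q)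

  scaleₚ : Carrier → Poly → Poly
  scaleₚ a = map (a *_)

  _*ₚ_ : Poly → Poly → Poly
  []      *ₚ q = []
  (a ∷ p) *ₚ q = scaleₚ a q +ₚ (0# ∷ (p *ₚ q))

  constₚ : Carrier → Poly
  constₚ a = a ∷ []

  oneₚ : Poly
  oneₚ = constₚ 1#

  Tₚ : Poly
  Tₚ = 0# ∷ 1# ∷ []

  extP : {A : Set} → (A → Poly) → List (ℚ × A) → Poly
  extP F []             = []
  extP F ((q , a) ∷ xs) = scaleₚ (ι q) (F a) +ₚ extP F xs

  module _ (Z : Word → Carrier) where
    cZ : ℕ → Carrier
    cZ 0             = 0#
    cZ 1             = 0#
    cZ (suc (suc i)) = sgn i * Z (eW (suc (suc i)))
      where
        sgn : ℕ → Carrier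
        sgn zero          = 1#
        sgn (suc zero)    = - 1#
        sgn (suc (suc j)) = sgn j

    -- A_Z(u) = exp(Σ_{n≥2} (-1)^n Z(e_n) u^n / n) = Σ_j a_j u^j, computed by
    -- a₀ = 1,  j a_j = Σ_{i=1}^{j} (i · coefficient of u^i in the exponent) a_{j-i}.
    -- aList j = [a_j, a_{j-1}, …, a_0]
    aList : ℕ → List Carrier
    aList zero    = 1# ∷ []
    aList (suc j) = (ι (+ 1 / suc j) * go 1 (aList j)) ∷ aList j
      where
        go : ℕ → List Carrier → Carrier
        go i []       = 0#
        go i (x ∷ xs) = cZ i * x + go (suc i) xs

    aCoef : ℕ → Carrier
    aCoef j with aList j
    ... | []    = 0#
    ... | x ∷ _ = x

    -- ρ_Z(T^n) = Σ_{m=0}^{n} (n!/m!) a_{n-m} T^m,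
    -- i.e. ρ_Z(e^{Tu}) = A_Z(u) e^{Tu} coefficientwise in u
    ρT : ℕ → Poly
    ρT n = List.map (λ m → natR (n P (n ∸ m)) * aCoef (n ∸ m)) (List.upTo (suc n))

    ρ : Poly → Poly
    ρ p = go 0 p
      where
        go : ℕ → Poly → Poly
        go n []       = []
        go n (a ∷ as) = scaleₚ a (ρT n) +ₚ go (suc n) as

    -- F : 𝔥¹ → R[T] is the shuffle-algebra homomorphism extending Z with e₁ ↦ T
    -- (given on the word basis of 𝔥¹, i.e. on words toW k, k an index)
    IsZsh : (Word → Poly) → Set ℓ
    IsZsh F =
      (F [] ≈ₚ oneₚ)
      × ((v w : Index) → IsIndex v → IsIndex w →
           extP F (shuffle (toW v) (toW w)) ≈ₚ (F (toW v) *ₚ F (toW w)))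
      × (F (x1 ∷ []) ≈ₚ Tₚ)
      × ((k : Index) → IsAdmissible k → F (toW k) ≈ₚ constₚ (Z (toW k)))

    IsZst : (Index → Poly) → Set ℓ
    IsZst G =
      (G [] ≈ₚ oneₚ)
      × ((v w : Index) → IsIndex v → IsIndex w →
           extP G (harm v w) ≈ₚ (G v *ₚ G w))
      × (G (1 ∷ []) ≈ₚ Tₚ)
      × ((k : Index) → IsAdmissible k → G k ≈ₚ constₚ (Z (toW k)))

  sumPQ : ℕ → (ℕ → ℕ → Carrier) → Carrier
  sumPQ m f = List.foldr _+_ 0# (List.map (λ p → f p (m ∸ p)) (List.drop 1 (List.upTo m)))

{-# OPTIONS --safe #-}
module Submission where

-- Kawashima's relation says that the Kawashima functions
--   f_k(z) = ∑_{m≥1} (-1)^{m-1} Z((1,…,1) ⊛ (k^∨)^⋆) z^m,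
-- which interpolate the star sums ∑_{n_1≤…≤n_r≤N}, are multiplicative for the
-- star-harmonic product.  For interpolated sums this is formal: with σ_z the
-- shift n ↦ n+z, f_k should be
--   ∑_i (-1)^{r-i} Z_*((k_1,…,k_i)^⋆) Z_*(σ_z(k_r,…,k_{i+1})),
-- a convolution (for deconcatenation) of homomorphisms.  On the other hand the
-- coefficient Z((1,…,1) ⊛ (k^∨)^⋆) is, by the integral-series identity, the value
-- of Z on a zigzag poset with a chain of e₁'s attached; dualizing that poset and
-- cutting the zigzag by inclusion-exclusion gives the same convolution with
-- shuffle in place of harmonic regularizations.  The two agree: at T = 0 the
-- regularization theorem says that Z_⧢ is the convolution of Z_* with the
-- functional (1,…,1) ↦ a_j supported on indices of 1s, where A_Z = ∑ a_j u^j,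
-- because dropping a trailing 1 is the derivation ∂/∂T; this functional cancels
-- from each of these convolutions.  The same cancellation proves the
-- integral-series identity.

-- Three coincidences make the two convolutions comparable. Duality turns the attached chain of m
-- letters e₁ into m letters e₀, and shuffling e₀^m into a word behind its initial e₁ acts on each
-- entry k like the expansion of 1/(n+z)^k: in both cases i new letters e₀ fall into the k gaps
-- behind the letters of the entry, in C(k-1+i, i) ways. Duality also exchanges the letters along
-- the zigzag, which undoes the Hoffman dual, so that k and not k^∨ governs the result. Finally, the
-- functional on the indices of 1s passes through the shift: a positive shift always creates an
-- entry larger than 1, so all of the shift falls on the other factor. Series and zigzags are cut in
-- the same way. A weak inequality between two summation variables, or an e₁-edge of the zigzag, is
-- complementary to the opposite relation, and both together leave a plain product. The two families
-- therefore solve one and the same linear recursion, whose solution is a convolution with the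
-- inverse of the signed Z_* or Z_⧢.

open import Defs
open import Level using (Level)
open import Function using (_∘_)
open import Data.Bool using (Bool; true; false; not)
open import Data.Empty using (⊥; ⊥-elim)
open import Data.Maybe using (just; nothing)
open import Data.Nat using (ℕ; zero; suc; _≤_; z≤n; s≤s; _∸_; _!) renaming (_+_ to _+ℕ_; _*_ to _*ℕ_)
open import Data.Nat.Combinatorics using (nPn≡n!) renaming (_P_ to _Perm_)
open import Data.Nat.Properties using (≤-refl; ≤-trans; m≤m+n) renaming (+-suc to +ℕ-suc; +-assoc to +ℕ-assoc; +-comm to +ℕ-comm; +-identityʳ to +ℕ-identityʳ)
open import Data.Nat.Tactic.RingSolver using () renaming (solve-∀ to solve-ℕ)
import Data.Integer as ℤ
import Data.Integer.Properties as ℤ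
open import Data.Rational as ℚ using (ℚ; 1ℚ; _/_; toℚᵘ)
open import Data.Rational.Properties using (+-*-rawRing; toℚᵘ-injective; toℚᵘ-fromℚᵘ; toℚᵘ-homo-+; toℚᵘ-homo-*)
open import Data.Rational.Unnormalised as ℚᵘ using (mkℚᵘ; *≡*)
import Data.Rational.Unnormalised.Properties as ℚᵘ
open import Data.Product using (_×_; _,_; proj₁; proj₂; map₁; Σ; ∃; ∃₂)
open import Data.Unit using (⊤; tt)
open import Data.List using (List; []; _∷_; [_]; _++_; _∷ʳ_; map; concatMap; reverse; replicate; foldr; applyUpTo)
open import Data.List.Properties using (unfold-reverse; reverse-involutive; reverse-++; reverse-map; ++-assoc; ++-identityʳ; map-++; map-∘; map-cong; map-replicate; map-applyUpTo; ∷-injectiveʳ)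
open import Data.List.Relation.Unary.All as All using (All; []; _∷_)
open import Data.List.Relation.Unary.All.Properties using (++⁺; map⁺)
open import Relation.Binary.PropositionalEquality as ≡ using (_≡_)
open import Algebra.Bundles using (CommutativeRing)
open import Algebra.Morphism.Structures using (IsRingHomomorphism)
open import Tactic.RingSolver using (solve-∀)
open import Tactic.RingSolver.Core.AlmostCommutativeRing using (AlmostCommutativeRing; fromCommutativeRing)


-- The ring operations are taken from a repackaging of R because the ring
-- solver only recognises operations that are syntactically of this form.
module Rearrangements {c ℓ : Level} (R : CommutativeRing c ℓ) where

  private
    acr : AlmostCommutativeRing c ℓ
    acr = fromCommutativeRing R (λ _ → nothing)

  open AlmostCommutativeRing acr using (_≈_; _+_; _*_)

  +-interchange : ∀ a b c d → (a + b) + (c + d) ≈ (a + c) + (b + d)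
  +-interchange = solve-∀ acr

  *-left-comm : ∀ a b c → a * (b * c) ≈ b * (a * c)
  *-left-comm = solve-∀ acr

  +-transpose : ∀ a b c d e f g h i →
    (a + (d + g)) + ((b + (e + h)) + (c + (f + i))) ≈ (a + (b + c)) + ((d + (e + f)) + (g + (h + i)))
  +-transpose = solve-∀ acr

  +-left-comm : ∀ a b c → a + (b + c) ≈ b + (a + c)
  +-left-comm = solve-∀ acr

  +-right-comm : ∀ a b c → (a + b) + c ≈ (a + c) + b
  +-right-comm = solve-∀ acr

  +-rearrange-5 : ∀ p q r s t → p + ((q + (r + s)) + t) ≈ q + ((p + (r + t)) + s)
  +-rearrange-5 = solve-∀ acr

  +-rearrange-8 : ∀ p₁ a b p₂ c d p₃ e →
    (p₁ + (a + b)) + ((p₂ + (c + d)) + (p₃ + e)) ≈ ((p₁ + (p₂ + p₃)) + c) + (a + (b + (d + e)))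
  +-rearrange-8 = solve-∀ acr

  +-rearrange-5′ : ∀ a b c d o → (a + (b + o)) + (c + (d + o)) ≈ (a + (c + o)) + (b + (d + o))
  +-rearrange-5′ = solve-∀ acr

  +-rearrange-12 : ∀ p₁ p₂ p₄ p₅ p₇ p₈ p₁₀ p₁₁ m₁ m₂ m₃ m₄ →
    (((p₁ + (p₂ + m₁)) + (p₄ + (p₅ + m₂))) + ((p₇ + (p₈ + m₃)) + (p₁₀ + (p₁₁ + m₄)))) + (m₁ + (m₃ + (m₂ + m₄))) ≈
    ((p₁ + (p₇ + (m₁ + m₃))) + (p₄ + (p₁₀ + (m₂ + m₄)))) + ((p₂ + (m₁ + (p₅ + m₂))) + (p₈ + (m₃ + (p₁₁ + m₄))))
  +-rearrange-12 = solve-∀ acr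

  +-rearrange-6 : ∀ p₁ p₂ p₃ p₄ m₁ m₂ →
    ((p₁ + (p₂ + m₁)) + (p₃ + (p₄ + m₂))) + (m₁ + m₂) ≈ ((p₁ + m₁) + (p₃ + m₂)) + (p₂ + (m₁ + (p₄ + m₂)))
  +-rearrange-6 = solve-∀ acr

  +-rearrange-6′ : ∀ p₁ p₂ p₃ p₄ m₁ m₂ →
    ((p₁ + (p₂ + m₁)) + (p₃ + (p₄ + m₂))) + (m₁ + m₂) ≈ (p₁ + (p₃ + (m₁ + m₂))) + ((p₂ + m₁) + (p₄ + m₂))
  +-rearrange-6′ = solve-∀ acr

  +-rearrange-3 : ∀ a b m → (a + (b + m)) + m ≈ (a + m) + (b + m)
  +-rearrange-3 = solve-∀ acr

  +-rearrange-6″ : ∀ a b c d e f → ((a + b) + (c + d)) + (e + f) ≈ (a + (e + b)) + (c + (f + d))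
  +-rearrange-6″ = solve-∀ acr

  *-interchange : ∀ a b c d → (a * b) * (c * d) ≈ (a * c) * (b * d)
  *-interchange = solve-∀ acr

private variable
  A B : Set

-- Deconcatenation and the products, as lists of terms

splits : List A → List (List A × List A)
splits []      = [ [] , [] ]
splits (x ∷ w) = ([] , x ∷ w) ∷ map (map₁ (x ∷_)) (splits w)

-- An index (k₁+1, …, k_r+1) is represented by (k₁, …, k_r); merging two
-- entries is then _⊕_.  H v w and S v list the terms of v * w and of v^⋆.
_⊕_ : ℕ → ℕ → ℕ
k ⊕ l = k +ℕ suc l

⊕-assoc : ∀ j k l → (j ⊕ k) ⊕ l ≡ j ⊕ (k ⊕ l)
⊕-assoc j k l = +ℕ-assoc j (suc k) (suc l)

⊕-comm : ∀ k l → k ⊕ l ≡ l ⊕ k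
⊕-comm k l = ≡.trans (+ℕ-suc k l) (≡.trans (≡.cong suc (+ℕ-comm k l)) (≡.sym (+ℕ-suc l k)))

H : List ℕ → List ℕ → List (List ℕ)
H []      w       = [ w ]
H (k ∷ v) []      = [ k ∷ v ]
H (k ∷ v) (l ∷ w) =
  map (k ∷_) (H v (l ∷ w)) ++ map (l ∷_) (H (k ∷ v) w) ++ map (k ⊕ l ∷_) (H v w)

-- One non-strict inequality, resolved into strict (a comma) and equal (a plus).
J : ℕ → List ℕ → List (List ℕ)
J k []      = [ k ∷ [] ]
J k (a ∷ x) = (k ∷ a ∷ x) ∷ (k ⊕ a ∷ x) ∷ []

S : List ℕ → List (List ℕ)
S []      = [ [] ]
S (k ∷ v) = concatMap (J k) (S v)

sh : Word → Word → List Word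
sh []      w       = [ w ]
sh (a ∷ v) []      = [ a ∷ v ]
sh (a ∷ v) (b ∷ w) = map (a ∷_) (sh v (b ∷ w)) ++ map (b ∷_) (sh (a ∷ v) w)

-- Finite sums and the convolution algebra of functionals on words

module Summation {c ℓ : Level} (R : CommutativeRing c ℓ) where

  open CommutativeRing R public
    using (Carrier; _≈_; _+_; _*_; -_; 0#; 1#; setoid; refl; sym; trans; reflexive; +-cong; +-congˡ; +-congʳ; *-cong; *-congˡ; *-congʳ; -‿cong;
           +-assoc; +-comm; +-identityˡ; +-identityʳ; *-assoc; *-comm; *-identityˡ; *-identityʳ;
           zeroˡ; zeroʳ; distribˡ; distribʳ; -‿inverseˡ; -‿inverseʳ)
  open import Algebra.Properties.Ring (CommutativeRing.ring R) public
    using (-0#≈0#; -‿involutive; -‿distribˡ-*; -‿distribʳ-*; -‿+-comm; +-cancelʳ)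
  open import Relation.Binary.Reasoning.Setoid setoid
  open Rearrangements R public

  ∑ : List A → (A → Carrier) → Carrier
  ∑ []       f = 0#
  ∑ (x ∷ xs) f = f x + ∑ xs f

  ∑-cong-All : {P : A → Set} {xs : List A} {f g : A → Carrier} → All P xs →
    (∀ x → P x → f x ≈ g x) → ∑ xs f ≈ ∑ xs g
  ∑-cong-All []        h = refl
  ∑-cong-All (px ∷ ps) h = +-cong (h _ px) (∑-cong-All ps h)

  ∑-cong : (xs : List A) {f g : A → Carrier} → (∀ x → f x ≈ g x) → ∑ xs f ≈ ∑ xs g
  ∑-cong []       h = refl
  ∑-cong (x ∷ xs) h = +-cong (h x) (∑-cong xs h)

  ∑-++ : (xs ys : List A) (f : A → Carrier) → ∑ (xs ++ ys) f ≈ ∑ xs f + ∑ ys f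
  ∑-++ []       ys f = sym (+-identityˡ _)
  ∑-++ (x ∷ xs) ys f = trans (+-congˡ (∑-++ xs ys f)) (sym (+-assoc _ _ _))

  ∑-map : (g : A → B) (xs : List A) (f : B → Carrier) → ∑ (map g xs) f ≈ ∑ xs (f ∘ g)
  ∑-map g []       f = refl
  ∑-map g (x ∷ xs) f = +-congˡ (∑-map g xs f)

  ∑-concatMap : (g : A → List B) (xs : List A) (f : B → Carrier) →
    ∑ (concatMap g xs) f ≈ ∑ xs (λ x → ∑ (g x) f)
  ∑-concatMap g []       f = refl
  ∑-concatMap g (x ∷ xs) f = trans (∑-++ (g x) (concatMap g xs) f) (+-congˡ (∑-concatMap g xs f))

  ∑-+ : (xs : List A) (f g : A → Carrier) → ∑ xs (λ x → f x + g x) ≈ ∑ xs f + ∑ xs g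
  ∑-+ []       f g = sym (+-identityˡ 0#)
  ∑-+ (x ∷ xs) f g = trans (+-congˡ (∑-+ xs f g)) (+-interchange _ _ _ _)

  ∑-*ˡ : (a : Carrier) (xs : List A) (f : A → Carrier) → ∑ xs (λ x → a * f x) ≈ a * ∑ xs f
  ∑-*ˡ a []       f = sym (zeroʳ a)
  ∑-*ˡ a (x ∷ xs) f = trans (+-congˡ (∑-*ˡ a xs f)) (sym (distribˡ a _ _))

  ∑-*ʳ : (a : Carrier) (xs : List A) (f : A → Carrier) → ∑ xs (λ x → f x * a) ≈ ∑ xs f * a
  ∑-*ʳ a []       f = sym (zeroˡ a)
  ∑-*ʳ a (x ∷ xs) f = trans (+-congˡ (∑-*ʳ a xs f)) (sym (distribʳ a _ _))

  ∑-neg : (xs : List A) (f : A → Carrier) → ∑ xs (λ x → - f x) ≈ - ∑ xs f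
  ∑-neg []       f = sym -0#≈0#
  ∑-neg (x ∷ xs) f = trans (+-congˡ (∑-neg xs f)) (-‿+-comm _ _)

  ∑-zero : (xs : List A) {f : A → Carrier} → (∀ x → f x ≈ 0#) → ∑ xs f ≈ 0#
  ∑-zero []       h = refl
  ∑-zero (x ∷ xs) h = trans (+-cong (h x) (∑-zero xs h)) (+-identityˡ 0#)

  ∑-swap : (xs : List A) (ys : List B) (f : A → B → Carrier) →
    ∑ xs (λ x → ∑ ys (f x)) ≈ ∑ ys (λ y → ∑ xs (λ x → f x y))
  ∑-swap []       ys f = sym (∑-zero ys (λ _ → refl))
  ∑-swap (x ∷ xs) ys f = trans (+-congˡ (∑-swap xs ys f)) (sym (∑-+ ys _ _))

  ∑-splits-∷ : (x : A) (w : List A) (f : List A × List A → Carrier) →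
    ∑ (splits (x ∷ w)) f ≈ f ([] , x ∷ w) + ∑ (splits w) (λ (u , v) → f (x ∷ u , v))
  ∑-splits-∷ x w f = +-congˡ (∑-map _ (splits w) f)

  ∑-splits-++ : (p : List A) (b : A) (s : List A) (f : List A × List A → Carrier) →
    ∑ (splits (p ++ b ∷ s)) f ≈
    ∑ (splits p) (λ (u , v) → f (u , v ++ b ∷ s)) + ∑ (splits s) (λ (u , v) → f (p ++ b ∷ u , v))
  ∑-splits-++ []      b s f = trans (∑-splits-∷ b s f) (+-congʳ (sym (+-identityʳ _)))
  ∑-splits-++ (x ∷ p) b s f = begin
    ∑ (splits (x ∷ p ++ b ∷ s)) f
      ≈⟨ ∑-splits-∷ x (p ++ b ∷ s) f ⟩
    f ([] , x ∷ p ++ b ∷ s) + ∑ (splits (p ++ b ∷ s)) (λ (u , v) → f (x ∷ u , v))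
      ≈⟨ +-congˡ (∑-splits-++ p b s _) ⟩
    f ([] , x ∷ p ++ b ∷ s) + (∑ (splits p) (λ (u , v) → f (x ∷ u , v ++ b ∷ s)) + _)
      ≈⟨ +-assoc _ _ _ ⟨
    f ([] , x ∷ p ++ b ∷ s) + ∑ (splits p) (λ (u , v) → f (x ∷ u , v ++ b ∷ s)) + _
      ≈⟨ +-congʳ (∑-splits-∷ x p (λ (u , v) → f (u , v ++ b ∷ s))) ⟨
    _ ∎

  ∑-splits-coassoc : (w : List A) (f : List A → List A → List A → Carrier) →
    ∑ (splits w) (λ (u , z) → ∑ (splits u) (λ (x , y) → f x y z)) ≈
    ∑ (splits w) (λ (x , u) → ∑ (splits u) (λ (y , z) → f x y z))
  ∑-splits-coassoc []      f = refl
  ∑-splits-coassoc (a ∷ w) f = begin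
    ∑ (splits (a ∷ w)) (λ (u , z) → ∑ (splits u) (λ (x , y) → f x y z))
      ≈⟨ ∑-splits-∷ a w _ ⟩
    (f [] [] (a ∷ w) + 0#) + ∑ (splits w) (λ (u , z) → ∑ (splits (a ∷ u)) (λ (x , y) → f x y z))
      ≈⟨ +-cong (+-identityʳ _) (trans (∑-cong (splits w) (λ (u , z) → ∑-splits-∷ a u _)) (∑-+ (splits w) _ _)) ⟩
    f [] [] (a ∷ w) + (∑ (splits w) (λ (u , z) → f [] (a ∷ u) z) +
      ∑ (splits w) (λ (u , z) → ∑ (splits u) (λ (x , y) → f (a ∷ x) y z)))
      ≈⟨ +-congˡ (+-congˡ (∑-splits-coassoc w (f ∘ (a ∷_)))) ⟩
    f [] [] (a ∷ w) + (∑ (splits w) (λ (u , z) → f [] (a ∷ u) z) +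
      ∑ (splits w) (λ (x , u) → ∑ (splits u) (λ (y , z) → f (a ∷ x) y z)))
      ≈⟨ +-assoc _ _ _ ⟨
    _ ≈⟨ +-congʳ (∑-splits-∷ a w (λ (y , z) → f [] y z)) ⟨
    _ ≈⟨ ∑-splits-∷ a w (λ (x , u) → ∑ (splits u) (λ (y , z) → f x y z)) ⟨
    _ ∎

  conv : (List A → Carrier) → (List A → Carrier) → List A → Carrier
  conv f g w = ∑ (splits w) (λ (u , v) → f u * g v)

  conv-cong : {f f′ g g′ : List A → Carrier} → (∀ w → f w ≈ f′ w) → (∀ w → g w ≈ g′ w) →
    ∀ w → conv f g w ≈ conv f′ g′ w
  conv-cong p q w = ∑-cong (splits w) (λ (u , v) → *-cong (p u) (q v))

  conv-∷ : (f g : List A → Carrier) (x : A) (w : List A) →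
    conv f g (x ∷ w) ≈ f [] * g (x ∷ w) + conv (f ∘ (x ∷_)) g w
  conv-∷ f g x w = ∑-splits-∷ x w _

  conv-assoc : (f g h : List A → Carrier) (w : List A) →
    conv (conv f g) h w ≈ conv f (conv g h) w
  conv-assoc f g h w = begin
    ∑ (splits w) (λ (u , z) → conv f g u * h z)
      ≈⟨ ∑-cong (splits w) (λ (u , z) → sym (∑-*ʳ (h z) (splits u) _)) ⟩
    ∑ (splits w) (λ (u , z) → ∑ (splits u) (λ (x , y) → f x * g y * h z))
      ≈⟨ ∑-splits-coassoc w (λ x y z → f x * g y * h z) ⟩
    ∑ (splits w) (λ (x , u) → ∑ (splits u) (λ (y , z) → f x * g y * h z))
      ≈⟨ ∑-cong (splits w) (λ (x , u) → trans (∑-cong (splits u) (λ _ → *-assoc _ _ _)) (∑-*ˡ (f x) (splits u) _)) ⟩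
    _ ∎

  -- Induction on the length: in `conv-∷` only the first summand involves the value at the whole
  -- word. The remaining ones have `b ∘ (x ∷_)` as left factor, which need not be unital; for this
  -- reason `agree` admits an arbitrary left factor `e`.
  conv-cancelˡ : (b f g : List A → Carrier) → b [] ≈ 1# →
    (∀ w → conv b f w ≈ conv b g w) → ∀ w → f w ≈ g w
  conv-cancelˡ b f g b1 h = λ w → trans (sym (lem (f w))) (trans (step w) (lem (g w)))
    where
    lem : ∀ x → b [] * x ≈ x
    lem x = trans (*-congʳ b1) (*-identityˡ x)

    agree : ∀ w → (e : _ → Carrier) → conv e f w ≈ conv e g w
    step  : ∀ w → b [] * f w ≈ b [] * g w
    step []      = +-cancelʳ 0# _ _ (h [])
    step (x ∷ w) = +-cancelʳ (conv (b ∘ (x ∷_)) f w) _ _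
      (trans (sym (conv-∷ b f x w)) (trans (h (x ∷ w)) (trans (conv-∷ b g x w) (+-congˡ (sym (agree w _))))))
    val : ∀ w → f w ≈ g w
    val w = trans (sym (lem (f w))) (trans (step w) (lem (g w)))
    agree []      e = +-congʳ (*-congˡ (val []))
    agree (x ∷ w) e = trans (conv-∷ e f x w)
      (trans (+-cong (*-congˡ (val (x ∷ w))) (agree w (e ∘ (x ∷_)))) (sym (conv-∷ e g x w)))

  -a*-b≈a*b : ∀ a b → - a * - b ≈ a * b
  -a*-b≈a*b a b = trans (sym (-‿distribˡ-* a (- b)))
    (trans (-‿cong (sym (-‿distribʳ-* a b))) (-‿involutive _))

  sg : List A → Carrier
  sg []      = 1#
  sg (_ ∷ w) = - sg w

  sg-++ : (u v : List A) → sg (u ++ v) ≈ sg u * sg v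
  sg-++ []      v = sym (*-identityˡ _)
  sg-++ (x ∷ u) v = trans (-‿cong (sg-++ u v)) (-‿distribˡ-* _ _)

  sg-sq : (w : List A) → sg w * sg w ≈ 1#
  sg-sq []      = *-identityˡ 1#
  sg-sq (x ∷ w) = trans (-a*-b≈a*b (sg w) (sg w)) (sg-sq w)

  twist : (List A → Carrier) → List A → Carrier
  twist f w = sg w * f w

  -- Length is additive under deconcatenation, so the sign twist is an automorphism of the
  -- convolution algebra.
  conv-twist : (f g : List A → Carrier) (w : List A) → conv (twist f) (twist g) w ≈ twist (conv f g) w
  conv-twist f g []      = begin
    (1# * f []) * (1# * g []) + 0# ≈⟨ +-congʳ (*-cong (*-identityˡ _) (*-identityˡ _)) ⟩
    f [] * g [] + 0#               ≈⟨ *-identityˡ _ ⟨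
    1# * (f [] * g [] + 0#)        ∎
  conv-twist f g (x ∷ w) = begin
    conv (twist f) (twist g) (x ∷ w)
      ≈⟨ conv-∷ (twist f) (twist g) x w ⟩
    (1# * f []) * (- sg w * g (x ∷ w)) + conv (twist f ∘ (x ∷_)) (twist g) w
      ≈⟨ +-cong (trans (*-congʳ (*-identityˡ _)) (*-left-comm _ _ _))
           (trans (∑-cong (splits w) (λ (u , v) → lem₂ _ _ _)) (∑-neg (splits w) _)) ⟩
    - sg w * (f [] * g (x ∷ w)) + - conv (twist (f ∘ (x ∷_))) (twist g) w
      ≈⟨ +-congˡ (-‿cong (conv-twist (f ∘ (x ∷_)) g w)) ⟩
    - sg w * (f [] * g (x ∷ w)) + - (sg w * conv (f ∘ (x ∷_)) g w)
      ≈⟨ lem₃ _ _ _ ⟩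
    - sg w * (f [] * g (x ∷ w) + conv (f ∘ (x ∷_)) g w)
      ≈⟨ *-congˡ (conv-∷ f g x w) ⟨
    _ ∎
    where
    lem₂ : ∀ a b c → (- a * b) * c ≈ - ((a * b) * c)
    lem₂ a b c = trans (*-congʳ (sym (-‿distribˡ-* a b))) (sym (-‿distribˡ-* (a * b) c))
    lem₃ : ∀ a b c → - a * b + - (a * c) ≈ - a * (b + c)
    lem₃ a b c = trans (+-congˡ (-‿distribˡ-* a c)) (sym (distribˡ (- a) b c))

  ε : List A → Carrier
  ε []      = 1#
  ε (_ ∷ _) = 0#

Jʳ : ℕ → List ℕ → List (List ℕ)
Jʳ a []          = [ a ∷ [] ]
Jʳ a (b ∷ [])    = (b ∷ a ∷ []) ∷ (b ⊕ a ∷ []) ∷ []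
Jʳ a (b ∷ c ∷ x) = map (b ∷_) (Jʳ a (c ∷ x))

-- With indices read from the right, the part of (a ∷ c) * w in which the
-- summation variable of a bounds all those of w.
cap : ℕ → List ℕ → List ℕ → List (List ℕ)
cap a c []      = [ a ∷ c ]
cap a c (y ∷ w) = map (a ∷_) (H c (y ∷ w)) ++ map (a ⊕ y ∷_) (H c w)

-- Harmonic product: recursion at either end, reversal, deconcatenation

module Harmonic {c ℓ : Level} (R : CommutativeRing c ℓ) where
  open Summation R
  open import Relation.Binary.Reasoning.Setoid setoid

  ∑-H : ∀ k v l w (Φ : List ℕ → Carrier) → ∑ (H (k ∷ v) (l ∷ w)) Φ ≈
    ∑ (H v (l ∷ w)) (Φ ∘ (k ∷_)) + (∑ (H (k ∷ v) w) (Φ ∘ (l ∷_)) + ∑ (H v w) (Φ ∘ (k ⊕ l ∷_)))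
  ∑-H k v l w Φ = trans (∑-++ (map (k ∷_) (H v (l ∷ w))) _ Φ) (+-cong (∑-map _ (H v (l ∷ w)) Φ)
    (trans (∑-++ (map (l ∷_) (H (k ∷ v) w)) _ Φ) (+-cong (∑-map _ (H (k ∷ v) w) Φ) (∑-map _ (H v w) Φ))))

  H-[]ʳ : ∀ v → H v [] ≡ [ v ]
  H-[]ʳ []      = ≡.refl
  H-[]ʳ (k ∷ v) = ≡.refl

  ∑-H-[]ʳ : ∀ v (Φ : List ℕ → Carrier) → ∑ (H v []) Φ ≈ Φ v
  ∑-H-[]ʳ v Φ rewrite H-[]ʳ v = +-identityʳ _

  -- `H` recurses on leading entries. That the same recursion holds at the trailing entries is what
  -- makes reversal compatible with the product.
  ∑-H-∷ʳ : ∀ v a w b (Φ : List ℕ → Carrier) → ∑ (H (v ∷ʳ a) (w ∷ʳ b)) Φ ≈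
    ∑ (H v (w ∷ʳ b)) (Φ ∘ (_∷ʳ a)) + (∑ (H (v ∷ʳ a) w) (Φ ∘ (_∷ʳ b)) + ∑ (H v w) (Φ ∘ (_∷ʳ a ⊕ b)))
  ∑-H-∷ʳ [] a [] b Φ = trans (+-congˡ (+-congˡ (+-identityʳ _)))
    (trans (+-left-comm _ _ _)
      (sym (+-cong (+-identityʳ _) (+-cong (+-identityʳ _) (+-identityʳ _)))))
  ∑-H-∷ʳ [] a (l ∷ w) b Φ = begin
    ∑ (H (a ∷ []) (l ∷ w ∷ʳ b)) Φ
      ≈⟨ ∑-H a [] l (w ∷ʳ b) Φ ⟩
    _ ≈⟨ +-congˡ (+-congʳ (∑-H-∷ʳ [] a w b _)) ⟩
    _ ≈⟨ +-rearrange-5 _ _ _ _ _ ⟩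
    _ ≈⟨ +-congˡ (+-congʳ (∑-H a [] l w _)) ⟨
    _ ∎
  ∑-H-∷ʳ (k ∷ v) a [] b Φ = begin
    ∑ (H (k ∷ v ∷ʳ a) (b ∷ [])) Φ
      ≈⟨ ∑-H k (v ∷ʳ a) b [] Φ ⟩
    _ ≈⟨ +-cong (trans (∑-H-∷ʳ v a [] b _) (+-congˡ (+-cong (∑-H-[]ʳ (v ∷ʳ a) _) (∑-H-[]ʳ v _))))
                (+-cong (+-identityʳ _) (∑-H-[]ʳ (v ∷ʳ a) _)) ⟩
    _ ≈⟨ +-right-comm _ _ _ ⟩
    _ ≈⟨ +-cong (trans (∑-H k v b [] _) (+-congˡ (+-cong (+-identityʳ _) (∑-H-[]ʳ v _))))
                (+-cong (+-identityʳ _) (+-identityʳ _)) ⟨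
    _ ∎
  ∑-H-∷ʳ (k ∷ v) a (l ∷ w) b Φ = begin
    ∑ (H (k ∷ v ∷ʳ a) (l ∷ w ∷ʳ b)) Φ
      ≈⟨ ∑-H k (v ∷ʳ a) l (w ∷ʳ b) Φ ⟩
    _ ≈⟨ +-cong (∑-H-∷ʳ v a (l ∷ w) b _) (+-cong (∑-H-∷ʳ (k ∷ v) a w b _) (∑-H-∷ʳ v a w b _)) ⟩
    _ ≈⟨ +-transpose _ _ _ _ _ _ _ _ _ ⟩
    _ ≈⟨ +-cong (∑-H k v l (w ∷ʳ b) _) (+-cong (∑-H k (v ∷ʳ a) l w _) (∑-H k v l w _)) ⟨
    _ ∎

  ∑-H-reverse : ∀ v w (Φ : List ℕ → Carrier) →
    ∑ (H (reverse v) (reverse w)) Φ ≈ ∑ (H v w) (Φ ∘ reverse)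
  ∑-H-reverse []      w       Φ = refl
  ∑-H-reverse (k ∷ v) []      Φ = trans (∑-H-[]ʳ (reverse (k ∷ v)) Φ) (sym (+-identityʳ _))
  ∑-H-reverse (k ∷ v) (l ∷ w) Φ = begin
    ∑ (H (reverse (k ∷ v)) (reverse (l ∷ w))) Φ
      ≡⟨ ≡.cong₂ (λ x y → ∑ (H x y) Φ) (unfold-reverse k v) (unfold-reverse l w) ⟩
    ∑ (H (reverse v ∷ʳ k) (reverse w ∷ʳ l)) Φ
      ≈⟨ ∑-H-∷ʳ (reverse v) k (reverse w) l Φ ⟩
    ∑ (H (reverse v) (reverse w ∷ʳ l)) (Φ ∘ (_∷ʳ k)) + (∑ (H (reverse v ∷ʳ k) (reverse w)) (Φ ∘ (_∷ʳ l)) +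
      ∑ (H (reverse v) (reverse w)) (Φ ∘ (_∷ʳ k ⊕ l)))
      ≡⟨ ≡.cong₂ (λ x y → ∑ (H (reverse v) x) (Φ ∘ (_∷ʳ k)) + (∑ (H y (reverse w)) (Φ ∘ (_∷ʳ l)) +
           ∑ (H (reverse v) (reverse w)) (Φ ∘ (_∷ʳ k ⊕ l)))) (unfold-reverse l w) (unfold-reverse k v) ⟨
    _ ≈⟨ +-cong (unsnoc v (l ∷ w) k) (+-cong (unsnoc (k ∷ v) w l) (unsnoc v w (k ⊕ l))) ⟩
    _ ≈⟨ ∑-H k v l w (Φ ∘ reverse) ⟨
    _ ∎
    where
    unsnoc : ∀ v w k → ∑ (H (reverse v) (reverse w)) (Φ ∘ (_∷ʳ k)) ≈ ∑ (H v w) (Φ ∘ reverse ∘ (k ∷_))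
    unsnoc v w k = trans (∑-H-reverse v w _)
      (∑-cong (H v w) (λ u → reflexive (≡.cong Φ (≡.sym (unfold-reverse k u)))))

  -- Deconcatenation is a homomorphism for the harmonic product (the quasi-shuffle bialgebra). Hence
  -- a convolution of multiplicative functionals is multiplicative.
  ∑-H-splits : ∀ v w (Ψ : List ℕ → List ℕ → Carrier) →
    ∑ (H v w) (λ u → ∑ (splits u) (λ (x , y) → Ψ x y)) ≈
    ∑ (splits v) (λ (v₁ , v₂) → ∑ (splits w) (λ (w₁ , w₂) → ∑ (H v₁ w₁) (λ x → ∑ (H v₂ w₂) (Ψ x))))
  ∑-H-splits [] w Ψ = +-congʳ (∑-cong (splits w) (λ _ → sym (trans (+-identityʳ _) (+-identityʳ _))))
  ∑-H-splits (k ∷ v) [] Ψ = trans (+-identityʳ _) (∑-cong (splits (k ∷ v))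
    (λ (x , y) → sym (trans (+-identityʳ _) (trans (∑-H-[]ʳ x _) (∑-H-[]ʳ y _)))))
  ∑-H-splits (k ∷ v) (l ∷ w) Ψ = begin
    ∑ (H (k ∷ v) (l ∷ w)) D
      ≈⟨ ∑-H k v l w D ⟩
    ∑ (H v (l ∷ w)) (D ∘ (k ∷_)) + (∑ (H (k ∷ v) w) (D ∘ (l ∷_)) + ∑ (H v w) (D ∘ (k ⊕ l ∷_)))
      ≈⟨ +-cong (peel v (l ∷ w) k) (+-cong (peel (k ∷ v) w l) (peel v w (k ⊕ l))) ⟩
    (_ + I (k ∷_) v (l ∷ w)) + ((_ + I (l ∷_) (k ∷ v) w) + (_ + I (k ⊕ l ∷_) v w))
      ≈⟨ +-cong (+-congˡ Q₁) (+-congʳ (+-congˡ Q₂)) ⟩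
    _ ≈⟨ +-rearrange-8 _ _ _ _ _ _ _ _ ⟩
    _ ≈⟨ +-cong (+-congʳ (trans (+-identityʳ _) (∑-H k v l w _))) (trans (∑-+ (splits v) _ _) (+-cong refl bulk)) ⟨
    _ ≈⟨ +-cong (∑-splits-∷ l w _) (∑-cong (splits v) (λ (v₁ , v₂) → trans (∑-splits-∷ l w _) (+-congʳ (+-identityʳ _)))) ⟨
    _ ≈⟨ ∑-splits-∷ k v _ ⟨
    _ ∎
    where
    D : List ℕ → Carrier
    D u = ∑ (splits u) (λ (x , y) → Ψ x y)
    I : (List ℕ → List ℕ) → List ℕ → List ℕ → Carrier
    I f v w = ∑ (splits v) (λ (v₁ , v₂) → ∑ (splits w) (λ (w₁ , w₂) → ∑ (H v₁ w₁) (λ x → ∑ (H v₂ w₂) (Ψ (f x)))))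
    peel : ∀ v w k → ∑ (H v w) (D ∘ (k ∷_)) ≈ ∑ (H v w) (Ψ [] ∘ (k ∷_)) + I (k ∷_) v w
    peel v w k = trans (∑-cong (H v w) (λ u → ∑-splits-∷ k u _))
      (trans (∑-+ (H v w) _ _) (+-congˡ (∑-H-splits v w (Ψ ∘ (k ∷_)))))
    Q₁ : I (k ∷_) v (l ∷ w) ≈ ∑ (splits v) (λ (v₁ , v₂) → ∑ (H v₂ (l ∷ w)) (Ψ (k ∷ v₁))) +
      ∑ (splits v) (λ (v₁ , v₂) → ∑ (splits w) (λ (w₁ , w₂) → ∑ (H v₁ (l ∷ w₁)) (λ x → ∑ (H v₂ w₂) (Ψ (k ∷ x)))))
    Q₁ = trans (∑-cong (splits v) (λ (v₁ , v₂) → trans (∑-splits-∷ l w _) (+-congʳ (∑-H-[]ʳ v₁ _)))) (∑-+ (splits v) _ _)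
    Q₂ : I (l ∷_) (k ∷ v) w ≈ ∑ (splits w) (λ (w₁ , w₂) → ∑ (H [] (l ∷ w₁)) (λ x → ∑ (H (k ∷ v) w₂) (Ψ x))) +
      ∑ (splits v) (λ (v₁ , v₂) → ∑ (splits w) (λ (w₁ , w₂) → ∑ (H (k ∷ v₁) w₁) (λ x → ∑ (H v₂ w₂) (Ψ (l ∷ x)))))
    Q₂ = ∑-splits-∷ k v _
    bulk : ∑ (splits v) (λ (v₁ , v₂) → ∑ (splits w) (λ (w₁ , w₂) → ∑ (H (k ∷ v₁) (l ∷ w₁)) (λ x → ∑ (H v₂ w₂) (Ψ x)))) ≈
      ∑ (splits v) (λ (v₁ , v₂) → ∑ (splits w) (λ (w₁ , w₂) → ∑ (H v₁ (l ∷ w₁)) (λ x → ∑ (H v₂ w₂) (Ψ (k ∷ x))))) +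
      (∑ (splits v) (λ (v₁ , v₂) → ∑ (splits w) (λ (w₁ , w₂) → ∑ (H (k ∷ v₁) w₁) (λ x → ∑ (H v₂ w₂) (Ψ (l ∷ x))))) + I (k ⊕ l ∷_) v w)
    bulk = trans (∑-cong (splits v) (λ (v₁ , v₂) → trans (∑-cong (splits w) (λ (w₁ , w₂) → ∑-H k v₁ l w₁ _))
      (trans (∑-+ (splits w) _ _) (+-congˡ (∑-+ (splits w) _ _)))))
      (trans (∑-+ (splits v) _ _) (+-congˡ (∑-+ (splits v) _ _)))

  -- Merging is associative, so it does not matter whether `l` or `k` is merged first. Summed over
  -- `S`, this is the comma-or-plus recursion of `starC`.
  J-J : ∀ k l x (Φ : List ℕ → Carrier) →
    ∑ (J l x) (λ y → ∑ (J k y) Φ) ≈ ∑ (J l x) (Φ ∘ (k ∷_)) + ∑ (J (k ⊕ l) x) Φ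
  J-J k l []      Φ = trans (+-identityʳ _) (trans (+-congˡ (+-identityʳ _)) (sym (+-cong (+-identityʳ _) (+-identityʳ _))))
  J-J k l (a ∷ x) Φ rewrite ⊕-assoc k l a = trans (+-congˡ (+-identityʳ _)) (+-rearrange-5′ _ _ _ _ _)

  ∑-S-∷ : ∀ k v (Φ : List ℕ → Carrier) → ∑ (S (k ∷ v)) Φ ≈ ∑ (S v) (λ x → ∑ (J k x) Φ)
  ∑-S-∷ k v Φ = ∑-concatMap (J k) (S v) Φ

-- Star sums: reversal, star-harmonic product, bounded parts

⊕-left-comm : ∀ j k l → j ⊕ (k ⊕ l) ≡ k ⊕ (j ⊕ l)
⊕-left-comm j k l = ≡.trans (≡.sym (⊕-assoc j k l)) (≡.trans (≡.cong (_⊕ l) (⊕-comm j k)) (⊕-assoc k j l))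

⊕-right-comm : ∀ j k l → (j ⊕ k) ⊕ l ≡ (j ⊕ l) ⊕ k
⊕-right-comm j k l = ≡.trans (⊕-assoc j k l) (≡.trans (≡.cong (j ⊕_) (⊕-comm k l)) (≡.sym (⊕-assoc j l k)))

Jʳ-∷ʳ : ∀ a y b → Jʳ a (y ∷ʳ b) ≡ ((y ∷ʳ b) ∷ʳ a) ∷ (y ∷ʳ b ⊕ a) ∷ []
Jʳ-∷ʳ a []          b = ≡.refl
Jʳ-∷ʳ a (c ∷ [])    b = ≡.refl
Jʳ-∷ʳ a (c ∷ d ∷ y) b = ≡.cong (map (c ∷_)) (Jʳ-∷ʳ a (d ∷ y) b)

module Star {c ℓ : Level} (R : CommutativeRing c ℓ) where
  open Summation R
  open Harmonic R
  open import Relation.Binary.Reasoning.Setoid setoid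

  a+[b+0]≈a+b : ∀ {a b} → a + (b + 0#) ≈ a + b
  a+[b+0]≈a+b = +-congˡ (+-identityʳ _)

  -- The operations act at opposite ends; only in a list of at most one entry do they meet, and
  -- merging is associative.
  J-Jʳ-comm : ∀ k a x (Φ : List ℕ → Carrier) →
    ∑ (Jʳ a x) (λ y → ∑ (J k y) Φ) ≈ ∑ (J k x) (λ y → ∑ (Jʳ a y) Φ)
  J-Jʳ-comm k a []          Φ = refl
  J-Jʳ-comm k a (b ∷ [])    Φ rewrite ⊕-assoc k b a = begin
    _ ≈⟨ +-congˡ (+-identityʳ _) ⟩
    _ ≈⟨ +-rearrange-5′ _ _ _ _ _ ⟩
    _ ≈⟨ +-congˡ (+-identityʳ _) ⟨
    _ ∎
  J-Jʳ-comm k a (b ∷ d ∷ x) Φ = begin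
    ∑ (map (b ∷_) X) (λ y → ∑ (J k y) Φ)
      ≈⟨ ∑-map (b ∷_) X _ ⟩
    ∑ X (λ z → ∑ (J k (b ∷ z)) Φ)
      ≈⟨ ∑-cong X (λ z → a+[b+0]≈a+b) ⟩
    ∑ X (λ z → Φ (k ∷ b ∷ z) + Φ (k ⊕ b ∷ z))
      ≈⟨ ∑-+ X _ _ ⟩
    ∑ X (λ z → Φ (k ∷ b ∷ z)) + ∑ X (λ z → Φ (k ⊕ b ∷ z))
      ≈⟨ +-cong (trans (∑-map (k ∷_) (map (b ∷_) X) Φ) (∑-map (b ∷_) X _)) (∑-map (k ⊕ b ∷_) X Φ) ⟨
    _ ≈⟨ a+[b+0]≈a+b ⟨
    _ ∎
    where X = Jʳ a (d ∷ x)

  ∑-S-∷ʳ : ∀ v a (Φ : List ℕ → Carrier) → ∑ (S (v ∷ʳ a)) Φ ≈ ∑ (S v) (λ x → ∑ (Jʳ a x) Φ)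
  ∑-S-∷ʳ []      a Φ = sym (+-identityʳ _)
  ∑-S-∷ʳ (k ∷ v) a Φ = begin
    ∑ (S (k ∷ v ∷ʳ a)) Φ                              ≈⟨ ∑-S-∷ k (v ∷ʳ a) Φ ⟩
    ∑ (S (v ∷ʳ a)) (λ x → ∑ (J k x) Φ)                ≈⟨ ∑-S-∷ʳ v a _ ⟩
    ∑ (S v) (λ x → ∑ (Jʳ a x) (λ y → ∑ (J k y) Φ))    ≈⟨ ∑-cong (S v) (λ x → J-Jʳ-comm k a x Φ) ⟩
    ∑ (S v) (λ x → ∑ (J k x) (λ y → ∑ (Jʳ a y) Φ))    ≈⟨ ∑-S-∷ k v _ ⟨
    ∑ (S (k ∷ v)) (λ y → ∑ (Jʳ a y) Φ)                ∎

  ∑-Jʳ-reverse : ∀ a x (Φ : List ℕ → Carrier) → ∑ (Jʳ a (reverse x)) Φ ≈ ∑ (J a x) (Φ ∘ reverse)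
  ∑-Jʳ-reverse a []      Φ = refl
  ∑-Jʳ-reverse a (b ∷ x) Φ = begin
    ∑ (Jʳ a (reverse (b ∷ x))) Φ
      ≡⟨ ≡.cong (λ z → ∑ (Jʳ a z) Φ) (unfold-reverse b x) ⟩
    ∑ (Jʳ a (reverse x ∷ʳ b)) Φ
      ≡⟨ ≡.cong (λ z → ∑ z Φ) (Jʳ-∷ʳ a (reverse x) b) ⟩
    Φ ((reverse x ∷ʳ b) ∷ʳ a) + (Φ (reverse x ∷ʳ b ⊕ a) + 0#)
      ≡⟨ ≡.cong₂ (λ y z → Φ y + (Φ z + 0#))
           (≡.trans (≡.cong (_∷ʳ a) (≡.sym (unfold-reverse b x))) (≡.sym (unfold-reverse a (b ∷ x))))
           (≡.trans (≡.cong (reverse x ∷ʳ_) (⊕-comm b a)) (≡.sym (unfold-reverse (a ⊕ b) x))) ⟩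
    ∑ (J a (b ∷ x)) (Φ ∘ reverse) ∎

  ∑-S-reverse : ∀ v (Φ : List ℕ → Carrier) → ∑ (S (reverse v)) Φ ≈ ∑ (S v) (Φ ∘ reverse)
  ∑-S-reverse []      Φ = refl
  ∑-S-reverse (k ∷ v) Φ = begin
    ∑ (S (reverse (k ∷ v))) Φ                      ≡⟨ ≡.cong (λ z → ∑ (S z) Φ) (unfold-reverse k v) ⟩
    ∑ (S (reverse v ∷ʳ k)) Φ                       ≈⟨ ∑-S-∷ʳ (reverse v) k Φ ⟩
    ∑ (S (reverse v)) (λ x → ∑ (Jʳ k x) Φ)         ≈⟨ ∑-S-reverse v _ ⟩
    ∑ (S v) (λ x → ∑ (Jʳ k (reverse x)) Φ)         ≈⟨ ∑-cong (S v) (λ x → ∑-Jʳ-reverse k x Φ) ⟩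
    ∑ (S v) (λ x → ∑ (J k x) (Φ ∘ reverse))        ≈⟨ ∑-S-∷ k v _ ⟨
    ∑ (S (k ∷ v)) (Φ ∘ reverse)                    ∎

  ∑-H-J : ∀ k a x b y (Φ : List ℕ → Carrier) → ∑ (H (a ∷ x) (b ∷ y)) (λ u → ∑ (J k u) Φ) ≈
    ∑ (H (a ∷ x) (b ∷ y)) (Φ ∘ (k ∷_)) + (∑ (H x (b ∷ y)) (Φ ∘ (k ⊕ a ∷_)) +
      (∑ (H (a ∷ x) y) (Φ ∘ (k ⊕ b ∷_)) + ∑ (H x y) (Φ ∘ (k ⊕ (a ⊕ b) ∷_))))
  ∑-H-J k a x b y Φ = begin
    ∑ (H (a ∷ x) (b ∷ y)) (λ u → ∑ (J k u) Φ)
      ≈⟨ ∑-H a x b y _ ⟩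
    _ ≈⟨ +-cong (pull (H x (b ∷ y))) (+-cong (pull (H (a ∷ x) y)) (pull (H x y))) ⟩
    _ ≈⟨ shape _ _ _ _ _ _ ⟩
    _ ≈⟨ +-congʳ (∑-H a x b y _) ⟨
    _ ∎
    where
    pull : ∀ X {a} → ∑ X (λ u → ∑ (J k (a ∷ u)) Φ) ≈ ∑ X (λ u → Φ (k ∷ a ∷ u)) + ∑ X (λ u → Φ (k ⊕ a ∷ u))
    pull X = trans (∑-cong X (λ u → a+[b+0]≈a+b)) (∑-+ X _ _)
    shape : ∀ p q r s t u → (p + q) + ((r + s) + (t + u)) ≈ (p + (r + t)) + (q + (s + u))
    shape p q r s t u = trans (+-congˡ (+-interchange r s t u)) (+-interchange p q (r + t) (s + u))

  private
    at : ∀ {m n} X (Φ : List ℕ → Carrier) → m ≡ n → ∑ X (Φ ∘ (m ∷_)) ≈ ∑ X (Φ ∘ (n ∷_))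
    at X Φ ≡.refl = refl

  -- Rota-Baxter identity of non-strict summation. In a product of two such sums the outermost
  -- variables, those of `k` and `l`, are weakly ordered one way or the other; the two cases on the
  -- right overlap in the diagonal, which is the term with `k ⊕ l`.
  H-J-J : ∀ k l x y (Φ : List ℕ → Carrier) →
    ∑ (J k x) (λ x′ → ∑ (J l y) (λ y′ → ∑ (H x′ y′) Φ)) + ∑ (H x y) (λ u → ∑ (J (k ⊕ l) u) Φ) ≈
    ∑ (J l y) (λ y′ → ∑ (H x y′) (λ u → ∑ (J k u) Φ)) + ∑ (J k x) (λ x′ → ∑ (H x′ y) (λ u → ∑ (J l u) Φ))
  H-J-J k l [] [] Φ = begin
    _ ≈⟨ +-cong (trans (trans (+-identityʳ _) (+-identityʳ _)) (+-congˡ (+-congˡ (+-identityʳ _))))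
                (trans (+-identityʳ _) (+-identityʳ _)) ⟩
    _ ≈⟨ +-rearrange-3 _ _ _ ⟩
    _ ≈⟨ +-congˡ (+-congˡ (reflexive (≡.cong (Φ ∘ [_]) (⊕-comm k l)))) ⟩
    _ ≈⟨ +-cong (trans (trans (+-identityʳ _) (+-identityʳ _)) (+-congˡ (+-identityʳ _)))
                (trans (trans (+-identityʳ _) (+-identityʳ _)) (+-congˡ (+-identityʳ _))) ⟨
    _ ∎
  H-J-J k l [] (b ∷ y) Φ = begin
    _ ≈⟨ +-cong (trans (+-identityʳ _) (trans a+[b+0]≈a+b (+-cong
           (trans (∑-H k [] l (b ∷ y) Φ) (+-cong (+-identityʳ _) (+-congˡ (+-identityʳ _))))
           (trans (∑-H k [] (l ⊕ b) y Φ) (+-cong (+-identityʳ _) (+-congˡ (+-identityʳ _)))))))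
         (trans (+-identityʳ _) (trans a+[b+0]≈a+b (+-congˡ (reflexive (≡.cong (Φ ∘ (_∷ y)) (⊕-assoc k l b)))))) ⟩
    _ ≈⟨ +-rearrange-6 _ _ _ _ _ _ ⟩
    _ ≈⟨ +-cong (trans a+[b+0]≈a+b (+-cong (trans (+-identityʳ _) a+[b+0]≈a+b) (trans (+-identityʳ _) a+[b+0]≈a+b)))
         (trans (+-identityʳ _) (trans (∑-H-J l k [] b y Φ) (+-congˡ (+-cong
           (trans (+-identityʳ _) (reflexive (≡.cong (Φ ∘ (_∷ b ∷ y)) (⊕-comm l k))))
           (+-congˡ (trans (+-identityʳ _) (reflexive (≡.cong (Φ ∘ (_∷ y)) (⊕-left-comm l k b))))))))) ⟨
    _ ∎
  H-J-J k l (a ∷ x) [] Φ = begin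
    _ ≈⟨ +-cong (trans a+[b+0]≈a+b (+-cong
           (trans (+-identityʳ _) (trans (∑-H k (a ∷ x) l [] Φ) (+-congˡ (+-cong (+-identityʳ _) (+-identityʳ _)))))
           (trans (+-identityʳ _) (trans (∑-H (k ⊕ a) x l [] Φ) (+-congˡ (+-cong (+-identityʳ _)
             (trans (∑-H-[]ʳ x _) (reflexive (≡.cong (Φ ∘ (_∷ x)) (⊕-right-comm k a l))))))))))
         (trans (+-identityʳ _) a+[b+0]≈a+b) ⟩
    _ ≈⟨ +-rearrange-6′ _ _ _ _ _ _ ⟩
    _ ≈⟨ +-cong (trans (+-identityʳ _) (trans (∑-H-J k a x l [] Φ) (+-congˡ (+-congˡ (+-cong (+-identityʳ _)
             (trans (∑-H-[]ʳ x _) (reflexive (≡.cong (Φ ∘ (_∷ x)) (≡.trans (≡.cong (k ⊕_) (⊕-comm a l)) (≡.sym (⊕-assoc k l a)))))))))))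
         (trans a+[b+0]≈a+b (+-cong
           (trans (+-identityʳ _) (trans a+[b+0]≈a+b (+-congˡ (reflexive (≡.cong (Φ ∘ (_∷ a ∷ x)) (⊕-comm l k))))))
           (trans (+-identityʳ _) (trans a+[b+0]≈a+b (+-congˡ (reflexive (≡.cong (Φ ∘ (_∷ x))
             (≡.trans (≡.sym (⊕-assoc l k a)) (≡.cong (_⊕ a) (⊕-comm l k)))))))))) ⟨
    _ ∎
  H-J-J k l (a ∷ x) (b ∷ y) Φ = begin
    _ ≈⟨ +-cong (trans a+[b+0]≈a+b (+-cong
           (trans a+[b+0]≈a+b (+-cong (∑-H k (a ∷ x) l (b ∷ y) Φ) (∑-H k (a ∷ x) (l ⊕ b) y Φ)))
           (trans a+[b+0]≈a+b (+-cong
             (trans (∑-H (k ⊕ a) x l (b ∷ y) Φ) (+-congˡ (+-congˡ (at (H x (b ∷ y)) Φ (⊕-right-comm k a l)))))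
             (trans (∑-H (k ⊕ a) x (l ⊕ b) y Φ) (+-congˡ (+-congˡ (at (H x y) Φ e₁))))))))
         (trans (∑-H-J (k ⊕ l) a x b y Φ) (+-congˡ (+-congˡ (+-congʳ (at (H (a ∷ x) y) Φ (⊕-assoc k l b)))))) ⟩
    _ ≈⟨ +-rearrange-12 _ _ _ _ _ _ _ _ _ _ _ _ ⟩
    _ ≈⟨ +-cong (trans a+[b+0]≈a+b (+-cong
           (trans (∑-H-J k a x l (b ∷ y) Φ) (+-congˡ (+-congˡ (+-congˡ (at (H x (b ∷ y)) Φ e₂)))))
           (trans (∑-H-J k a x (l ⊕ b) y Φ) (+-congˡ (+-congˡ (+-congˡ (at (H x y) Φ e₃)))))))
         (trans a+[b+0]≈a+b (+-cong
           (trans (∑-H-J l k (a ∷ x) b y Φ) (+-congˡ (+-cong (at (H (a ∷ x) (b ∷ y)) Φ (⊕-comm l k))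
             (+-congˡ (at (H (a ∷ x) y) Φ (⊕-left-comm l k b))))))
           (trans (∑-H-J l (k ⊕ a) x b y Φ) (+-congˡ (+-cong (at (H x (b ∷ y)) Φ e₄)
             (+-congˡ (at (H x y) Φ e₅))))))) ⟨
    _ ∎
    where
    e₁ : (k ⊕ a) ⊕ (l ⊕ b) ≡ (k ⊕ l) ⊕ (a ⊕ b)
    e₁ = ≡.trans (⊕-assoc k a (l ⊕ b)) (≡.trans (≡.cong (k ⊕_) (⊕-left-comm a l b)) (≡.sym (⊕-assoc k l (a ⊕ b))))
    e₂ : k ⊕ (a ⊕ l) ≡ (k ⊕ l) ⊕ a
    e₂ = ≡.trans (≡.sym (⊕-assoc k a l)) (⊕-right-comm k a l)
    e₃ : k ⊕ (a ⊕ (l ⊕ b)) ≡ (k ⊕ l) ⊕ (a ⊕ b)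
    e₃ = ≡.trans (≡.sym (⊕-assoc k a (l ⊕ b))) e₁
    e₄ : l ⊕ (k ⊕ a) ≡ (k ⊕ l) ⊕ a
    e₄ = ≡.trans (≡.sym (⊕-assoc l k a)) (≡.cong (_⊕ a) (⊕-comm l k))
    e₅ : l ⊕ ((k ⊕ a) ⊕ b) ≡ (k ⊕ l) ⊕ (a ⊕ b)
    e₅ = ≡.trans (⊕-left-comm l (k ⊕ a) b) e₁

  private
    signs : ∀ s t a b c d → d + c ≈ a + b →
      - (s * - t * a) + (- (- s * t * b) + - (s * t * c)) ≈ (- s * - t) * d
    signs s t a b c d h = begin
      - (s * - t * a) + (- (- s * t * b) + - (s * t * c))
        ≈⟨ +-cong (neg (*-congʳ (sym (-‿distribʳ-* s t)))) (+-congʳ (neg (*-congʳ (sym (-‿distribˡ-* s t))))) ⟩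
      s * t * a + (s * t * b + - (s * t * c))
        ≈⟨ +-assoc _ _ _ ⟨
      s * t * a + s * t * b + - (s * t * c)
        ≈⟨ +-congʳ (distribˡ (s * t) a b) ⟨
      s * t * (a + b) + - (s * t * c)
        ≈⟨ +-congʳ (*-congˡ (sym h)) ⟩
      s * t * (d + c) + - (s * t * c)
        ≈⟨ trans (+-congʳ (distribˡ (s * t) d c)) (+-assoc _ _ _) ⟩
      s * t * d + (s * t * c + - (s * t * c))
        ≈⟨ trans (+-congˡ (-‿inverseʳ _)) (+-identityʳ _) ⟩
      s * t * d
        ≈⟨ *-congʳ (-a*-b≈a*b s t) ⟨
      (- s * - t) * d ∎
      where
      neg : ∀ {x u a} → x * a ≈ - u * a → - (x * a) ≈ u * a
      neg p = trans (-‿cong (trans p (sym (-‿distribˡ-* _ _)))) (-‿involutive _)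

  -- Merging two entries shortens the index by one and so reverses the sign of the diagonal term,
  -- which is the correction that `H-J-J` requires. Hence star sums multiply by the star-harmonic
  -- product.
  ∑-H-S : ∀ v w (Φ : List ℕ → Carrier) → ∑ (H v w) (λ u → sg u * ∑ (S u) Φ) ≈
    sg v * sg w * ∑ (S v) (λ x → ∑ (S w) (λ y → ∑ (H x y) Φ))
  ∑-H-S [] w Φ = begin
    sg w * ∑ (S w) Φ + 0#
      ≈⟨ +-identityʳ _ ⟩
    sg w * ∑ (S w) Φ
      ≈⟨ *-cong (*-identityˡ _) (trans (+-identityʳ _) (∑-cong (S w) (λ y → +-identityʳ _))) ⟨
    1# * sg w * (∑ (S w) (λ y → Φ y + 0#) + 0#) ∎
  ∑-H-S (k ∷ v) [] Φ = begin
    sg (k ∷ v) * ∑ (S (k ∷ v)) Φ + 0#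
      ≈⟨ +-identityʳ _ ⟩
    sg (k ∷ v) * ∑ (S (k ∷ v)) Φ
      ≈⟨ *-cong (*-identityʳ _) (∑-cong (S (k ∷ v)) (λ x → trans (+-identityʳ _) (∑-H-[]ʳ x Φ))) ⟨
    sg (k ∷ v) * 1# * ∑ (S (k ∷ v)) (λ x → ∑ (H x []) Φ + 0#) ∎
  ∑-H-S (k ∷ v) (l ∷ w) Φ = begin
    ∑ (H (k ∷ v) (l ∷ w)) (λ u → sg u * ∑ (S u) Φ)
      ≈⟨ ∑-H k v l w _ ⟩
    _ ≈⟨ +-cong (peel k v (l ∷ w)) (+-cong (peel l (k ∷ v) w) (peel (k ⊕ l) v w)) ⟩
    _ ≈⟨ signs (sg v) (sg w) _ _ _ _ main ⟩
    sg (k ∷ v) * sg (l ∷ w) * ∑ (S (k ∷ v)) (λ x → ∑ (S (l ∷ w)) (λ y → ∑ (H x y) Φ)) ∎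
    where
    peel : ∀ m v w → ∑ (H v w) (λ u → sg (m ∷ u) * ∑ (S (m ∷ u)) Φ) ≈
      - (sg v * sg w * ∑ (S v) (λ x → ∑ (S w) (λ y → ∑ (H x y) (λ u → ∑ (J m u) Φ))))
    peel m v w = begin
      ∑ (H v w) (λ u → - sg u * ∑ (S (m ∷ u)) Φ)
        ≈⟨ ∑-cong (H v w) (λ u → trans (*-congˡ (∑-S-∷ m u Φ)) (sym (-‿distribˡ-* _ _))) ⟩
      ∑ (H v w) (λ u → - (sg u * ∑ (S u) (λ x → ∑ (J m x) Φ)))
        ≈⟨ ∑-neg (H v w) _ ⟩
      - ∑ (H v w) (λ u → sg u * ∑ (S u) (λ x → ∑ (J m x) Φ))
        ≈⟨ -‿cong (∑-H-S v w _) ⟩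
      _ ∎
    main : ∑ (S (k ∷ v)) (λ x → ∑ (S (l ∷ w)) (λ y → ∑ (H x y) Φ)) +
        ∑ (S v) (λ x → ∑ (S w) (λ y → ∑ (H x y) (λ u → ∑ (J (k ⊕ l) u) Φ))) ≈
      ∑ (S v) (λ x → ∑ (S (l ∷ w)) (λ y → ∑ (H x y) (λ u → ∑ (J k u) Φ))) +
        ∑ (S (k ∷ v)) (λ x → ∑ (S w) (λ y → ∑ (H x y) (λ u → ∑ (J l u) Φ)))
    main = begin
      _ ≈⟨ +-congʳ (trans (∑-S-∷ k v _) (∑-cong (S v) (λ x →
             trans (∑-cong (J k x) (λ x′ → ∑-S-∷ l w _)) (∑-swap (J k x) (S w) _)))) ⟩
      _ ≈⟨ trans (sym (∑-+ (S v) _ _)) (∑-cong (S v) (λ x → sym (∑-+ (S w) _ _))) ⟩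
      _ ≈⟨ ∑-cong (S v) (λ x → ∑-cong (S w) (λ y → H-J-J k l x y Φ)) ⟩
      _ ≈⟨ trans (∑-cong (S v) (λ x → ∑-+ (S w) _ _)) (∑-+ (S v) _ _) ⟩
      _ ≈⟨ +-cong (∑-cong (S v) (λ x → ∑-S-∷ l w _))
             (trans (∑-S-∷ k v _) (∑-cong (S v) (λ x → ∑-swap (J k x) (S w) _))) ⟨
      _ ∎

  ∑-cap-∷ : ∀ a c y w (Φ : List ℕ → Carrier) →
    ∑ (cap a c (y ∷ w)) Φ ≈ ∑ (H c (y ∷ w)) (Φ ∘ (a ∷_)) + ∑ (H c w) (Φ ∘ (a ⊕ y ∷_))
  ∑-cap-∷ a c y w Φ = trans (∑-++ (map (a ∷_) (H c (y ∷ w))) _ Φ) (+-cong (∑-map _ (H c (y ∷ w)) Φ) (∑-map _ (H c w) Φ))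

  -- Dichotomy: the variable of `a` weakly bounds that of `x`, or is strictly bounded by it. Summed
  -- over `S`, this becomes the recursion that `ladder` solves.
  cap-step : ∀ a c x w (Φ : List ℕ → Carrier) →
    ∑ (J x w) (λ u → ∑ (cap a c u) Φ) + ∑ (cap x (a ∷ c) w) Φ ≈ ∑ (J x w) (λ u → ∑ (H (a ∷ c) u) Φ)
  cap-step a c x [] Φ = begin
    _ ≈⟨ +-congʳ (trans (+-identityʳ _) (∑-cap-∷ a c x [] Φ)) ⟩
    _ ≈⟨ trans (+-assoc _ _ _) (+-congˡ (+-comm _ _)) ⟩
    _ ≈⟨ trans (+-identityʳ _) (∑-H a c x [] Φ) ⟨
    _ ∎
  cap-step a c x (y ∷ w) Φ = begin
    _ ≈⟨ +-cong (trans a+[b+0]≈a+b (+-cong (∑-cap-∷ a c x (y ∷ w) Φ) (∑-cap-∷ a c (x ⊕ y) w Φ)))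
           (∑-cap-∷ x (a ∷ c) y w Φ) ⟩
    _ ≈⟨ +-rearrange-6″ _ _ _ _ _ _ ⟩
    _ ≈⟨ trans a+[b+0]≈a+b (+-cong (∑-H a c x (y ∷ w) Φ) (∑-H a c (x ⊕ y) w Φ)) ⟨
    _ ∎

  ∑-S-cap : ∀ a c x v (Φ : List ℕ → Carrier) →
    ∑ (S (x ∷ v)) (λ w → ∑ (cap a c w) Φ) + ∑ (S v) (λ w → ∑ (cap x (a ∷ c) w) Φ) ≈
    ∑ (S (x ∷ v)) (λ w → ∑ (H (a ∷ c) w) Φ)
  ∑-S-cap a c x v Φ = begin
    _ ≈⟨ +-congʳ (∑-S-∷ x v _) ⟩
    _ ≈⟨ ∑-+ (S v) _ _ ⟨
    _ ≈⟨ ∑-cong (S v) (λ w → cap-step a c x w Φ) ⟩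
    _ ≈⟨ ∑-S-∷ x v _ ⟨
    _ ∎

-- A ribbon poset x₁, x₂, …, x_n, in which x_{i+1} lies above x_i if it is
-- labelled e₀ and below x_i if it is labelled e₁, is encoded by the word y of
-- the labels of x₂, …, x_n.  ribbon y lists its linear extensions as the pairs
-- (labels below x₁ , labels above x₁).
ribbon : Word → List (Word × Word)
ribbon []       = [ [] , [] ]
ribbon (x0 ∷ y) = concatMap (λ (p , s) → map (λ (p₁ , p₂) → (p₁ , p₂ ++ x0 ∷ s)) (splits p)) (ribbon y)
ribbon (x1 ∷ y) = concatMap (λ (p , s) → map (λ (s₁ , s₂) → (p ++ x1 ∷ s₁ , s₂)) (splits s)) (ribbon y)

-- A linear extension of a poset, split at the element to which the x₁ of a
-- ribbon is to be glued.
Marked : Set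
Marked = Word × Letter × Word

total : Marked → Word
total (p , a , s) = p ++ a ∷ s

-- Grows the poset by an element above the marked one and moves the mark to it; iteration attaches a
-- chain.
above : Letter → List Marked → List Marked
above b = concatMap (λ (p , a , s) → map (λ (s₁ , s₂) → (p ++ a ∷ s₁ , b , s₂)) (splits s))

aboves : Word → List Marked → List Marked
aboves []      X = X
aboves (b ∷ y) X = aboves y (above b X)

aboves-++ : ∀ y z X → aboves (y ++ z) X ≡ aboves z (aboves y X)
aboves-++ []      z X = ≡.refl
aboves-++ (b ∷ y) z X = aboves-++ y z (above b X)

data Start1 : Word → Set where
  start1 : ∀ {w} → Start1 (x1 ∷ w)

-- Keeps the total word in 𝔥¹ whatever is shuffled in above the mark; multiplicativity of `F` is
-- known only there.
Good : Marked → Set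
Good (p , a , s) = Start1 (p ∷ʳ a)

Start1-∷ʳ : ∀ p a s → Start1 (p ∷ʳ a) → Start1 (p ++ a ∷ s)
Start1-∷ʳ []       .x1 s start1 = start1
Start1-∷ʳ (x1 ∷ p) a   s start1 = start1

Start1-++ : ∀ u {v} → Start1 u → Start1 (u ++ v)
Start1-++ (x1 ∷ u) start1 = start1

all-map : {A B : Set} {P : B → Set} {f : A → B} (xs : List A) → (∀ x → P (f x)) → All P (map f xs)
all-map xs h = map⁺ (All.universal h xs)

all-concatMap : {A B : Set} {P : A → Set} {Q : B → Set} {f : A → List B} {xs : List A} →
  All P xs → (∀ x → P x → All Q (f x)) → All Q (concatMap f xs)
all-concatMap []        h = []
all-concatMap (px ∷ ps) h = ++⁺ (h _ px) (all-concatMap ps h)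

above-Good : ∀ b {X} → All Good X → All Good (above b X)
above-Good b g = all-concatMap g (λ (p , a , s) q → all-map (splits s)
  (λ (s₁ , s₂) → Start1-++ (p ++ a ∷ s₁) (Start1-∷ʳ p a s₁ q)))

aboves-Good : ∀ y {X} → All Good X → All Good (aboves y X)
aboves-Good []      g = g
aboves-Good (b ∷ y) g = aboves-Good y (above-Good b g)

dagger-∷ : ∀ a w → dagger (a ∷ w) ≡ dagger w ∷ʳ swapL a
dagger-∷ a w = unfold-reverse (swapL a) (map swapL w)

dagger-++ : ∀ u v → dagger (u ++ v) ≡ dagger v ++ dagger u
dagger-++ u v = ≡.trans (≡.cong reverse (map-++ swapL u v)) (reverse-++ (map swapL u) (map swapL v))

dagger-++-∷ : ∀ u a v → dagger (u ++ a ∷ v) ≡ dagger v ++ swapL a ∷ dagger u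
dagger-++-∷ u a v = ≡.trans (dagger-++ u (a ∷ v)) (≡.trans (≡.cong (_++ dagger u) (dagger-∷ a v)) (++-assoc (dagger v) (swapL a ∷ []) (dagger u)))

-- Shuffle product: gluing, cutting and dualizing ribbon posets

module Shuffle {c ℓ : Level} (R : CommutativeRing c ℓ) where
  open Summation R
  open import Relation.Binary.Reasoning.Setoid setoid

  ∑-sh : ∀ a v b w (Φ : Word → Carrier) →
    ∑ (sh (a ∷ v) (b ∷ w)) Φ ≈ ∑ (sh v (b ∷ w)) (Φ ∘ (a ∷_)) + ∑ (sh (a ∷ v) w) (Φ ∘ (b ∷_))
  ∑-sh a v b w Φ = trans (∑-++ (map (a ∷_) (sh v (b ∷ w))) _ Φ) (+-cong (∑-map _ (sh v (b ∷ w)) Φ) (∑-map _ (sh (a ∷ v) w) Φ))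

  sh-[]ʳ : ∀ v → sh v [] ≡ [ v ]
  sh-[]ʳ []      = ≡.refl
  sh-[]ʳ (k ∷ v) = ≡.refl

  ∑-sh-[]ʳ : ∀ v (Φ : Word → Carrier) → ∑ (sh v []) Φ ≈ Φ v
  ∑-sh-[]ʳ v Φ rewrite sh-[]ʳ v = +-identityʳ _

  ∑-sh-comm : ∀ v w (Φ : Word → Carrier) → ∑ (sh v w) Φ ≈ ∑ (sh w v) Φ
  ∑-sh-comm []      w       Φ = trans (+-identityʳ _) (sym (∑-sh-[]ʳ w Φ))
  ∑-sh-comm (a ∷ v) []      Φ = refl
  ∑-sh-comm (a ∷ v) (b ∷ w) Φ = begin
    ∑ (sh (a ∷ v) (b ∷ w)) Φ
      ≈⟨ ∑-sh a v b w Φ ⟩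
    ∑ (sh v (b ∷ w)) (Φ ∘ (a ∷_)) + ∑ (sh (a ∷ v) w) (Φ ∘ (b ∷_))
      ≈⟨ +-cong (∑-sh-comm v (b ∷ w) _) (∑-sh-comm (a ∷ v) w _) ⟩
    ∑ (sh (b ∷ w) v) (Φ ∘ (a ∷_)) + ∑ (sh w (a ∷ v)) (Φ ∘ (b ∷_))
      ≈⟨ +-comm _ _ ⟩
    _ ≈⟨ ∑-sh b w a v Φ ⟨
    ∑ (sh (b ∷ w) (a ∷ v)) Φ ∎

  ∑-sh-++ˡ : ∀ u a v w (Φ : Word → Carrier) → ∑ (sh (u ++ a ∷ v) w) Φ ≈
    ∑ (splits w) (λ (w₁ , w₂) → ∑ (sh u w₁) (λ x → ∑ (sh v w₂) (λ y → Φ (x ++ a ∷ y))))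
  ∑-sh-++ˡ []      a v []      Φ = +-congʳ (sym (trans (+-identityʳ _) (∑-sh-[]ʳ v _)))
  ∑-sh-++ˡ []      a v (b ∷ w) Φ = begin
    _ ≈⟨ ∑-sh a v b w Φ ⟩
    _ ≈⟨ +-cong (sym (+-identityʳ _)) (∑-sh-++ˡ [] a v w _) ⟩
    _ ≈⟨ ∑-splits-∷ b w _ ⟨
    _ ∎
  ∑-sh-++ˡ (c ∷ u) a v []      Φ = +-congʳ (sym (trans (+-identityʳ _) (∑-sh-[]ʳ v _)))
  ∑-sh-++ˡ (c ∷ u) a v (b ∷ w) Φ = begin
    _ ≈⟨ ∑-sh c (u ++ a ∷ v) b w Φ ⟩
    _ ≈⟨ +-cong (trans (∑-sh-++ˡ u a v (b ∷ w) _) (∑-splits-∷ b w _)) (∑-sh-++ˡ (c ∷ u) a v w _) ⟩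
    _ ≈⟨ +-assoc _ _ _ ⟩
    _ ≈⟨ +-cong (trans (∑-sh-[]ʳ u _) (sym (+-identityʳ _))) (sym (∑-+ (splits w) _ _)) ⟩
    _ ≈⟨ +-congˡ (∑-cong (splits w) (λ (w₁ , w₂) → ∑-sh c u b w₁ _)) ⟨
    _ ≈⟨ ∑-splits-∷ b w _ ⟨
    _ ∎

  ∑-sh-++ʳ : ∀ w u a v (Φ : Word → Carrier) → ∑ (sh w (u ++ a ∷ v)) Φ ≈
    ∑ (splits w) (λ (w₁ , w₂) → ∑ (sh w₁ u) (λ x → ∑ (sh w₂ v) (λ y → Φ (x ++ a ∷ y))))
  ∑-sh-++ʳ w u a v Φ = begin
    _ ≈⟨ ∑-sh-comm w (u ++ a ∷ v) Φ ⟩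
    _ ≈⟨ ∑-sh-++ˡ u a v w Φ ⟩
    _ ≈⟨ ∑-cong (splits w) (λ (w₁ , w₂) → trans (∑-sh-comm u w₁ _) (∑-cong (sh w₁ u) (λ x → ∑-sh-comm v w₂ _))) ⟩
    _ ∎

  -- Identifies the marked element with x₁ of the ribbon. Given linear extensions of both posets,
  -- what lies below the common element and what lies above it shuffle independently.
  glue : Marked → Word → (Word → Carrier) → Carrier
  glue (p′ , a , s′) y Φ = ∑ (ribbon y) (λ (p , s) → ∑ (sh p′ p) (λ u → ∑ (sh s′ s) (λ v → Φ (u ++ a ∷ v))))

  ∑-ribbon-x0 : ∀ y (Ψ : Word × Word → Carrier) → ∑ (ribbon (x0 ∷ y)) Ψ ≈
    ∑ (ribbon y) (λ (p , s) → ∑ (splits p) (λ (p₁ , p₂) → Ψ (p₁ , p₂ ++ x0 ∷ s)))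
  ∑-ribbon-x0 y Ψ = trans (∑-concatMap _ (ribbon y) Ψ) (∑-cong (ribbon y) (λ (p , s) → ∑-map _ (splits p) Ψ))

  ∑-ribbon-x1 : ∀ y (Ψ : Word × Word → Carrier) → ∑ (ribbon (x1 ∷ y)) Ψ ≈
    ∑ (ribbon y) (λ (p , s) → ∑ (splits s) (λ (s₁ , s₂) → Ψ (p ++ x1 ∷ s₁ , s₂)))
  ∑-ribbon-x1 y Ψ = trans (∑-concatMap _ (ribbon y) Ψ) (∑-cong (ribbon y) (λ (p , s) → ∑-map _ (splits s) Ψ))

  ∑-above : ∀ b X (Ψ : Marked → Carrier) → ∑ (above b X) Ψ ≈
    ∑ X (λ (p , a , s) → ∑ (splits s) (λ (s₁ , s₂) → Ψ (p ++ a ∷ s₁ , b , s₂)))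
  ∑-above b X Ψ = trans (∑-concatMap _ X Ψ) (∑-cong X (λ (p , a , s) → ∑-map _ (splits s) Ψ))

  -- Both sides enumerate the linear extensions of two chains `p′ a s′` and `p b s` with the one
  -- extra relation a < b: on the left by the position of a in the second chain, on the right by
  -- that of b in the first.
  pivot : ∀ p′ a s′ p b s (Φ : Word → Carrier) →
    ∑ (splits p) (λ (p₁ , p₂) → ∑ (sh p′ p₁) (λ u → ∑ (sh s′ (p₂ ++ b ∷ s)) (λ v → Φ (u ++ a ∷ v)))) ≈
    ∑ (splits s′) (λ (s₁ , s₂) → ∑ (sh (p′ ++ a ∷ s₁) p) (λ q → ∑ (sh s₂ s) (λ z → Φ (q ++ b ∷ z))))
  pivot p′ a s′ p b s Φ = begin
    _ ≈⟨ ∑-cong (splits p) (λ (p₁ , p₂) → trans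
           (∑-cong (sh p′ p₁) (λ u → ∑-sh-++ʳ s′ p₂ b s (λ v → Φ (u ++ a ∷ v))))
           (∑-swap (sh p′ p₁) (splits s′) _)) ⟩
    _ ≈⟨ ∑-swap (splits p) (splits s′) _ ⟩
    _ ≈⟨ ∑-cong (splits s′) (λ (s₁ , s₂) → ∑-cong (splits p) (λ (p₁ , p₂) → ∑-cong (sh p′ p₁) (λ u →
           ∑-cong (sh s₁ p₂) (λ x → ∑-cong (sh s₂ s) (λ z → reflexive (≡.cong Φ (≡.sym (++-assoc u (a ∷ x) (b ∷ z))))))))) ⟩
    _ ≈⟨ ∑-cong (splits s′) (λ (s₁ , s₂) → sym (∑-sh-++ˡ p′ a s₁ p _)) ⟩
    _ ∎

  glue-x0 : ∀ X y (Φ : Word → Carrier) →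
    ∑ X (λ t → glue t (x0 ∷ y) Φ) ≈ ∑ (above x0 X) (λ t → glue t y Φ)
  glue-x0 X y Φ = begin
    _ ≈⟨ ∑-cong X (λ (p′ , a , s′) → begin
           _ ≈⟨ ∑-ribbon-x0 y _ ⟩
           _ ≈⟨ ∑-cong (ribbon y) (λ (p , s) → pivot p′ a s′ p x0 s Φ) ⟩
           _ ≈⟨ ∑-swap (ribbon y) (splits s′) _ ⟩
           _ ∎) ⟩
    _ ≈⟨ ∑-above x0 X _ ⟨
    _ ∎

  glue-x0s : ∀ n X y (Φ : Word → Carrier) →
    ∑ X (λ t → glue t (replicate n x0 ++ y) Φ) ≈ ∑ (aboves (replicate n x0) X) (λ t → glue t y Φ)
  glue-x0s zero    X y Φ = refl
  glue-x0s (suc n) X y Φ = trans (glue-x0 X (replicate n x0 ++ y) Φ) (glue-x0s n (above x0 X) y Φ)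

  -- Cuts an edge of the zigzag. The element labelled e₁ lies below the mark in the first sum and
  -- above it in the second; together no relation is left, and the two posets merely shuffle.
  glue-x1 : ∀ X y (Φ : Word → Carrier) →
    ∑ X (λ t → glue t (x1 ∷ y) Φ) + ∑ (above x1 X) (λ t → glue t y Φ) ≈
    ∑ X (λ t → ∑ (ribbon y) (λ (p , s) → ∑ (sh (total t) (p ++ x1 ∷ s)) Φ))
  glue-x1 X y Φ = begin
    _ ≈⟨ +-congˡ (∑-above x1 X _) ⟩
    _ ≈⟨ ∑-+ X _ _ ⟨
    _ ≈⟨ ∑-cong X (λ (p′ , a , s′) → begin
           _ ≈⟨ +-cong (∑-ribbon-x1 y _) (sym (∑-swap (ribbon y) (splits s′) _)) ⟩
           _ ≈⟨ ∑-+ (ribbon y) _ _ ⟨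
           _ ≈⟨ ∑-cong (ribbon y) (λ (p , s) → begin
                  _ ≈⟨ +-congˡ (pivot p′ a s′ p x1 s Φ) ⟨
                  _ ≈⟨ +-comm _ _ ⟩
                  _ ≈⟨ ∑-splits-++ p x1 s _ ⟨
                  _ ≈⟨ ∑-sh-++ˡ p′ a s′ (p ++ x1 ∷ s) Φ ⟨
                  _ ∎) ⟩
           _ ∎) ⟩
    _ ∎

  glue-[] : ∀ t (Φ : Word → Carrier) → glue t [] Φ ≈ Φ (total t)
  glue-[] (p , a , s) Φ = trans (+-identityʳ _) (trans (∑-sh-[]ʳ p _) (∑-sh-[]ʳ s _))

  ∑-aboves : ∀ y X (Φ : Word → Carrier) →
    ∑ (aboves y X) (Φ ∘ total) ≈ ∑ X (λ (p , a , s) → ∑ (sh s y) (λ z → Φ (p ++ a ∷ z)))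
  ∑-aboves []      X Φ = ∑-cong X (λ (p , a , s) → sym (∑-sh-[]ʳ s _))
  ∑-aboves (b ∷ y) X Φ = begin
    _ ≈⟨ ∑-aboves y (above b X) Φ ⟩
    _ ≈⟨ ∑-above b X _ ⟩
    _ ≈⟨ ∑-cong X (λ (p , a , s) → begin
           _ ≈⟨ ∑-cong (splits s) (λ (s₁ , s₂) → trans (∑-cong (sh s₂ y) (λ z →
                  reflexive (≡.cong Φ (++-assoc p (a ∷ s₁) (b ∷ z))))) (sym (∑-sh-[]ʳ s₁ _))) ⟩
           _ ≈⟨ ∑-sh-++ʳ s [] b y _ ⟨
           _ ∎) ⟩
    _ ∎

  ∑-splits-dagger : ∀ w (f : Word × Word → Carrier) →
    ∑ (splits (dagger w)) f ≈ ∑ (splits w) (λ (u , v) → f (dagger v , dagger u))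
  ∑-splits-dagger []      f = refl
  ∑-splits-dagger (a ∷ w) f = begin
    _ ≡⟨ ≡.cong (λ z → ∑ (splits z) f) (dagger-∷ a w) ⟩
    ∑ (splits (dagger w ++ swapL a ∷ [])) f
      ≈⟨ ∑-splits-++ (dagger w) (swapL a) [] f ⟩
    _ ≈⟨ +-comm _ _ ⟩
    _ ≈⟨ +-cong (trans (+-identityʳ _) (reflexive (≡.cong (λ z → f (z , [])) (≡.sym (dagger-∷ a w)))))
           (trans (∑-splits-dagger w _) (∑-cong (splits w) (λ (u , v) → reflexive (≡.cong (λ z → f (dagger v , z)) (≡.sym (dagger-∷ a u)))))) ⟩
    _ ≈⟨ ∑-splits-∷ a w _ ⟨
    _ ∎

  ∑-sh-dagger : ∀ v w (Φ : Word → Carrier) → ∑ (sh (dagger v) (dagger w)) Φ ≈ ∑ (sh v w) (Φ ∘ dagger)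
  ∑-sh-dagger []      w Φ = refl
  ∑-sh-dagger (a ∷ v) w Φ = begin
    _ ≡⟨ ≡.cong (λ z → ∑ (sh z (dagger w)) Φ) (dagger-∷ a v) ⟩
    ∑ (sh (dagger v ++ swapL a ∷ []) (dagger w)) Φ
      ≈⟨ ∑-sh-++ˡ (dagger v) (swapL a) [] (dagger w) Φ ⟩
    _ ≈⟨ ∑-splits-dagger w _ ⟩
    _ ≈⟨ ∑-cong (splits w) (λ (w₁ , w₂) → begin
           _ ≈⟨ ∑-sh-dagger v w₂ _ ⟩
           _ ≈⟨ ∑-cong (sh v w₂) (λ x → trans (+-identityʳ _) (reflexive (≡.cong Φ (≡.sym (dagger-++-∷ w₁ a x))))) ⟩
           _ ≈⟨ +-identityʳ _ ⟨
           _ ∎) ⟩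
    _ ≈⟨ ∑-sh-++ˡ [] a v w (Φ ∘ dagger) ⟨
    _ ∎

  -- Reversing the order and exchanging the labels turns "above, labelled e₀" into "below, labelled
  -- e₁", so a ribbon becomes a ribbon.
  ∑-ribbon-dagger : ∀ y (Ψ : Word × Word → Carrier) →
    ∑ (ribbon (map swapL y)) Ψ ≈ ∑ (ribbon y) (λ (p , s) → Ψ (dagger s , dagger p))
  ∑-ribbon-dagger []       Ψ = refl
  ∑-ribbon-dagger (x0 ∷ y) Ψ = begin
    _ ≈⟨ ∑-ribbon-x1 (map swapL y) Ψ ⟩
    _ ≈⟨ ∑-ribbon-dagger y _ ⟩
    _ ≈⟨ ∑-cong (ribbon y) (λ (p , s) → trans (∑-splits-dagger p _) (∑-cong (splits p) (λ (p₁ , p₂) →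
           reflexive (≡.cong (λ z → Ψ (z , dagger p₁)) (≡.sym (dagger-++-∷ p₂ x0 s)))))) ⟩
    _ ≈⟨ ∑-ribbon-x0 y _ ⟨
    _ ∎
  ∑-ribbon-dagger (x1 ∷ y) Ψ = begin
    _ ≈⟨ ∑-ribbon-x0 (map swapL y) Ψ ⟩
    _ ≈⟨ ∑-ribbon-dagger y _ ⟩
    _ ≈⟨ ∑-cong (ribbon y) (λ (p , s) → trans (∑-splits-dagger s _) (∑-cong (splits s) (λ (s₁ , s₂) →
           reflexive (≡.cong (λ z → Ψ (dagger s₂ , z)) (≡.sym (dagger-++-∷ p x1 s₁)))))) ⟩
    _ ≈⟨ ∑-ribbon-x1 y _ ⟨
    _ ∎

  glue-dagger : ∀ p′ a s′ y (Φ : Word → Carrier) →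
    glue (p′ , a , s′) y (Φ ∘ dagger) ≈ glue (dagger s′ , swapL a , dagger p′) (map swapL y) Φ
  glue-dagger p′ a s′ y Φ = sym (begin
    _ ≈⟨ ∑-ribbon-dagger y _ ⟩
    _ ≈⟨ ∑-cong (ribbon y) (λ (p , s) → begin
           _ ≈⟨ ∑-sh-dagger s′ s _ ⟩
           _ ≈⟨ ∑-cong (sh s′ s) (λ v → ∑-sh-dagger p′ p _) ⟩
           _ ≈⟨ ∑-swap (sh s′ s) (sh p′ p) _ ⟩
           _ ≈⟨ ∑-cong (sh p′ p) (λ u → ∑-cong (sh s′ s) (λ v → reflexive (≡.cong Φ (≡.sym (dagger-++-∷ u a v))))) ⟩
           _ ∎) ⟩
    _ ∎)

-- Words of indices and the shift n ↦ n+z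

W : List ℕ → Word
W []      = []
W (k ∷ v) = x1 ∷ replicate k x0 ++ W v

pairs : ℕ → List (ℕ × ℕ)
pairs zero    = [ 0 , 0 ]
pairs (suc m) = (0 , suc m) ∷ map (map₁ suc) (pairs m)

-- All ways to put some of m balls into n boxes, as (balls used , balls left).
spread : ℕ → ℕ → List (ℕ × ℕ)
spread zero    m = [ 0 , m ]
spread (suc n) m = concatMap (λ (i , j) → map (map₁ (i +ℕ_)) (spread n j)) (pairs m)

-- The coefficient of (-z)^m in the shift e_k ↦ ∑_i (-z)^i C(k-1+i, i) e_{k+i}
-- coming from the expansion of 1/(n+z)^k.
shift : ℕ → List ℕ → List (List ℕ)
shift zero    []      = [ [] ]
shift (suc m) []      = []
shift m       (k ∷ v) = concatMap (λ (u , r) → map (k +ℕ u ∷_) (shift r v)) (spread (suc k) m)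

zeros : ℕ → Word
zeros n = replicate n x0

zeros-+ : ∀ i j → zeros (i +ℕ j) ≡ zeros i ++ zeros j
zeros-+ zero    j = ≡.refl
zeros-+ (suc i) j = ≡.cong (x0 ∷_) (zeros-+ i j)

zeros-split : ∀ i x u w → zeros i ++ x0 ∷ zeros (x +ℕ u) ++ w ≡ zeros (suc x +ℕ (i +ℕ u)) ++ w
zeros-split i x u w = begin
  zeros i ++ zeros (suc x +ℕ u) ++ w      ≡⟨ ++-assoc (zeros i) _ w ⟨
  (zeros i ++ zeros (suc x +ℕ u)) ++ w    ≡⟨ ≡.cong (_++ w) (zeros-+ i (suc x +ℕ u)) ⟨
  zeros (i +ℕ (suc x +ℕ u)) ++ w          ≡⟨ ≡.cong (λ n → zeros n ++ w) (lem i x u) ⟩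
  zeros (suc x +ℕ (i +ℕ u)) ++ w          ∎
  where
  open ≡.≡-Reasoning
  lem : ∀ i x u → i +ℕ (suc x +ℕ u) ≡ suc x +ℕ (i +ℕ u)
  lem = solve-ℕ

⊕-+-interchange : ∀ k l s t → (k ⊕ l) +ℕ (s +ℕ t) ≡ (k +ℕ s) ⊕ (l +ℕ t)
⊕-+-interchange = lem
  where
  lem : ∀ k l s t → (k +ℕ suc l) +ℕ (s +ℕ t) ≡ (k +ℕ s) +ℕ suc (l +ℕ t)
  lem = solve-ℕ

module Shift {c ℓ : Level} (R : CommutativeRing c ℓ) where
  open Summation R
  open Harmonic R
  open Shuffle R
  open import Relation.Binary.Reasoning.Setoid setoid

  ∑-pairs-suc : ∀ m (f : ℕ × ℕ → Carrier) → ∑ (pairs (suc m)) f ≈ f (0 , suc m) + ∑ (pairs m) (λ (i , j) → f (suc i , j))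
  ∑-pairs-suc m f = +-congˡ (∑-map _ (pairs m) f)

  ∑-pairs-sucʳ : ∀ m (f : ℕ × ℕ → Carrier) → ∑ (pairs (suc m)) f ≈ f (suc m , 0) + ∑ (pairs m) (λ (i , j) → f (i , suc j))
  ∑-pairs-sucʳ zero    f = +-left-comm _ _ _
  ∑-pairs-sucʳ (suc m) f = begin
    _ ≈⟨ ∑-pairs-suc (suc m) f ⟩
    _ ≈⟨ +-congˡ (∑-pairs-sucʳ m (λ (i , j) → f (suc i , j))) ⟩
    _ ≈⟨ +-left-comm _ _ _ ⟩
    _ ≈⟨ +-congˡ (∑-pairs-suc m (λ (i , j) → f (i , suc j))) ⟨
    _ ∎

  ∑-pairs-comm : ∀ m (f : ℕ × ℕ → Carrier) → ∑ (pairs m) f ≈ ∑ (pairs m) (λ (i , j) → f (j , i))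
  ∑-pairs-comm zero    f = refl
  ∑-pairs-comm (suc m) f = trans (∑-pairs-suc m f) (trans (+-congˡ (∑-pairs-comm m _)) (sym (∑-pairs-sucʳ m _)))

  ∑-pairs-coassoc : ∀ m (f : ℕ → ℕ → ℕ → Carrier) →
    ∑ (pairs m) (λ (i , r) → ∑ (pairs r) (λ (j , k) → f i j k)) ≈
    ∑ (pairs m) (λ (s , k) → ∑ (pairs s) (λ (i , j) → f i j k))
  ∑-pairs-coassoc zero    f = refl
  ∑-pairs-coassoc (suc m) f = begin
    _ ≈⟨ ∑-pairs-suc m _ ⟩
    _ ≈⟨ +-cong (∑-pairs-suc m _) (∑-pairs-coassoc m (f ∘ suc)) ⟩
    _ ≈⟨ +-assoc _ _ _ ⟩
    _ ≈⟨ +-cong (sym (+-identityʳ _)) (sym (∑-+ (pairs m) _ _)) ⟩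
    _ ≈⟨ +-congˡ (∑-cong (pairs m) (λ (s , k) → ∑-pairs-suc s _)) ⟨
    _ ≈⟨ ∑-pairs-suc m _ ⟨
    _ ∎

  ∑-spread : ∀ n m (f : ℕ × ℕ → Carrier) →
    ∑ (spread (suc n) m) f ≈ ∑ (pairs m) (λ (i , j) → ∑ (spread n j) (λ (u , r) → f (i +ℕ u , r)))
  ∑-spread n m f = trans (∑-concatMap _ (pairs m) f) (∑-cong (pairs m) (λ (i , j) → ∑-map _ (spread n j) f))

  ∑-spread-pairsˡ : ∀ n m (f : ℕ → ℕ → ℕ → Carrier) →
    ∑ (spread n m) (λ (s , r) → ∑ (pairs r) (λ (i , j) → f s i j)) ≈
    ∑ (pairs m) (λ (i₀ , j) → ∑ (spread n i₀) (λ (s , i) → f s i j))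
  ∑-spread-pairsˡ zero    m f = trans (+-identityʳ _) (∑-cong (pairs m) (λ _ → sym (+-identityʳ _)))
  ∑-spread-pairsˡ (suc n) m f = begin
    _ ≈⟨ ∑-spread n m _ ⟩
    _ ≈⟨ ∑-cong (pairs m) (λ (a , b) → ∑-spread-pairsˡ n b (λ s → f (a +ℕ s))) ⟩
    _ ≈⟨ ∑-pairs-coassoc m (λ a i₀ j → ∑ (spread n i₀) (λ (s , i) → f (a +ℕ s) i j)) ⟩
    _ ≈⟨ ∑-cong (pairs m) (λ (i₀ , j) → ∑-spread n i₀ _) ⟨
    _ ∎

  ∑-spread-pairsʳ : ∀ n m (f : ℕ → ℕ → ℕ → Carrier) →
    ∑ (spread n m) (λ (s , r) → ∑ (pairs r) (λ (i , j) → f s i j)) ≈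
    ∑ (pairs m) (λ (i , j₀) → ∑ (spread n j₀) (λ (s , j) → f s i j))
  ∑-spread-pairsʳ n m f = begin
    _ ≈⟨ ∑-cong (spread n m) (λ (s , r) → ∑-pairs-comm r _) ⟩
    _ ≈⟨ ∑-spread-pairsˡ n m (λ s i j → f s j i) ⟩
    _ ≈⟨ ∑-pairs-comm m _ ⟩
    _ ∎

  -- Vandermonde's identity: the balls for the first `n` boxes are chosen before those for the rest.
  ∑-spread-+ : ∀ n n′ m (f : ℕ × ℕ → Carrier) →
    ∑ (spread (n +ℕ n′) m) f ≈ ∑ (spread n m) (λ (s , r) → ∑ (spread n′ r) (λ (t , q) → f (s +ℕ t , q)))
  ∑-spread-+ zero    n′ m f = sym (+-identityʳ _)
  ∑-spread-+ (suc n) n′ m f = begin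
    _ ≈⟨ ∑-spread (n +ℕ n′) m f ⟩
    _ ≈⟨ ∑-cong (pairs m) (λ (i , j) → trans (∑-spread-+ n n′ j _) (∑-cong (spread n j) (λ (s , r) →
           ∑-cong (spread n′ r) (λ (t , q) → reflexive (≡.cong (λ z → f (z , q)) (≡.sym (+ℕ-assoc i s t))))))) ⟩
    _ ≈⟨ ∑-spread n m _ ⟨
    _ ∎

  ∑-spread-0 : ∀ n (f : ℕ × ℕ → Carrier) → ∑ (spread n 0) f ≈ f (0 , 0)
  ∑-spread-0 zero    f = +-identityʳ _
  ∑-spread-0 (suc n) f = trans (∑-spread n 0 f) (trans (+-identityʳ _) (∑-spread-0 n _))

  ∑-shift : ∀ m k v (Φ : List ℕ → Carrier) →
    ∑ (shift m (k ∷ v)) Φ ≈ ∑ (spread (suc k) m) (λ (u , r) → ∑ (shift r v) (Φ ∘ (k +ℕ u ∷_)))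
  ∑-shift zero    k v Φ = trans (∑-concatMap _ (spread (suc k) 0) Φ) (∑-cong (spread (suc k) 0) (λ (u , r) → ∑-map _ (shift r v) Φ))
  ∑-shift (suc m) k v Φ = trans (∑-concatMap _ (spread (suc k) (suc m)) Φ) (∑-cong (spread (suc k) (suc m)) (λ (u , r) → ∑-map _ (shift r v) Φ))

  ∑-shift-0 : ∀ v (Φ : List ℕ → Carrier) → ∑ (shift 0 v) Φ ≈ Φ v
  ∑-shift-0 []      Φ = +-identityʳ _
  ∑-shift-0 (k ∷ v) Φ = begin
    _ ≈⟨ ∑-shift 0 k v Φ ⟩
    _ ≈⟨ ∑-spread-0 (suc k) _ ⟩
    _ ≈⟨ ∑-shift-0 v _ ⟩
    Φ (k +ℕ 0 ∷ v) ≡⟨ ≡.cong (λ z → Φ (z ∷ v)) (+ℕ-identityʳ k) ⟩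
    _ ∎

  ∑-pairs-shift-[] : ∀ m (g : ℕ → List ℕ → Carrier) →
    ∑ (pairs m) (λ (i , j) → ∑ (shift i []) (g j)) ≈ g m []
  ∑-pairs-shift-[] zero    g = trans (+-identityʳ _) (+-identityʳ _)
  ∑-pairs-shift-[] (suc m) g = begin
    _ ≈⟨ ∑-pairs-suc m (λ (i , j) → ∑ (shift i []) (g j)) ⟩
    _ ≈⟨ +-cong (+-identityʳ _) (∑-zero (pairs m) (λ _ → refl)) ⟩
    _ ≈⟨ +-identityʳ _ ⟩
    _ ∎

  -- Substituting n+z respects products of powers of 1/n, so the shift is a homomorphism for the
  -- harmonic product, and degree `m` is distributed over `pairs m`. A merged entry has as many
  -- boxes as `k` and `l` together; with entries stored minus one this holds definitionally.
  ∑-H-shift : ∀ m v w (Φ : List ℕ → Carrier) → ∑ (H v w) (λ u → ∑ (shift m u) Φ) ≈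
    ∑ (pairs m) (λ (i , j) → ∑ (shift i v) (λ v′ → ∑ (shift j w) (λ w′ → ∑ (H v′ w′) Φ)))
  ∑-H-shift m [] w Φ = begin
    _ ≈⟨ +-identityʳ _ ⟩
    _ ≈⟨ ∑-cong (shift m w) (λ _ → sym (+-identityʳ _)) ⟩
    _ ≈⟨ ∑-pairs-shift-[] m (λ j v′ → ∑ (shift j w) (λ w′ → ∑ (H v′ w′) Φ)) ⟨
    _ ∎
  ∑-H-shift m (k ∷ v) [] Φ = begin
    _ ≈⟨ +-identityʳ _ ⟩
    _ ≈⟨ ∑-cong (shift m (k ∷ v)) (λ u → sym (∑-H-[]ʳ u Φ)) ⟩
    _ ≈⟨ ∑-pairs-shift-[] m (λ i w′ → ∑ (shift i (k ∷ v)) (λ v′ → ∑ (H v′ w′) Φ)) ⟨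
    _ ≈⟨ ∑-pairs-comm m _ ⟩
    _ ≈⟨ ∑-cong (pairs m) (λ (i , j) → ∑-swap (shift j []) (shift i (k ∷ v)) _) ⟩
    _ ∎
  ∑-H-shift m (k ∷ v) (l ∷ w) Φ = begin
    _ ≈⟨ ∑-H k v l w _ ⟩
    _ ≈⟨ +-cong (trans (expand k v (l ∷ w)) first) (+-cong (trans (expand l (k ∷ v) w) second) (trans (expand (k ⊕ l) v w) both)) ⟩
    _ ≈⟨ trans (Θ-+ _ _) (+-congˡ (Θ-+ _ _)) ⟨
    _ ≈⟨ ∑-cong (pairs m) (λ (i₀ , j₀) → ∑-cong (spread (suc k) i₀) (λ (s , i) → ∑-cong (spread (suc l) j₀) (λ (t , j) →
           ∑-cong (shift i v) (λ v′ → ∑-cong (shift j w) (λ w′ → ∑-H (k +ℕ s) v′ (l +ℕ t) w′ Φ))))) ⟨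
    _ ≈⟨ ∑-cong (pairs m) (λ (i₀ , j₀) → trans (∑-shift i₀ k v _) (∑-cong (spread (suc k) i₀) (λ (s , i) →
           trans (∑-cong (shift i v) (λ v′ → ∑-shift j₀ l w _)) (∑-swap (shift i v) (spread (suc l) j₀) _)))) ⟨
    _ ∎
    where
    Θ : (ℕ → ℕ → List ℕ → List ℕ → Carrier) → Carrier
    Θ f = ∑ (pairs m) (λ (i₀ , j₀) → ∑ (spread (suc k) i₀) (λ (s , i) → ∑ (spread (suc l) j₀) (λ (t , j) →
            ∑ (shift i v) (λ v′ → ∑ (shift j w) (λ w′ → f s t v′ w′)))))
    Θ-+ : ∀ f g → Θ (λ s t v′ w′ → f s t v′ w′ + g s t v′ w′) ≈ Θ f + Θ g
    Θ-+ f g = trans (∑-cong (pairs m) (λ (i₀ , j₀) → trans (∑-cong (spread (suc k) i₀) (λ (s , i) →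
      trans (∑-cong (spread (suc l) j₀) (λ (t , j) → trans (∑-cong (shift i v) (λ v′ → ∑-+ (shift j w) _ _))
      (∑-+ (shift i v) _ _))) (∑-+ (spread (suc l) j₀) _ _))) (∑-+ (spread (suc k) i₀) _ _))) (∑-+ (pairs m) _ _)
    Ξ : ℕ → List ℕ → List ℕ → Carrier
    Ξ a v w = ∑ (spread (suc a) m) (λ (s , r) → ∑ (pairs r) (λ (i , j) →
      ∑ (shift i v) (λ v′ → ∑ (shift j w) (λ w′ → ∑ (H v′ w′) (Φ ∘ (a +ℕ s ∷_))))))
    expand : ∀ a v w → ∑ (H v w) (λ u → ∑ (shift m (a ∷ u)) Φ) ≈ Ξ a v w
    expand a v w = trans (∑-cong (H v w) (λ u → ∑-shift m a u Φ)) (trans (∑-swap (H v w) (spread (suc a) m) _)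
      (∑-cong (spread (suc a) m) (λ (s , r) → ∑-H-shift r v w _)))
    first : Ξ k v (l ∷ w) ≈ Θ (λ s t v′ w′ → ∑ (H v′ (l +ℕ t ∷ w′)) (Φ ∘ (k +ℕ s ∷_)))
    first = begin
      _ ≈⟨ ∑-spread-pairsˡ (suc k) m _ ⟩
      _ ≈⟨ ∑-cong (pairs m) (λ (i₀ , j₀) → ∑-cong (spread (suc k) i₀) (λ (s , i) →
             trans (∑-cong (shift i v) (λ v′ → ∑-shift j₀ l w _)) (∑-swap (shift i v) (spread (suc l) j₀) _))) ⟩
      _ ∎
    second : Ξ l (k ∷ v) w ≈ Θ (λ s t v′ w′ → ∑ (H (k +ℕ s ∷ v′) w′) (Φ ∘ (l +ℕ t ∷_)))
    second = begin
      _ ≈⟨ ∑-spread-pairsʳ (suc l) m _ ⟩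
      _ ≈⟨ ∑-cong (pairs m) (λ (i₀ , j₀) → trans (∑-cong (spread (suc l) j₀) (λ (t , j) → ∑-shift i₀ k v _))
             (∑-swap (spread (suc l) j₀) (spread (suc k) i₀) _)) ⟩
      _ ∎
    both : Ξ (k ⊕ l) v w ≈ Θ (λ s t v′ w′ → ∑ (H v′ w′) (Φ ∘ ((k +ℕ s) ⊕ (l +ℕ t) ∷_)))
    both = begin
      _ ≈⟨ ∑-spread-+ (suc k) (suc l) m _ ⟩
      _ ≈⟨ ∑-cong (spread (suc k) m) (λ (s , r) → ∑-spread-pairsʳ (suc l) r (λ t i j →
             ∑ (shift i v) (λ v′ → ∑ (shift j w) (λ w′ → ∑ (H v′ w′) (Φ ∘ ((k ⊕ l) +ℕ (s +ℕ t) ∷_)))))) ⟩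
      _ ≈⟨ ∑-spread-pairsˡ (suc k) m (λ s i j₀ → ∑ (spread (suc l) j₀) (λ (t , j) →
             ∑ (shift i v) (λ v′ → ∑ (shift j w) (λ w′ → ∑ (H v′ w′) (Φ ∘ ((k ⊕ l) +ℕ (s +ℕ t) ∷_)))))) ⟩
      _ ≈⟨ ∑-cong (pairs m) (λ (i₀ , j₀) → ∑-cong (spread (suc k) i₀) (λ (s , i) → ∑-cong (spread (suc l) j₀) (λ (t , j) →
             ∑-cong (shift i v) (λ v′ → ∑-cong (shift j w) (λ w′ → ∑-cong (H v′ w′) (λ u →
               reflexive (≡.cong (λ z → Φ (z ∷ u)) (⊕-+-interchange k l s t)))))))) ⟩
      _ ∎

  ∑-splits-zeros : ∀ m (f : Word × Word → Carrier) →
    ∑ (splits (zeros m)) f ≈ ∑ (pairs m) (λ (i , j) → f (zeros i , zeros j))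
  ∑-splits-zeros zero    f = refl
  ∑-splits-zeros (suc m) f = trans (∑-splits-∷ x0 (zeros m) f)
    (trans (+-congˡ (∑-splits-zeros m _)) (sym (∑-pairs-suc m _)))

  ∑-sh-zeros-∷ : ∀ m b y (Ψ : Word → Carrier) → ∑ (sh (zeros m) (b ∷ y)) Ψ ≈
    ∑ (pairs m) (λ (i , j) → ∑ (sh (zeros j) y) (λ z → Ψ (zeros i ++ b ∷ z)))
  ∑-sh-zeros-∷ m b y Ψ = begin
    _ ≈⟨ ∑-sh-++ʳ (zeros m) [] b y Ψ ⟩
    _ ≈⟨ ∑-cong (splits (zeros m)) (λ (u , v) → ∑-sh-[]ʳ u _) ⟩
    _ ≈⟨ ∑-splits-zeros m _ ⟩
    _ ∎

  -- The new letters e₀ fall into the gaps behind the letters of the entries, and an entry of n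
  -- letters has n gaps: this is the shift of degree `m`, without sign. The leading run stands for
  -- an entry whose e₁ has been removed, hence its `suc x` boxes.
  ∑-sh-zeros : ∀ m x v (Ψ : Word → Carrier) → ∑ (sh (zeros m) (zeros x ++ W v)) Ψ ≈
    ∑ (spread (suc x) m) (λ (u , r) → ∑ (shift r v) (λ v′ → Ψ (zeros (x +ℕ u) ++ W v′)))
  ∑-sh-zeros m zero [] Ψ = begin
    _ ≈⟨ ∑-sh-[]ʳ (zeros m) Ψ ⟩
    Ψ (zeros m) ≡⟨ ≡.cong Ψ (≡.trans (≡.sym (++-identityʳ (zeros m))) (≡.cong (λ z → zeros z ++ []) (≡.sym (+ℕ-identityʳ m)))) ⟩
    Ψ (zeros (m +ℕ 0) ++ [])
      ≈⟨ ∑-pairs-shift-[] m (λ i v′ → Ψ (zeros (i +ℕ 0) ++ W v′)) ⟨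
    _ ≈⟨ ∑-pairs-comm m _ ⟩
    _ ≈⟨ ∑-cong (pairs m) (λ _ → +-identityʳ _) ⟨
    _ ≈⟨ ∑-spread 0 m _ ⟨
    _ ∎
  ∑-sh-zeros m zero (k ∷ v) Ψ = begin
    _ ≈⟨ ∑-sh-zeros-∷ m x1 (zeros k ++ W v) Ψ ⟩
    _ ≈⟨ ∑-cong (pairs m) (λ (i , j) → ∑-sh-zeros j k v _) ⟩
    _ ≈⟨ ∑-cong (pairs m) (λ (i , j) → ∑-shift j k v _) ⟨
    _ ≈⟨ ∑-cong (pairs m) (λ (i , j) → trans (+-identityʳ _) (∑-cong (shift j (k ∷ v)) (λ v′ →
           reflexive (≡.cong (λ z → Ψ (zeros z ++ W v′)) (+ℕ-identityʳ i))))) ⟨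
    _ ≈⟨ ∑-spread 0 m _ ⟨
    _ ∎
  ∑-sh-zeros m (suc x) v Ψ = begin
    _ ≈⟨ ∑-sh-zeros-∷ m x0 (zeros x ++ W v) Ψ ⟩
    _ ≈⟨ ∑-cong (pairs m) (λ (i , j) → trans (∑-sh-zeros j x v _) (∑-cong (spread (suc x) j) (λ (u , r) →
           ∑-cong (shift r v) (λ v′ → reflexive (≡.cong Ψ (zeros-split i x u (W v′))))))) ⟩
    _ ≈⟨ ∑-spread (suc x) m _ ⟨
    _ ∎

  ∑-sh-zeros-W : ∀ m x v (Φ : Word → Carrier) →
    ∑ (sh (zeros m) (zeros x ++ W v)) (Φ ∘ (x1 ∷_)) ≈ ∑ (shift m (x ∷ v)) (Φ ∘ W)
  ∑-sh-zeros-W m x v Φ = trans (∑-sh-zeros m x v _) (sym (∑-shift m x v _))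

-- Words that begin with e₁ and words that end with e₀

W-++ : ∀ u v → W (u ++ v) ≡ W u ++ W v
W-++ []      v = ≡.refl
W-++ (k ∷ u) v = ≡.cong (x1 ∷_) (≡.trans (≡.cong (zeros k ++_) (W-++ u v)) (≡.sym (++-assoc (zeros k) (W u) (W v))))

parse : Word → ℕ × List ℕ
parse []       = 0 , []
parse (x0 ∷ w) = map₁ suc (parse w)
parse (x1 ∷ w) = 0 , proj₁ (parse w) ∷ proj₂ (parse w)

parse-W : ∀ w → zeros (proj₁ (parse w)) ++ W (proj₂ (parse w)) ≡ w
parse-W []       = ≡.refl
parse-W (x0 ∷ w) = ≡.cong (x0 ∷_) (parse-W w)
parse-W (x1 ∷ w) = ≡.cong (x1 ∷_) (parse-W w)

Start1-W : ∀ {w} → Start1 w → ∃ λ v → w ≡ W v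
Start1-W {x1 ∷ w} start1 = proj₁ (parse w) ∷ proj₂ (parse w) , ≡.cong (x1 ∷_) (≡.sym (parse-W w))

data End0 : Word → Set where
  here  : End0 (x0 ∷ [])
  there : ∀ {a w} → End0 w → End0 (a ∷ w)

End0-++ : ∀ u {v} → End0 v → End0 (u ++ v)
End0-++ []      e = e
End0-++ (a ∷ u) e = there (End0-++ u e)

End0-drop : ∀ u {b v} → End0 (u ++ b ∷ v) → End0 (b ∷ v)
End0-drop []          h         = h
End0-drop (a ∷ [])    (there h) = h
End0-drop (a ∷ c ∷ u) (there h) = End0-drop (c ∷ u) h

splits-sound : {A : Set} (w : List A) → All (λ (u , v) → u ++ v ≡ w) (splits w)
splits-sound []      = ≡.refl ∷ []
splits-sound (a ∷ w) = ≡.refl ∷ map⁺ (All.map (≡.cong (a ∷_)) (splits-sound w))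

Bounded : Word × Word → Set
Bounded (p , s) = Start1 (p ∷ʳ x1) × End0 (x0 ∷ s)

Start1-prefix : ∀ u v → Start1 ((u ++ v) ∷ʳ x1) → Start1 (u ∷ʳ x1)
Start1-prefix []       v h      = start1
Start1-prefix (x1 ∷ u) v start1 = start1

End0-suffix : ∀ u v → End0 (x0 ∷ u ++ v) → End0 (x0 ∷ v)
End0-suffix u []      h = here
End0-suffix u (b ∷ v) h = there (End0-drop (x0 ∷ u) h)

-- Minimal elements of a ribbon other than x₁ are labelled e₁, maximal ones e₀.
ribbon-Bounded : ∀ y → All Bounded (ribbon y)
ribbon-Bounded []       = (start1 , here) ∷ []
ribbon-Bounded (x0 ∷ y) = all-concatMap (ribbon-Bounded y) (λ (p , s) (h , e) → map⁺ (All.map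
  (λ { {u , v} ≡.refl → Start1-prefix u v h , there (End0-++ v e) }) (splits-sound p)))
ribbon-Bounded (x1 ∷ y) = all-concatMap (ribbon-Bounded y) (λ (p , s) (h , e) → map⁺ (All.map
  (λ { {u , v} ≡.refl → Start1-++ (p ++ x1 ∷ u) (Start1-∷ʳ p x1 u h) , End0-suffix u v e }) (splits-sound s)))

sh-Start1 : ∀ u p → Start1 (p ∷ʳ x1) → All Start1 (sh (x1 ∷ u) p)
sh-Start1 u []       h      = start1 ∷ []
sh-Start1 u (x1 ∷ p) start1 = ++⁺ (all-map (sh u (x1 ∷ p)) (λ _ → start1)) (all-map (sh (x1 ∷ u) p) (λ _ → start1))

replicate-∷ʳ : {A : Set} (n : ℕ) (a : A) → replicate n a ∷ʳ a ≡ a ∷ replicate n a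
replicate-∷ʳ zero    a = ≡.refl
replicate-∷ʳ (suc n) a = ≡.cong (a ∷_) (replicate-∷ʳ n a)

reverse-replicate : {A : Set} (n : ℕ) (a : A) → reverse (replicate n a) ≡ replicate n a
reverse-replicate zero    a = ≡.refl
reverse-replicate (suc n) a = ≡.trans (unfold-reverse a (replicate n a))
  (≡.trans (≡.cong (_∷ʳ a) (reverse-replicate n a)) (replicate-∷ʳ n a))

dagger-ones : ∀ n → dagger (replicate n x1) ≡ zeros n
dagger-ones n = ≡.trans (≡.cong reverse (map-replicate swapL n x1)) (reverse-replicate n x0)

W-replicate : ∀ n → W (replicate n 0) ≡ replicate n x1
W-replicate zero    = ≡.refl
W-replicate (suc n) = ≡.cong (x1 ∷_) (W-replicate n)

W-chain : ∀ n x v → W (reverse (suc x ∷ replicate n 0) ++ v) ≡ replicate (suc n) x1 ++ x0 ∷ zeros x ++ W v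
W-chain n x v = begin
  W (reverse (suc x ∷ replicate n 0) ++ v)
    ≡⟨ ≡.cong (λ z → W (z ++ v)) (unfold-reverse (suc x) (replicate n 0)) ⟩
  W ((reverse (replicate n 0) ∷ʳ suc x) ++ v)
    ≡⟨ ≡.cong (λ z → W ((z ∷ʳ suc x) ++ v)) (reverse-replicate n 0) ⟩
  W ((replicate n 0 ∷ʳ suc x) ++ v)
    ≡⟨ ≡.cong W (++-assoc (replicate n 0) (suc x ∷ []) v) ⟩
  W (replicate n 0 ++ suc x ∷ v)
    ≡⟨ W-++ (replicate n 0) (suc x ∷ v) ⟩
  W (replicate n 0) ++ x1 ∷ x0 ∷ zeros x ++ W v
    ≡⟨ ≡.cong (_++ x1 ∷ x0 ∷ zeros x ++ W v) (W-replicate n) ⟩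
  replicate n x1 ++ x1 ∷ x0 ∷ zeros x ++ W v
    ≡⟨ ++-assoc (replicate n x1) (x1 ∷ []) _ ⟨
  (replicate n x1 ∷ʳ x1) ++ x0 ∷ zeros x ++ W v
    ≡⟨ ≡.cong (_++ x0 ∷ zeros x ++ W v) (replicate-∷ʳ n x1) ⟩
  replicate (suc n) x1 ++ x0 ∷ zeros x ++ W v ∎
  where open ≡.≡-Reasoning

-- Convolution inverses, ladder recursions, functionals on indices of 1s

module Series {c ℓ : Level} (R : CommutativeRing c ℓ) where
  open Summation R
  open Harmonic R
  open Star R
  open Shuffle R
  open Shift R
  open import Relation.Binary.Reasoning.Setoid setoid

  ∑-* : (xs : List A) (ys : List B) (f : A → Carrier) (g : B → Carrier) →
    ∑ xs (λ x → ∑ ys (λ y → f x * g y)) ≈ ∑ xs f * ∑ ys g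
  ∑-* xs ys f g = trans (∑-cong xs (λ x → ∑-*ˡ (f x) ys g)) (∑-*ʳ (∑ ys g) xs f)

  twist-twist : (f : List A → Carrier) (w : List A) → twist (twist f) w ≈ f w
  twist-twist f w = trans (sym (*-assoc _ _ _)) (trans (*-congʳ (sg-sq w)) (*-identityˡ _))

  twist-cong : {f g : List A → Carrier} → (∀ w → f w ≈ g w) → ∀ w → twist f w ≈ twist g w
  twist-cong h w = *-congˡ (h w)

  conv-twist-∷ : (f g : List A → Carrier) (x : A) (w : List A) →
    conv (twist f) g (x ∷ w) ≈ f [] * g (x ∷ w) + - conv (twist (f ∘ (x ∷_))) g w
  conv-twist-∷ f g x w = begin
    _ ≈⟨ conv-∷ (twist f) g x w ⟩
    _ ≈⟨ +-cong (*-congʳ (*-identityˡ _)) (trans (∑-cong (splits w) (λ _ → trans (*-congʳ (sym (-‿distribˡ-* _ _)))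
           (sym (-‿distribˡ-* _ _)))) (∑-neg (splits w) _)) ⟩
    _ ∎

  -- By hypothesis the terms with non-empty prefix cancel the one with empty prefix. So `g` is the
  -- convolution inverse of the signed `f`.
  conv-ε : (f g : List A → Carrier) → f [] ≈ 1# → g [] ≈ 1# →
    (∀ x w → g (x ∷ w) ≈ conv (twist (f ∘ (x ∷_))) g w) → ∀ w → conv (twist f) g w ≈ ε w
  conv-ε f g f1 g1 h []      = trans (+-identityʳ _) (trans (*-cong (trans (*-identityˡ _) f1) g1) (*-identityˡ _))
  conv-ε f g f1 g1 h (x ∷ w) = begin
    _ ≈⟨ conv-twist-∷ f g x w ⟩
    _ ≈⟨ +-cong (trans (*-congʳ f1) (*-identityˡ _)) (-‿cong (sym (h x w))) ⟩
    _ ≈⟨ -‿inverseʳ _ ⟩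
    _ ∎

  -- Solves the recursion V(X, x∷w) + V(X·x, w) = b(X, []) A(x∷w), which both the
  -- series and the ribbon integrals satisfy.
  ladder : {St : Set} (P : St → Set) (ext : St → ℕ → St) (b V : St → List ℕ → Carrier) (A : List ℕ → Carrier) →
    (∀ X x → P X → P (ext X x)) → A [] ≈ 1# →
    (∀ X x w → b X (x ∷ w) ≈ b (ext X x) w) → (∀ X → V X [] ≈ b X []) →
    (∀ X x w → P X → V X (x ∷ w) + V (ext X x) w ≈ b X [] * A (x ∷ w)) →
    ∀ X w → P X → V X w ≈ conv (twist (b X)) A w
  ladder P ext b V A Pext A1 bext V[] step = go
    where
    go : ∀ X w → P X → V X w ≈ conv (twist (b X)) A w
    go X []      p = trans (V[] X) (sym (trans (+-identityʳ _) (trans (*-cong (*-identityˡ _) A1) (*-identityʳ _))))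
    go X (x ∷ w) p = begin
      V X (x ∷ w)
        ≈⟨ trans (+-congˡ (-‿inverseʳ _)) (+-identityʳ _) ⟨
      V X (x ∷ w) + (V (ext X x) w + - V (ext X x) w)
        ≈⟨ +-assoc _ _ _ ⟨
      V X (x ∷ w) + V (ext X x) w + - V (ext X x) w
        ≈⟨ +-cong (step X x w p) (-‿cong (go (ext X x) w (Pext X x p))) ⟩
      b X [] * A (x ∷ w) + - conv (twist (b (ext X x))) A w
        ≈⟨ +-congˡ (-‿cong (conv-cong (twist-cong (λ v → sym (bext X x v))) (λ _ → refl) w)) ⟩
      b X [] * A (x ∷ w) + - conv (twist (b X ∘ (x ∷_))) A w
        ≈⟨ conv-twist-∷ (b X) A x w ⟨
      _ ∎

  -- The series ∑ a_j u^j, as a functional supported on the indices (1, …, 1).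
  onOnes : (ℕ → Carrier) → List ℕ → Carrier
  onOnes a []          = a 0
  onOnes a (zero ∷ v)  = onOnes (a ∘ suc) v
  onOnes a (suc _ ∷ v) = 0#

  onOnes-++-suc : ∀ a u x v → onOnes a (u ++ suc x ∷ v) ≈ 0#
  onOnes-++-suc a []          x v = refl
  onOnes-++-suc a (zero ∷ u)  x v = onOnes-++-suc (a ∘ suc) u x v
  onOnes-++-suc a (suc _ ∷ u) x v = refl

  -- A suffix that contains the entry `suc x` is killed by `onOnes a`, so only cuts behind that
  -- entry survive.
  conv-onOnes-++ : ∀ a (g : List ℕ → Carrier) u x v →
    conv g (onOnes a) (u ++ suc x ∷ v) ≈ conv (λ w → g (u ++ suc x ∷ w)) (onOnes a) v
  conv-onOnes-++ a g u x v = begin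
    _ ≈⟨ ∑-splits-++ u (suc x) v _ ⟩
    _ ≈⟨ +-congʳ (∑-zero (splits u) (λ (p , q) → trans (*-congˡ (onOnes-++-suc a q x v)) (zeroʳ _))) ⟩
    _ ≈⟨ +-identityˡ _ ⟩
    _ ∎

  -- A positive shift enlarges at least one entry, and no index of 1s remains.
  ∑-shift-onOnes : ∀ m a v → ∑ (shift (suc m) v) (onOnes a) ≈ 0#
  ∑-shift-onOnes m a []          = refl
  ∑-shift-onOnes m a (suc k ∷ v) = trans (∑-shift (suc m) (suc k) v _)
    (∑-zero (spread (suc (suc k)) (suc m)) (λ (u , r) → ∑-zero (shift r v) (λ _ → refl)))
  ∑-shift-onOnes m a (zero ∷ v)  = begin
    _ ≈⟨ ∑-shift (suc m) 0 v _ ⟩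
    _ ≈⟨ ∑-spread 0 (suc m) _ ⟩
    _ ≈⟨ ∑-pairs-suc m _ ⟩
    _ ≈⟨ +-cong (trans (+-identityʳ _) (∑-shift-onOnes m (a ∘ suc) v))
           (∑-zero (pairs m) (λ (i , j) → trans (+-identityʳ _) (∑-zero (shift j v) (λ _ → refl)))) ⟩
    _ ≈⟨ +-identityʳ _ ⟩
    _ ∎

  shifted : ℕ → (List ℕ → Carrier) → List ℕ → Carrier
  shifted m f v = ∑ (shift m v) f

  ∑-shift-onOnes-* : ∀ m a (f : List ℕ → Carrier) v →
    ∑ (shift m v) (λ u → f [] * onOnes a u) ≈ shifted m f [] * onOnes a v
  ∑-shift-onOnes-* zero    a f v = trans (∑-shift-0 v _) (*-congʳ (sym (+-identityʳ _)))
  ∑-shift-onOnes-* (suc m) a f v = begin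
    _ ≈⟨ ∑-*ˡ (f []) (shift (suc m) v) _ ⟩
    _ ≈⟨ *-congˡ (∑-shift-onOnes m a v) ⟩
    _ ≈⟨ trans (zeroʳ _) (sym (zeroˡ _)) ⟩
    _ ∎

  -- Terms in which the right part is shifted by a positive amount vanish by `∑-shift-onOnes`, so
  -- the whole shift falls on `f`.
  shifted-conv : ∀ m a (f : List ℕ → Carrier) v →
    shifted m (conv f (onOnes a)) v ≈ conv (shifted m f) (onOnes a) v
  shifted-conv zero    a f []      = +-congʳ (trans (+-identityʳ _) (*-congʳ (sym (+-identityʳ _))))
  shifted-conv (suc m) a f []      = sym (trans (+-identityʳ _) (zeroˡ _))
  shifted-conv m       a f (k ∷ v) = begin
    ∑ (shift m (k ∷ v)) (conv f (onOnes a))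
      ≈⟨ ∑-shift m k v _ ⟩
    ∑ Y (λ (u , r) → ∑ (shift r v) (λ v′ → conv f (onOnes a) (k +ℕ u ∷ v′)))
      ≈⟨ ∑-cong Y (λ (u , r) → trans (∑-cong (shift r v) (λ v′ → conv-∷ f (onOnes a) (k +ℕ u) v′)) (∑-+ (shift r v) _ _)) ⟩
    _ ≈⟨ ∑-+ Y _ _ ⟩
    _ ≈⟨ +-cong (trans (sym (∑-shift m k v _)) (∑-shift-onOnes-* m a f (k ∷ v)))
           (∑-cong Y (λ (u , r) → shifted-conv r a (f ∘ (k +ℕ u ∷_)) v)) ⟩
    _ ≈⟨ +-congˡ (∑-swap Y (splits v) _) ⟩
    _ ≈⟨ +-congˡ (∑-cong (splits v) (λ (p , q) → trans (∑-*ʳ (onOnes a q) Y _) (*-congʳ (sym (∑-shift m k p f))))) ⟩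
    _ ≈⟨ conv-∷ (shifted m f) (onOnes a) k v ⟨
    _ ∎
    where Y = spread (suc k) m

  -- The Kawashima functions, from series and from zigzag integrals

  module Kawashima
    (F : Word → Carrier) (G : List ℕ → Carrier) (a : ℕ → Carrier)
    (F-[] : F [] ≈ 1#) (G-[] : G [] ≈ 1#)
    (F-sh : ∀ v w → ∑ (sh (W v) (W w)) F ≈ F (W v) * F (W w))
    (G-H : ∀ v w → ∑ (H v w) G ≈ G v * G w)
    (F-W : ∀ v → F (W v) ≈ conv G (onOnes a) v)
    (F-dagger : ∀ w → Start1 w → End0 w → F w ≈ F (dagger w))
    where

    -- `J` and `cap` act on the first entry, whereas the largest summation variable of an index
    -- belongs to its last entry.
    Gʳ : List ℕ → Carrier
    Gʳ = G ∘ reverse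

    Gʳ-H : ∀ v w → ∑ (H v w) Gʳ ≈ Gʳ v * Gʳ w
    Gʳ-H v w = trans (sym (∑-H-reverse v w G)) (G-H (reverse v) (reverse w))

    star* : List ℕ → Carrier
    star* v = ∑ (S v) Gʳ

    -- With `x = suc y` and `c` all zeros this will be Z((1,...,1) ⊛ l^⋆) for the index l that reads
    -- `y ∷ v` from the right. Other `c` arise because the ladder moves entries of `v` over.
    capped : ℕ × List ℕ → List ℕ → Carrier
    capped (x , c) v = ∑ (S v) (λ w → ∑ (cap x c w) Gʳ)

    star*-[] : star* [] ≈ 1#
    star*-[] = trans (+-identityʳ _) G-[]

    capped-conv : ∀ x c v → capped (x , c) v ≈ conv (twist (λ w → G (reverse (x ∷ c) ++ w))) star* v
    capped-conv x c v = ladder (λ _ → ⊤) (λ (x , c) y → y , x ∷ c) (λ (x , c) w → G (reverse (x ∷ c) ++ w)) capped star*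
      (λ _ _ _ → tt) star*-[]
      (λ (x , c) y w → reflexive (≡.cong G (≡.trans (≡.sym (++-assoc (reverse (x ∷ c)) (y ∷ []) w))
        (≡.cong (_++ w) (≡.sym (unfold-reverse y (x ∷ c)))))))
      (λ (x , c) → trans (+-identityʳ _) (trans (+-identityʳ _) (reflexive (≡.cong G (≡.sym (++-identityʳ _))))))
      (λ (x , c) y w _ → begin
        _ ≈⟨ ∑-S-cap x c y w Gʳ ⟩
        _ ≈⟨ ∑-cong (S (y ∷ w)) (λ z → Gʳ-H (x ∷ c) z) ⟩
        _ ≈⟨ ∑-*ˡ (Gʳ (x ∷ c)) (S (y ∷ w)) Gʳ ⟩
        _ ≈⟨ *-congʳ (reflexive (≡.cong G (≡.sym (++-identityʳ _)))) ⟩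
        _ ∎)
      (x , c) v tt

    -- The antipode relation, up to reversal: capping by a single entry just lengthens a star sum by
    -- that entry.
    G*star* : ∀ v → conv (twist G) star* v ≈ ε v
    G*star* = conv-ε G star* G-[] star*-[] (λ x w → trans (∑-S-∷ x w Gʳ)
      (trans (∑-cong (S w) (λ z → reflexive (≡.cong (λ X → ∑ X Gʳ) (J-cap x z)))) (capped-conv x [] w)))
      where
      J-cap : ∀ x w → J x w ≡ cap x [] w
      J-cap x []      = ≡.refl
      J-cap x (y ∷ w) = ≡.refl

    -- Shuffle counterpart of `star*`: the zigzag integral of a star sum, regularized by `F`.
    starˢ : List ℕ → Carrier
    starˢ []      = 1#
    starˢ (x ∷ v) = ∑ (ribbon (zeros x ++ W v)) (λ (p , s) → F (p ++ x1 ∷ s))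

    chained : List Marked → List ℕ → Carrier
    chained X v = ∑ (aboves (W v) X) (F ∘ total)

    glued : List Marked → List ℕ → Carrier
    glued X v = ∑ X (λ t → glue t (W v) F)

    F-Start1 : ∀ {v w} → Start1 v → Start1 w → ∑ (sh v w) F ≈ F v * F w
    F-Start1 hv hw with Start1-W hv | Start1-W hw
    ... | v , ≡.refl | w , ≡.refl = F-sh v w

    -- Each e₁ of the zigzag is a rung of the ladder: `glue-x1` cuts there, and in the complementary
    -- case the run of e₀ behind it joins the chain by `glue-x0s`.
    glued-conv : ∀ X v → All Good X → glued X v ≈ conv (twist (chained X)) starˢ v
    glued-conv = ladder (All Good) (λ X x → aboves (x1 ∷ zeros x) X) chained glued starˢ
      (λ X x → aboves-Good (x1 ∷ zeros x)) refl
      (λ X x w → reflexive (≡.cong (λ Y → ∑ Y (F ∘ total)) (aboves-++ (x1 ∷ zeros x) (W w) X)))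
      (λ X → ∑-cong X (λ t → glue-[] t F))
      (λ X x w g → begin
        _ ≈⟨ +-congˡ (glue-x0s x (above x1 X) (W w) F) ⟨
        _ ≈⟨ glue-x1 X (zeros x ++ W w) F ⟩
        _ ≈⟨ ∑-cong-All g (λ (p′ , a , s′) h → ∑-cong-All (ribbon-Bounded (zeros x ++ W w))
               (λ (p , s) (h′ , _) → F-Start1 (Start1-∷ʳ p′ a s′ h) (Start1-∷ʳ p x1 s h′))) ⟩
        _ ≈⟨ ∑-* X (ribbon (zeros x ++ W w)) _ _ ⟩
        _ ∎)

    glue-conv : ∀ t x v → Good t →
      glue t (zeros x ++ W v) F ≈ conv (twist (λ w → ∑ (aboves (zeros x ++ W w) [ t ]) (F ∘ total))) starˢ v
    glue-conv t x v g = begin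
      _ ≈⟨ +-identityʳ _ ⟨
      _ ≈⟨ glue-x0s x [ t ] (W v) F ⟩
      _ ≈⟨ glued-conv (aboves (zeros x) [ t ]) v (aboves-Good (zeros x) (g ∷ [])) ⟩
      _ ≈⟨ conv-cong (twist-cong (λ w → reflexive (≡.cong (λ Y → ∑ Y (F ∘ total)) (≡.sym (aboves-++ (zeros x) (W w) [ t ])))))
             (λ _ → refl) v ⟩
      _ ∎

    glue-chain-conv : ∀ p b x v → Start1 (p ∷ʳ b) →
      glue (p , b , []) (zeros x ++ W v) F ≈ conv (twist (λ w → F (p ++ b ∷ zeros x ++ W w))) starˢ v
    glue-chain-conv p b x v g = trans (glue-conv (p , b , []) x v g) (conv-cong (twist-cong (λ w →
      trans (∑-aboves (zeros x ++ W w) [ p , b , [] ] F) (trans (+-identityʳ _) (+-identityʳ _)))) (λ _ → refl) v)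

    F*starˢ : ∀ v → conv (twist (F ∘ W)) starˢ v ≈ ε v
    F*starˢ = conv-ε (F ∘ W) starˢ F-[] refl (λ x w → trans
      (∑-cong (ribbon (zeros x ++ W w)) (λ _ → sym (trans (+-identityʳ _) (+-identityʳ _))))
      (glue-chain-conv [] x1 x w start1))

    -- `star*` and `starˢ` are the inverses of the signed Z_* and Z_⧢. Since Z_⧢ is Z_* times
    -- `onOnes a`, the inverses differ by the same signed factor on the other side, once the unital
    -- `twist G` is cancelled.
    star*-starˢ : ∀ v → star* v ≈ conv (twist (onOnes a)) starˢ v
    star*-starˢ = conv-cancelˡ (twist G) star* _ (trans (*-identityˡ _) G-[]) (λ v → begin
      _ ≈⟨ G*star* v ⟩
      _ ≈⟨ F*starˢ v ⟨
      _ ≈⟨ conv-cong (λ w → trans (twist-cong F-W w) (sym (conv-twist G (onOnes a) w))) (λ _ → refl) v ⟩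
      _ ≈⟨ conv-assoc (twist G) (twist (onOnes a)) starˢ v ⟩
      _ ∎)

    -- The signed `onOnes a` moves from the left factor to the right one, where `star*-starˢ`
    -- absorbs it. So identities for zigzag integrals become identities for star sums.
    transfer : ∀ (f g : List ℕ → Carrier) → (∀ v → f v ≈ conv g (onOnes a) v) →
      ∀ v → conv (twist f) starˢ v ≈ conv (twist g) star* v
    transfer f g h v = begin
      _ ≈⟨ conv-cong (λ w → trans (twist-cong h w) (sym (conv-twist g (onOnes a) w))) (λ _ → refl) v ⟩
      _ ≈⟨ conv-assoc (twist g) (twist (onOnes a)) starˢ v ⟩
      _ ≈⟨ conv-cong (λ _ → refl) star*-starˢ v ⟨
      _ ∎

    -- The integral-series identity for ((1, …, 1), l).
    capped-glue : ∀ n x v →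
      capped (suc x , replicate n 0) v ≈ glue (replicate (suc n) x1 , x0 , []) (zeros x ++ W v) F
    capped-glue n x v = begin
      _ ≈⟨ capped-conv (suc x) (replicate n 0) v ⟩
      _ ≈⟨ transfer (λ w → F (replicate (suc n) x1 ++ x0 ∷ zeros x ++ W w)) (λ w → G (reverse (suc x ∷ replicate n 0) ++ w)) eq v ⟨
      _ ≈⟨ glue-chain-conv (replicate (suc n) x1) x0 x v start1 ⟨
      _ ∎
      where
      d : ∀ w → reverse (suc x ∷ replicate n 0) ++ w ≡ reverse (replicate n 0) ++ suc x ∷ w
      d w = ≡.trans (≡.cong (_++ w) (unfold-reverse (suc x) (replicate n 0))) (++-assoc (reverse (replicate n 0)) (suc x ∷ []) w)
      eq : ∀ w → F (replicate (suc n) x1 ++ x0 ∷ zeros x ++ W w) ≈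
        conv (λ w → G (reverse (suc x ∷ replicate n 0) ++ w)) (onOnes a) w
      eq w = begin
        _ ≡⟨ ≡.cong F (≡.trans (≡.sym (W-chain n x w)) (≡.cong W (d w))) ⟩
        _ ≈⟨ F-W _ ⟩
        -- The entry `suc x` stands for an integer at least 2, so the 1s seen by `onOnes a` all lie
        -- in `w`.
        _ ≈⟨ conv-onOnes-++ a G (reverse (replicate n 0)) x w ⟩
        _ ≈⟨ conv-cong (λ z → reflexive (≡.cong G (≡.sym (d z)))) (λ _ → refl) w ⟩
        _ ∎

    -- Every linear extension begins with e₁ and ends with e₀, so duality applies to each. The chain
    -- e₁^(n+1) e₀, marked at its top, becomes e₁ e₀^(n+1), marked at its bottom.
    glue-dual : ∀ n y → glue (replicate (suc n) x1 , x0 , []) y F ≈ glue ([] , x1 , zeros (suc n)) (map swapL y) F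
    glue-dual n y = begin
      _ ≈⟨ ∑-cong-All (ribbon-Bounded y) (λ (p , s) (h , e) → ∑-cong-All (sh-Start1 (replicate n x1) p h) (λ u hu →
             +-congʳ (F-dagger (u ++ x0 ∷ s) (Start1-++ u hu) (End0-++ u e)))) ⟩
      _ ≈⟨ glue-dagger (replicate (suc n) x1) x0 [] y F ⟩
      _ ≡⟨ ≡.cong (λ z → glue ([] , x1 , z) (map swapL y) F) (dagger-ones (suc n)) ⟩
      _ ∎

    -- Up to sign, the coefficient of z^m in the Kawashima function.
    kaw : ℕ → List ℕ → Carrier
    kaw m = conv (shifted m G) (twist star*)

    glue-kaw : ∀ n x v → glue ([] , x1 , zeros (suc n)) (zeros x ++ W v) F ≈ - twist (kaw (suc n)) (x ∷ v)
    glue-kaw n x v = begin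
      _ ≈⟨ glue-conv ([] , x1 , zeros m) x v start1 ⟩
      _ ≈⟨ conv-cong (twist-cong (λ w → trans (∑-aboves (zeros x ++ W w) _ F)
             (trans (+-identityʳ _) (∑-sh-zeros-W m x w F)))) (λ _ → refl) v ⟩
      conv (twist (D ∘ (x ∷_))) starˢ v
        ≈⟨ -‿involutive _ ⟨
      - - conv (twist (D ∘ (x ∷_))) starˢ v
        -- Completes the sum to a convolution on `x ∷ v`; the added term vanishes because the empty
        -- index has no positive shift.
        ≈⟨ -‿cong (trans (+-congʳ (zeroˡ _)) (+-identityˡ _)) ⟨
      - (0# * starˢ (x ∷ v) + - conv (twist (D ∘ (x ∷_))) starˢ v)
        ≈⟨ -‿cong (conv-twist-∷ D starˢ x v) ⟨
      - conv (twist D) starˢ (x ∷ v)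
        ≈⟨ -‿cong (transfer D (shifted m G) (λ w → trans (∑-cong (shift m w) F-W) (shifted-conv m a G w)) (x ∷ v)) ⟩
      - conv (twist (shifted m G)) star* (x ∷ v)
        ≈⟨ -‿cong (conv-cong (λ _ → refl) (λ w → sym (twist-twist star* w)) (x ∷ v)) ⟩
      - conv (twist (shifted m G)) (twist (twist star*)) (x ∷ v)
        ≈⟨ -‿cong (conv-twist (shifted m G) (twist star*) (x ∷ v)) ⟩
      - twist (kaw m) (x ∷ v) ∎
      where
      m = suc n
      D = shifted m (F ∘ W)

    -- The shift of degree 0 is the identity, which leaves, up to signs, the convolution of `G` with
    -- its inverse.
    kaw-0 : ∀ x v → kaw 0 (x ∷ v) ≈ 0#
    kaw-0 x v = begin
      kaw 0 (x ∷ v)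
        ≈⟨ twist-twist (kaw 0) (x ∷ v) ⟨
      twist (twist (kaw 0)) (x ∷ v)
        ≈⟨ *-congˡ (sym (conv-twist (shifted 0 G) (twist star*) (x ∷ v))) ⟩
      sg (x ∷ v) * conv (twist (shifted 0 G)) (twist (twist star*)) (x ∷ v)
        ≈⟨ *-congˡ (conv-cong (twist-cong (λ w → ∑-shift-0 w G)) (twist-twist star*) (x ∷ v)) ⟩
      sg (x ∷ v) * conv (twist G) star* (x ∷ v)
        ≈⟨ *-congˡ (G*star* (x ∷ v)) ⟩
      sg (x ∷ v) * 0#
        ≈⟨ zeroʳ _ ⟩
      0# ∎

    twist-star*-H : ∀ v w → ∑ (H v w) (twist star*) ≈ twist star* v * twist star* w
    twist-star*-H v w = begin
      _ ≈⟨ ∑-H-S v w Gʳ ⟩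
      _ ≈⟨ *-congˡ (trans (∑-cong (S v) (λ x → ∑-cong (S w) (λ y → Gʳ-H x y))) (∑-* (S v) (S w) Gʳ Gʳ)) ⟩
      _ ≈⟨ *-interchange _ _ _ _ ⟩
      _ ∎

    shifted-H : ∀ m v w → ∑ (H v w) (shifted m G) ≈ ∑ (pairs m) (λ (i , j) → shifted i G v * shifted j G w)
    shifted-H m v w = begin
      _ ≈⟨ ∑-H-shift m v w G ⟩
      _ ≈⟨ ∑-cong (pairs m) (λ (i , j) → trans (∑-cong (shift i v) (λ x → ∑-cong (shift j w) (λ y → G-H x y)))
             (∑-* (shift i v) (shift j w) G G)) ⟩
      _ ∎

    -- Shifts and signed star sums are both multiplicative, and `∑-H-splits` passes this on to their
    -- convolution.
    kaw-H : ∀ m v w → ∑ (H v w) (kaw m) ≈ ∑ (pairs m) (λ (i , j) → kaw i v * kaw j w)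
    kaw-H m v w = begin
      _ ≈⟨ ∑-H-splits v w (λ x y → shifted m G x * twist star* y) ⟩
      _ ≈⟨ ∑-cong (splits v) (λ (v₁ , v₂) → ∑-cong (splits w) (λ (w₁ , w₂) → begin
             _ ≈⟨ ∑-* (H v₁ w₁) (H v₂ w₂) _ _ ⟩
             _ ≈⟨ *-cong (shifted-H m v₁ w₁) (twist-star*-H v₂ w₂) ⟩
             _ ≈⟨ ∑-*ʳ _ (pairs m) _ ⟨
             _ ≈⟨ ∑-cong (pairs m) (λ _ → *-interchange _ _ _ _) ⟩
             _ ∎)) ⟩
      _ ≈⟨ ∑-cong (splits v) (λ _ → ∑-swap (splits w) (pairs m) _) ⟩
      _ ≈⟨ ∑-swap (splits v) (pairs m) _ ⟩
      _ ≈⟨ ∑-cong (pairs m) (λ _ → ∑-* (splits v) (splits w) _ _) ⟩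
      _ ∎

-- Rational scalars, formal linear combinations, polynomials

suc/1 : ∀ n → ℤ.+ suc n / 1 ≡ 1ℚ ℚ.+ (ℤ.+ n / 1)
suc/1 n = toℚᵘ-injective (begin
  toℚᵘ (ℤ.+ suc n / 1)                  ≈⟨ toℚᵘ-fromℚᵘ (mkℚᵘ (ℤ.+ suc n) 0) ⟩
  mkℚᵘ (ℤ.+ suc n) 0                    ≈⟨ *≡* (≡.cong (λ z → (ℤ.+ 1 ℤ.+ z) ℤ.* ℤ.+ 1) (≡.sym (ℤ.*-identityʳ (ℤ.+ n)))) ⟩
  toℚᵘ 1ℚ ℚᵘ.+ mkℚᵘ (ℤ.+ n) 0           ≈⟨ ℚᵘ.+-congʳ (toℚᵘ 1ℚ) (toℚᵘ-fromℚᵘ (mkℚᵘ (ℤ.+ n) 0)) ⟨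
  toℚᵘ 1ℚ ℚᵘ.+ toℚᵘ (ℤ.+ n / 1)         ≈⟨ toℚᵘ-homo-+ 1ℚ (ℤ.+ n / 1) ⟨
  toℚᵘ (1ℚ ℚ.+ (ℤ.+ n / 1))             ∎)
  where open ℚᵘ.≃-Reasoning

1/suc : ∀ n → (ℤ.+ 1 / suc n) ℚ.* (ℤ.+ suc n / 1) ≡ 1ℚ
1/suc n = toℚᵘ-injective (begin
  toℚᵘ ((ℤ.+ 1 / suc n) ℚ.* (ℤ.+ suc n / 1))       ≈⟨ toℚᵘ-homo-* (ℤ.+ 1 / suc n) (ℤ.+ suc n / 1) ⟩
  toℚᵘ (ℤ.+ 1 / suc n) ℚᵘ.* toℚᵘ (ℤ.+ suc n / 1)   ≈⟨ ℚᵘ.*-cong (toℚᵘ-fromℚᵘ (mkℚᵘ (ℤ.+ 1) n)) (toℚᵘ-fromℚᵘ (mkℚᵘ (ℤ.+ suc n) 0)) ⟩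
  mkℚᵘ (ℤ.+ 1) n ℚᵘ.* mkℚᵘ (ℤ.+ suc n) 0           ≈⟨ *≡* (≡.trans (≡.cong (ℤ._* ℤ.+ 1) (ℤ.*-comm (ℤ.+ 1) (ℤ.+ suc n))) (ℤ.*-comm (ℤ.+ suc n ℤ.* ℤ.+ 1) (ℤ.+ 1))) ⟩
  toℚᵘ 1ℚ                                          ∎)
  where open ℚᵘ.≃-Reasoning

module Evaluation {c ℓ : Level} (R : CommutativeRing c ℓ) (ι : ℚ → CommutativeRing.Carrier R)
  (ι-hom : IsRingHomomorphism +-*-rawRing (CommutativeRing.rawRing R) ι) where
  open Summation R
  open Harmonic R
  open Star R
  open Shuffle R
  open Shift R
  open Series R
  open IsRingHomomorphism ι-hom using (+-homo; *-homo; 1#-homo; -‿homo) renaming (0#-homo to ι-0)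
  open import Relation.Binary.Reasoning.Setoid setoid

  natR-suc : ∀ n → natR R ι (suc n) ≈ 1# + natR R ι n
  natR-suc n = trans (reflexive (≡.cong ι (suc/1 n))) (trans (+-homo _ _) (+-congʳ 1#-homo))

  natR-+ : ∀ m n → natR R ι (m +ℕ n) ≈ natR R ι m + natR R ι n
  natR-+ zero    n = sym (trans (+-congʳ ι-0) (+-identityˡ _))
  natR-+ (suc m) n = begin
    _ ≈⟨ natR-suc (m +ℕ n) ⟩
    _ ≈⟨ +-congˡ (natR-+ m n) ⟩
    _ ≈⟨ +-assoc _ _ _ ⟨
    _ ≈⟨ +-congʳ (natR-suc m) ⟨
    _ ∎

  natR-* : ∀ m n → natR R ι (m *ℕ n) ≈ natR R ι m * natR R ι n
  natR-* zero    n = trans ι-0 (sym (trans (*-congʳ ι-0) (zeroˡ _)))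
  natR-* (suc m) n = begin
    _ ≈⟨ natR-+ n (m *ℕ n) ⟩
    _ ≈⟨ +-cong (sym (*-identityˡ _)) (natR-* m n) ⟩
    _ ≈⟨ distribʳ _ _ _ ⟨
    _ ≈⟨ *-congʳ (natR-suc m) ⟨
    _ ∎

  natR-suc-cancel : ∀ n x → natR R ι (suc n) * x ≈ 0# → x ≈ 0#
  natR-suc-cancel n x h = begin
    x                                               ≈⟨ *-identityˡ x ⟨
    1# * x                                          ≈⟨ *-congʳ (trans (reflexive (≡.cong ι (1/suc n))) 1#-homo) ⟨
    ι ((ℤ.+ 1 / suc n) ℚ.* (ℤ.+ suc n / 1)) * x     ≈⟨ *-congʳ (*-homo _ _) ⟩
    ι (ℤ.+ 1 / suc n) * natR R ι (suc n) * x        ≈⟨ *-assoc _ _ _ ⟩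
    ι (ℤ.+ 1 / suc n) * (natR R ι (suc n) * x)      ≈⟨ *-congˡ h ⟩
    ι (ℤ.+ 1 / suc n) * 0#                          ≈⟨ zeroʳ _ ⟩
    0#                                              ∎

  lin : List (ℚ × A) → (A → Carrier) → Carrier
  lin []             Φ = 0#
  lin ((q , x) ∷ xs) Φ = ι q * Φ x + lin xs Φ

  lin-++ : (xs ys : List (ℚ × A)) (Φ : A → Carrier) → lin (xs ++ ys) Φ ≈ lin xs Φ + lin ys Φ
  lin-++ []       ys Φ = sym (+-identityˡ _)
  lin-++ (x ∷ xs) ys Φ = trans (+-congˡ (lin-++ xs ys Φ)) (sym (+-assoc _ _ _))

  lin-mapL : (f : A → B) (xs : List (ℚ × A)) (Φ : B → Carrier) → lin (mapL f xs) Φ ≈ lin xs (Φ ∘ f)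
  lin-mapL f []       Φ = refl
  lin-mapL f (x ∷ xs) Φ = +-congˡ (lin-mapL f xs Φ)

  lin-scaleL : (q : ℚ) (xs : List (ℚ × A)) (Φ : A → Carrier) → lin (scaleL q xs) Φ ≈ ι q * lin xs Φ
  lin-scaleL q []             Φ = sym (zeroʳ _)
  lin-scaleL q ((r , x) ∷ xs) Φ = trans (+-cong (trans (*-congʳ (*-homo q r)) (*-assoc _ _ _)) (lin-scaleL q xs Φ)) (sym (distribˡ _ _ _))

  lin-extL : (f : A → List (ℚ × B)) (xs : List (ℚ × A)) (Φ : B → Carrier) →
    lin (extL f xs) Φ ≈ lin xs (λ x → lin (f x) Φ)
  lin-extL f []             Φ = refl
  lin-extL f ((q , x) ∷ xs) Φ = trans (lin-++ (scaleL q (f x)) (extL f xs) Φ) (+-cong (lin-scaleL q (f x) Φ) (lin-extL f xs Φ))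

  lin-single : (x : A) (Φ : A → Carrier) → lin [ 1ℚ , x ] Φ ≈ Φ x
  lin-single x Φ = trans (+-identityʳ _) (trans (*-congʳ 1#-homo) (*-identityˡ _))

  lin-ext2L : {C : Set} (f : A → B → List (ℚ × C)) (x : A) (ys : List (ℚ × B)) (Φ : C → Carrier) →
    lin (ext2L f [ 1ℚ , x ] ys) Φ ≈ lin ys (λ y → lin (f x y) Φ)
  lin-ext2L f x []             Φ = refl
  lin-ext2L f x ((q , y) ∷ ys) Φ = begin
    lin (ext2L f [ 1ℚ , x ] ((q , y) ∷ ys)) Φ
      ≡⟨ ≡.cong (λ z → lin z Φ) (++-assoc (scaleL (1ℚ ℚ.* q) (f x y)) _ []) ⟩
    lin (scaleL (1ℚ ℚ.* q) (f x y) ++ ext2L f [ 1ℚ , x ] ys) Φ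
      ≈⟨ lin-++ (scaleL (1ℚ ℚ.* q) (f x y)) (ext2L f [ 1ℚ , x ] ys) Φ ⟩
    _ ≈⟨ +-cong (lin-scaleL (1ℚ ℚ.* q) (f x y) Φ) (lin-ext2L f x ys Φ) ⟩
    _ ≈⟨ +-congʳ (*-congʳ (trans (*-homo 1ℚ q) (trans (*-congʳ 1#-homo) (*-identityˡ _)))) ⟩
    _ ∎

  ZW-lin : (Z : Word → Carrier) (xs : LinW) → ZW R ι Z xs ≈ lin xs Z
  ZW-lin Z []       = refl
  ZW-lin Z (x ∷ xs) = +-congˡ (ZW-lin Z xs)

  ZI-lin : (Z : Word → Carrier) (xs : LinI) → ZI R ι Z xs ≈ lin xs (Z ∘ toW)
  ZI-lin Z xs = trans (ZW-lin Z (mapL toW xs)) (lin-mapL toW xs Z)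

  lin-shuffle : ∀ v w (Φ : Word → Carrier) → lin (shuffle v w) Φ ≈ ∑ (sh v w) Φ
  lin-shuffle []      w       Φ = trans (lin-single w Φ) (sym (+-identityʳ _))
  lin-shuffle (a ∷ v) []      Φ = trans (lin-single (a ∷ v) Φ) (sym (+-identityʳ _))
  lin-shuffle (a ∷ v) (b ∷ w) Φ = begin
    _ ≈⟨ lin-++ (mapL (a ∷_) (shuffle v (b ∷ w))) _ Φ ⟩
    _ ≈⟨ +-cong (lin-mapL _ (shuffle v (b ∷ w)) Φ) (lin-mapL _ (shuffle (a ∷ v) w) Φ) ⟩
    _ ≈⟨ +-cong (lin-shuffle v (b ∷ w) _) (lin-shuffle (a ∷ v) w _) ⟩
    _ ≈⟨ ∑-sh a v b w Φ ⟨
    _ ∎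

  lin-harm : ∀ v w (Φ : Index → Carrier) → lin (harm (map suc v) (map suc w)) Φ ≈ ∑ (H v w) (Φ ∘ map suc)
  lin-harm []      w       Φ = trans (lin-single (map suc w) Φ) (sym (+-identityʳ _))
  lin-harm (k ∷ v) []      Φ = trans (lin-single (map suc (k ∷ v)) Φ) (sym (+-identityʳ _))
  lin-harm (k ∷ v) (l ∷ w) Φ = begin
    _ ≈⟨ lin-++ (mapL (suc k ∷_) (harm (map suc v) (map suc (l ∷ w)))) _ Φ ⟩
    _ ≈⟨ +-cong (lin-mapL _ (harm (map suc v) (map suc (l ∷ w))) Φ)
           (trans (lin-++ (mapL (suc l ∷_) (harm (map suc (k ∷ v)) (map suc w))) _ Φ)
             (+-cong (lin-mapL _ (harm (map suc (k ∷ v)) (map suc w)) Φ) (lin-mapL _ (harm (map suc v) (map suc w)) Φ))) ⟩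
    _ ≈⟨ +-cong (lin-harm v (l ∷ w) _) (+-cong (lin-harm (k ∷ v) w _) (lin-harm v w _)) ⟩
    _ ≈⟨ ∑-H k v l w (Φ ∘ map suc) ⟨
    _ ∎

  private
    signs : ∀ s t x y z → s * - t * x + (- s * t * y + - (s * t * z)) ≈ (- s * - t) * (- x + (- y + - z))
    signs s t x y z = begin
      s * - t * x + (- s * t * y + - (s * t * z))
        ≈⟨ +-cong (*-congʳ (-‿distribʳ-* s t)) (+-congʳ (*-congʳ (-‿distribˡ-* s t))) ⟨
      - (s * t) * x + (- (s * t) * y + - (s * t * z))
        ≈⟨ +-cong (neg x) (+-cong (neg y) (-‿distribʳ-* (s * t) z)) ⟩
      s * t * - x + (s * t * - y + s * t * - z)
        ≈⟨ trans (distribˡ _ _ _) (+-congˡ (distribˡ _ _ _)) ⟨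
      s * t * (- x + (- y + - z))
        ≈⟨ *-congʳ (-a*-b≈a*b s t) ⟨
      (- s * - t) * (- x + (- y + - z)) ∎
      where
      neg : ∀ x → - (s * t) * x ≈ s * t * - x
      neg x = trans (sym (-‿distribˡ-* (s * t) x)) (-‿distribʳ-* (s * t) x)

  -- Conjugation by the sign of the length turns the harmonic product into the star-harmonic one:
  -- only the merging term changes the number of entries.
  lin-sharm : ∀ v w (Φ : Index → Carrier) →
    lin (sharm (map suc v) (map suc w)) Φ ≈ sg v * sg w * ∑ (H v w) (twist (Φ ∘ map suc))
  lin-sharm []      w       Φ = begin
    _ ≈⟨ lin-single (map suc w) Φ ⟩
    _ ≈⟨ twist-twist (Φ ∘ map suc) w ⟨
    _ ≈⟨ *-cong (*-identityˡ _) (+-identityʳ _) ⟨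
    _ ∎
  lin-sharm (k ∷ v) []      Φ = begin
    _ ≈⟨ lin-single (map suc (k ∷ v)) Φ ⟩
    _ ≈⟨ twist-twist (Φ ∘ map suc) (k ∷ v) ⟨
    _ ≈⟨ *-cong (*-identityʳ _) (+-identityʳ _) ⟨
    _ ∎
  lin-sharm (k ∷ v) (l ∷ w) Φ = begin
    _ ≈⟨ lin-++ (mapL (suc k ∷_) (sharm (map suc v) (map suc (l ∷ w)))) _ Φ ⟩
    _ ≈⟨ +-cong (lin-mapL _ (sharm (map suc v) (map suc (l ∷ w))) Φ)
           (trans (lin-++ (mapL (suc l ∷_) (sharm (map suc (k ∷ v)) (map suc w))) _ Φ)
             (+-cong (lin-mapL _ (sharm (map suc (k ∷ v)) (map suc w)) Φ)
               (trans (lin-scaleL (ℚ.- 1ℚ) (mapL (suc k +ℕ suc l ∷_) (sharm (map suc v) (map suc w))) Φ)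
                 (*-cong (trans (-‿homo 1ℚ) (-‿cong 1#-homo)) (lin-mapL _ (sharm (map suc v) (map suc w)) Φ))))) ⟩
    _ ≈⟨ +-cong (lin-sharm v (l ∷ w) _) (+-cong (lin-sharm (k ∷ v) w _)
           (trans (sym (-‿distribˡ-* _ _)) (-‿cong (trans (*-identityˡ _) (lin-sharm v w _))))) ⟩
    _ ≈⟨ signs (sg v) (sg w) _ _ _ ⟩
    _ ≈⟨ *-congˡ (+-cong (peel v (l ∷ w)) (+-cong (peel (k ∷ v) w) (peel v w))) ⟨
    _ ≈⟨ *-congˡ (∑-H k v l w _) ⟨
    _ ∎
    where
    peel : ∀ v w {m} → ∑ (H v w) (λ u → twist (Φ ∘ map suc) (m ∷ u)) ≈ - ∑ (H v w) (twist (λ u → Φ (suc m ∷ map suc u)))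
    peel v w = trans (∑-cong (H v w) (λ u → sym (-‿distribˡ-* _ _))) (∑-neg (H v w) _)

  -- `starC` carries a merged entry along from the left, whereas `S` starts at the right end; `J-J`
  -- compares the two.
  lin-star : ∀ k v (Φ : Index → Carrier) → lin (starC (suc k) (map suc v)) Φ ≈ ∑ (S (k ∷ v)) (Φ ∘ map suc)
  lin-star k []      Φ = trans (lin-single _ Φ) (sym (+-identityʳ _))
  lin-star k (l ∷ v) Φ = begin
    _ ≈⟨ lin-++ (mapL (suc k ∷_) (starC (suc l) (map suc v))) _ Φ ⟩
    _ ≈⟨ +-cong (trans (lin-mapL _ (starC (suc l) (map suc v)) Φ) (lin-star l v _)) (lin-star (k ⊕ l) v Φ) ⟩
    _ ≈⟨ +-cong (∑-S-∷ l v _) (∑-S-∷ (k ⊕ l) v _) ⟩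
    _ ≈⟨ ∑-+ (S v) _ _ ⟨
    _ ≈⟨ ∑-cong (S v) (λ x → J-J k l x _) ⟨
    _ ≈⟨ ∑-S-∷ l v _ ⟨
    _ ≈⟨ ∑-S-∷ k (l ∷ v) _ ⟨
    _ ∎

  coeff-+ₚ : ∀ p q n → coeff R ι (_+ₚ_ R ι p q) n ≈ coeff R ι p n + coeff R ι q n
  coeff-+ₚ []      q       n       = sym (+-identityˡ _)
  coeff-+ₚ (a ∷ p) []      n       = sym (+-identityʳ _)
  coeff-+ₚ (a ∷ p) (b ∷ q) zero    = refl
  coeff-+ₚ (a ∷ p) (b ∷ q) (suc n) = coeff-+ₚ p q n

  coeff-scaleₚ : ∀ a p n → coeff R ι (scaleₚ R ι a p) n ≈ a * coeff R ι p n
  coeff-scaleₚ a []      n       = sym (zeroʳ a)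
  coeff-scaleₚ a (b ∷ p) zero    = refl
  coeff-scaleₚ a (b ∷ p) (suc n) = coeff-scaleₚ a p n

  coeff-*ₚ : ∀ p q n → coeff R ι (_*ₚ_ R ι p q) n ≈ ∑ (pairs n) (λ (i , j) → coeff R ι p i * coeff R ι q j)
  coeff-*ₚ []      q n       = sym (∑-zero (pairs n) (λ _ → zeroˡ _))
  coeff-*ₚ (a ∷ p) q zero    = trans (coeff-+ₚ (scaleₚ R ι a q) _ 0) (+-congʳ (coeff-scaleₚ a q 0))
  coeff-*ₚ (a ∷ p) q (suc n) = begin
    _ ≈⟨ coeff-+ₚ (scaleₚ R ι a q) _ (suc n) ⟩
    _ ≈⟨ +-cong (coeff-scaleₚ a q (suc n)) (coeff-*ₚ p q n) ⟩
    _ ≈⟨ ∑-pairs-suc n _ ⟨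
    _ ∎

  coeff-extP : (F : A → Poly R ι) (xs : List (ℚ × A)) (n : ℕ) → coeff R ι (extP R ι F xs) n ≈ lin xs (λ x → coeff R ι (F x) n)
  coeff-extP F []             n = refl
  coeff-extP F ((q , x) ∷ xs) n = trans (coeff-+ₚ (scaleₚ R ι (ι q) (F x)) _ n) (+-cong (coeff-scaleₚ (ι q) (F x) n) (coeff-extP F xs n))

  ∑-pairs-T : ∀ n (g : ℕ → Carrier) → ∑ (pairs (suc n)) (λ (i , j) → coeff R ι (Tₚ R ι) i * g j) ≈ g n
  ∑-pairs-T n g = begin
    _ ≈⟨ ∑-pairs-suc n _ ⟩
    _ ≈⟨ +-cong (zeroˡ _) (one n) ⟩
    _ ≈⟨ +-identityˡ _ ⟩
    _ ∎
    where
    one : ∀ n → ∑ (pairs n) (λ (i , j) → coeff R ι (oneₚ R ι) i * g j) ≈ g n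
    one zero    = trans (+-identityʳ _) (*-identityˡ _)
    one (suc n) = trans (∑-pairs-suc n _) (trans (+-cong (*-identityˡ _) (∑-zero (pairs n) (λ _ → zeroˡ _))) (+-identityʳ _))

-- Indices as words, admissibility, Hoffman duality

toW-map-suc : ∀ v → toW (map suc v) ≡ W v
toW-map-suc []      = ≡.refl
toW-map-suc (k ∷ v) = ≡.cong (λ z → x1 ∷ replicate k x0 ++ z) (toW-map-suc v)

map-suc-IsIndex : ∀ v → IsIndex (map suc v)
map-suc-IsIndex v = all-map v (λ _ → s≤s z≤n)

IsIndex-map-suc : ∀ {k} → IsIndex k → ∃ λ v → k ≡ map suc v
IsIndex-map-suc []              = [] , ≡.refl
IsIndex-map-suc (s≤s {n = n} _ ∷ h) with IsIndex-map-suc h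
... | v , ≡.refl = n ∷ v , ≡.refl

lastOK-W : ∀ v → End0 (W v) → lastOK (map suc v)
lastOK-W (suc k ∷ [])    h         = s≤s (s≤s z≤n)
lastOK-W (zero ∷ [])     (there ())
lastOK-W (k ∷ l ∷ v)     h         = lastOK-W (l ∷ v) (End0-drop (x1 ∷ zeros k) h)

lastOK-∷ʳ : ∀ u x → lastOK (map suc (u ∷ʳ suc x))
lastOK-∷ʳ []          x = s≤s (s≤s z≤n)
lastOK-∷ʳ (k ∷ [])    x = s≤s (s≤s z≤n)
lastOK-∷ʳ (k ∷ l ∷ u) x = lastOK-∷ʳ (l ∷ u) x

lastOK-reverse : ∀ x v → lastOK (map suc (reverse (suc x ∷ v)))
lastOK-reverse x v rewrite unfold-reverse (suc x) v = lastOK-∷ʳ (reverse v) x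

admissible-word : ∀ {w} → Start1 w → End0 w → ∃ λ k → IsAdmissible k × w ≡ toW k
admissible-word s e with Start1-W s
... | v , ≡.refl = map suc v , (map-suc-IsIndex v , lastOK-W v e) , ≡.sym (toW-map-suc v)

Start1-dagger : ∀ {w} → End0 w → Start1 (dagger w)
Start1-dagger here = start1
Start1-dagger (there {a} {w} e) rewrite dagger-∷ a w = Start1-++ (dagger w) (Start1-dagger e)

End0-dagger : ∀ {w} → Start1 w → End0 (dagger w)
End0-dagger {x1 ∷ w} start1 rewrite dagger-∷ x1 w = End0-++ (dagger w) here

initLast-∷ʳ : ∀ v k → initLast (v ∷ʳ k) ≡ just (v , k)
initLast-∷ʳ []      k = ≡.refl
initLast-∷ʳ (a ∷ v) k rewrite initLast-∷ʳ v k = ≡.refl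

circ-∷ʳ : ∀ v k w l → circ (v ∷ʳ k) (w ∷ʳ l) ≡ mapL (_++ [ k +ℕ l ]) (harm v w)
circ-∷ʳ v k w l rewrite initLast-∷ʳ v k | initLast-∷ʳ w l = ≡.refl

undec : ℕ → List Bool → List ℕ
undec c []           = c ∷ []
undec c (true ∷ bs)  = c ∷ undec 0 bs
undec c (false ∷ bs) = undec (suc c) bs

dec-undec : ∀ c bs → dec (suc c) bs ≡ map suc (undec c bs)
dec-undec c []           = ≡.refl
dec-undec c (true ∷ bs)  = ≡.cong (suc c ∷_) (dec-undec 0 bs)
dec-undec c (false ∷ bs) = dec-undec (suc c) bs

undec-∷ : ∀ c bs → ∃₂ λ x v → undec c bs ≡ x ∷ v
undec-∷ c []           = _ , _ , ≡.refl
undec-∷ c (true ∷ bs)  = _ , _ , ≡.refl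
undec-∷ c (false ∷ bs) = undec-∷ (suc c) bs

replicate-++-∷ : {A : Set} (n : ℕ) (a : A) (w : List A) → replicate n a ++ a ∷ w ≡ a ∷ replicate n a ++ w
replicate-++-∷ zero    a w = ≡.refl
replicate-++-∷ (suc n) a w = ≡.cong (a ∷_) (replicate-++-∷ n a w)

enc-undec : ∀ c bs → enc (map suc (undec c bs)) ≡ replicate c false ++ bs
enc-undec c []           = ≡.sym (++-identityʳ _)
enc-undec c (true ∷ bs) with undec 0 bs | undec-∷ 0 bs | enc-undec 0 bs
... | _ | x , v , ≡.refl | eq = ≡.cong (λ z → replicate c false ++ true ∷ z) eq
enc-undec c (false ∷ bs) = ≡.trans (enc-undec (suc c) bs) (≡.sym (replicate-++-∷ c false bs))

letter : Bool → Letter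
letter true  = x1
letter false = x0

-- Behind the initial e₁, a letter is e₁ exactly where a new entry starts, that is, at a comma.
-- Reading the entries from the right reverses these positions.
W-reverse-enc : ∀ k v → W (reverse (k ∷ v)) ≡ x1 ∷ map letter (reverse (enc (map suc (k ∷ v))))
W-reverse-enc k [] = ≡.cong (x1 ∷_) (≡.trans (++-identityʳ (zeros k))
  (≡.sym (≡.trans (≡.cong (map letter) (reverse-replicate k false)) (map-replicate letter k false))))
W-reverse-enc k (l ∷ v) = begin
  W (reverse (k ∷ l ∷ v))
    ≡⟨ ≡.cong W (unfold-reverse k (l ∷ v)) ⟩
  W (reverse (l ∷ v) ∷ʳ k)
    ≡⟨ W-++ (reverse (l ∷ v)) (k ∷ []) ⟩
  W (reverse (l ∷ v)) ++ W (k ∷ [])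
    ≡⟨ ≡.cong₂ _++_ (W-reverse-enc l v) (W-reverse-enc k []) ⟩
  x1 ∷ map letter (reverse e) ++ map letter (true ∷ reverse f)
    ≡⟨ ≡.cong (x1 ∷_) (map-++ letter (reverse e) (true ∷ reverse f)) ⟨
  x1 ∷ map letter (reverse e ++ true ∷ reverse f)
    ≡⟨ ≡.cong (λ z → x1 ∷ map letter z) (++-assoc (reverse e) (true ∷ []) (reverse f)) ⟨
  x1 ∷ map letter ((reverse e ∷ʳ true) ++ reverse f)
    ≡⟨ ≡.cong (λ z → x1 ∷ map letter (z ++ reverse f)) (unfold-reverse true e) ⟨
  x1 ∷ map letter (reverse (true ∷ e) ++ reverse f)
    ≡⟨ ≡.cong (λ z → x1 ∷ map letter z) (reverse-++ f (true ∷ e)) ⟨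
  x1 ∷ map letter (reverse (f ++ true ∷ e)) ∎
  where
  open ≡.≡-Reasoning
  e = enc (map suc (l ∷ v))
  f = replicate k false

hoffman : List ℕ → List ℕ
hoffman v = undec 0 (map not (enc (map suc v)))

-- Read from the right and without its first letter, the word of the Hoffman
-- dual is obtained by exchanging e₀ and e₁.
W-reverse-hoffman : ∀ k v {x u y w} → reverse (k ∷ v) ≡ x ∷ u → reverse (hoffman (k ∷ v)) ≡ y ∷ w →
  map swapL (zeros y ++ W w) ≡ zeros x ++ W u
W-reverse-hoffman k v {x} {u} {y} {w} p q with hoffman (k ∷ v) | undec-∷ 0 (map not (enc (map suc (k ∷ v)))) | enc-undec 0 (map not (enc (map suc (k ∷ v))))
... | _ | l , z , ≡.refl | r = begin
  map swapL (zeros y ++ W w)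
    ≡⟨ ≡.cong (map swapL) (∷-injectiveʳ (≡.trans (≡.cong W (≡.sym q)) (W-reverse-enc l z))) ⟩
  map swapL (map letter (reverse (enc (map suc (l ∷ z)))))
    ≡⟨ ≡.cong (λ e → map swapL (map letter (reverse e))) r ⟩
  map swapL (map letter (reverse (map not e)))
    ≡⟨ ≡.cong (λ e → map swapL (map letter e)) (reverse-map not e) ⟨
  map swapL (map letter (map not (reverse e)))
    ≡⟨ ≡.cong (map swapL) (map-∘ (reverse e)) ⟨
  map swapL (map (letter ∘ not) (reverse e))
    ≡⟨ map-∘ (reverse e) ⟨
  map (swapL ∘ letter ∘ not) (reverse e)
    ≡⟨ map-cong (λ { true → ≡.refl ; false → ≡.refl }) (reverse e) ⟩
  map letter (reverse e)
    ≡⟨ ∷-injectiveʳ (≡.trans (≡.cong W (≡.sym p)) (W-reverse-enc k v)) ⟨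
  zeros x ++ W u ∎
  where
  open ≡.≡-Reasoning
  e = enc (map suc (k ∷ v))

reverse-∷-inv : {A : Set} (x : A) (v : List A) → ∃₂ λ y w → reverse (x ∷ v) ≡ y ∷ w
reverse-∷-inv x v with reverse v | unfold-reverse x v
... | []    | eq = _ , _ , eq
... | y ∷ w | eq = _ , _ , eq

-- The regularization theorem at T = 0

module Rho {c ℓ : Level} (R : CommutativeRing c ℓ) (ι : ℚ → CommutativeRing.Carrier R)
  (Z : Word → CommutativeRing.Carrier R) where

  ρ-from : ℕ → Poly R ι → Poly R ι
  ρ-from n []       = []
  ρ-from n (a ∷ as) = _+ₚ_ R ι (scaleₚ R ι a (ρT R ι Z n)) (ρ-from (suc n) as)

  ρ-from-unique : (g : ℕ → Poly R ι → Poly R ι) → (∀ n → g n [] ≡ []) →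
    (∀ n a as → g n (a ∷ as) ≡ _+ₚ_ R ι (scaleₚ R ι a (ρT R ι Z n)) (g (suc n) as)) →
    ∀ n p → g n p ≡ ρ-from n p
  ρ-from-unique g g[] g∷ n []       = g[] n
  ρ-from-unique g g[] g∷ n (a ∷ as) = ≡.trans (g∷ n a as)
    (≡.cong (_+ₚ_ R ι (scaleₚ R ι a (ρT R ι Z n))) (ρ-from-unique g g[] g∷ (suc n) as))

  -- The local function in the definition of ρ cannot be named; the with
  -- abstraction brings it into a form from which unification reads it off.
  mutual
    ρ-local : Poly R ι → ℕ → Poly R ι → Poly R ι
    ρ-local = _

    ρ≡ρ-from : ∀ p → ρ R ι Z p ≡ ρ-from 0 p
    ρ≡ρ-from []       = ≡.refl
    ρ≡ρ-from (a ∷ []) = ≡.refl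
    ρ≡ρ-from (a ∷ b ∷ as) with List._∷_ a (List._∷_ b as) | 2 | _+ₚ_ R ι
    ... | p | n | _⊞_ = ≡.cong (λ t → _ ⊞ (_ ⊞ t)) (ρ-from-unique (ρ-local p) (λ _ → ≡.refl) (λ _ _ _ → ≡.refl) n as)

module Regularization {c ℓ : Level} (R : CommutativeRing c ℓ) (ι : ℚ → CommutativeRing.Carrier R)
  (ι-hom : IsRingHomomorphism +-*-rawRing (CommutativeRing.rawRing R) ι) where
  open Summation R
  open Harmonic R
  open Star R
  open Shuffle R
  open Shift R
  open Series R
  open Evaluation R ι ι-hom
  open IsRingHomomorphism ι-hom using (1#-homo) renaming (0#-homo to ι-0)
  open import Relation.Binary.Reasoning.Setoid setoid

  module Derivative (Z : Word → Carrier) (G : Index → Poly R ι) (isZst : IsZst R ι Z G) where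

    G-coeff : ℕ → List ℕ → Carrier
    G-coeff n v = coeff R ι (G (map suc v)) n

    G-coeff-H : ∀ n v w → ∑ (H v w) (G-coeff n) ≈ ∑ (pairs n) (λ (i , j) → G-coeff i v * G-coeff j w)
    G-coeff-H n v w = begin
      _ ≈⟨ lin-harm v w (λ k → coeff R ι (G k) n) ⟨
      _ ≈⟨ coeff-extP G (harm (map suc v) (map suc w)) n ⟨
      _ ≈⟨ proj₁ (proj₂ isZst) (map suc v) (map suc w) (map-suc-IsIndex v) (map-suc-IsIndex w) n ⟩
      _ ≈⟨ coeff-*ₚ (G (map suc v)) (G (map suc w)) n ⟩
      _ ∎

    G-coeffʳ : ℕ → List ℕ → Carrier
    G-coeffʳ n = G-coeff n ∘ reverse

    G-coeffʳ-T : ∀ n w → ∑ (H (0 ∷ []) w) (G-coeffʳ n) ≈ ∑ (pairs n) (λ (i , j) → coeff R ι (Tₚ R ι) i * G-coeffʳ j w)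
    G-coeffʳ-T n w = begin
      _ ≈⟨ ∑-H-reverse (0 ∷ []) w (G-coeff n) ⟨
      _ ≈⟨ G-coeff-H n (0 ∷ []) (reverse w) ⟩
      _ ≈⟨ ∑-cong (pairs n) (λ (i , j) → *-congʳ (proj₁ (proj₂ (proj₂ isZst)) i)) ⟩
      _ ∎

    G-coeffʳ-suc : ∀ n x w → G-coeffʳ (suc n) (suc x ∷ w) ≈ 0#
    G-coeffʳ-suc n x w = proj₂ (proj₂ (proj₂ isZst)) _ (map-suc-IsIndex _ , lastOK-reverse x w) (suc n)

    -- The derivation dropping a trailing 1 from an index (read from the right).
    drop1 : (List ℕ → Carrier) → List ℕ → Carrier
    drop1 f (zero ∷ v) = f v
    drop1 f _          = 0#

    -- Leibniz rule for multiplication by e₁, on which the derivation takes the value 1.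
    drop1-H : ∀ f w → ∑ (H (0 ∷ []) w) (drop1 f) ≈ f w + drop1 (λ v → ∑ (H (0 ∷ []) v) f) w
    drop1-H f []          = refl
    drop1-H f (zero ∷ w)  = begin
      _ ≈⟨ ∑-H 0 [] 0 w (drop1 f) ⟩
      _ ≈⟨ +-cong (+-identityʳ _) (trans (+-congˡ (+-identityʳ _)) (+-identityʳ _)) ⟩
      _ ∎
    drop1-H f (suc x ∷ w) = begin
      _ ≈⟨ ∑-H 0 [] (suc x) w (drop1 f) ⟩
      _ ≈⟨ +-cong (+-identityʳ _) (trans (+-cong (∑-zero (H (0 ∷ []) w) (λ _ → refl)) (+-identityʳ _)) (+-identityʳ _)) ⟩
      _ ∎

    -- ∂/∂T of Z_* minus Z_* of the derivation; it vanishes by induction on the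
    -- number of trailing 1s, since e₁ * w is a multiple of w e₁ up to terms with
    -- fewer trailing 1s.
    defect : ℕ → List ℕ → Carrier
    defect n v = natR R ι (suc n) * G-coeffʳ (suc n) v + - drop1 (G-coeffʳ n) v

    -- Compares the Leibniz rule of `drop1` with ∂(T·P)/∂T = P + T·∂P/∂T: the defect of e₁ * w is T
    -- times the defect of w.
    defect-H : ∀ w → (∀ n → defect n w ≈ 0#) → ∀ n → ∑ (H (0 ∷ []) w) (defect n) ≈ 0#
    defect-H w h n = begin
      _ ≈⟨ ∑-+ X _ _ ⟩
      _ ≈⟨ +-cong (∑-*ˡ _ X _) (∑-neg X _) ⟩
      _ ≈⟨ +-cong (*-cong (natR-suc n) (trans (G-coeffʳ-T (suc n) w) (∑-pairs-T n _))) (-‿cong (drop1-H (G-coeffʳ n) w)) ⟩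
      (1# + natR R ι n) * G-coeffʳ n w + - (G-coeffʳ n w + Y n)
        ≈⟨ +-cong (trans (distribʳ _ _ _) (+-congʳ (*-identityˡ _))) (sym (-‿+-comm _ _)) ⟩
      (G-coeffʳ n w + natR R ι n * G-coeffʳ n w) + (- G-coeffʳ n w + - Y n)
        ≈⟨ +-interchange _ _ _ _ ⟩
      (G-coeffʳ n w + - G-coeffʳ n w) + (natR R ι n * G-coeffʳ n w + - Y n)
        ≈⟨ trans (+-congʳ (-‿inverseʳ _)) (+-identityˡ _) ⟩
      natR R ι n * G-coeffʳ n w + - Y n
        ≈⟨ last n ⟩
      0# ∎
      where
      X = H (0 ∷ []) w
      Y : ℕ → Carrier
      Y n = drop1 (λ v → ∑ (H (0 ∷ []) v) (G-coeffʳ n)) w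
      drop1-cong : ∀ {f g} → (∀ v → f v ≈ g v) → ∀ w → drop1 f w ≈ drop1 g w
      drop1-cong h []          = refl
      drop1-cong h (zero ∷ w)  = h w
      drop1-cong h (suc x ∷ w) = refl
      drop1-0 : ∀ w → drop1 (λ _ → 0#) w ≈ 0#
      drop1-0 []          = refl
      drop1-0 (zero ∷ w)  = refl
      drop1-0 (suc x ∷ w) = refl
      last : ∀ n → natR R ι n * G-coeffʳ n w + - Y n ≈ 0#
      -- The first term carries the scalar 0, the second the constant term of T.
      last zero    = begin
        _ ≈⟨ +-cong (trans (*-congʳ ι-0) (zeroˡ _)) (-‿cong (trans (drop1-cong (λ v →
               trans (G-coeffʳ-T 0 v) (trans (+-identityʳ _) (zeroˡ _))) w) (drop1-0 w))) ⟩
        _ ≈⟨ -‿inverseʳ _ ⟩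
        _ ∎
      last (suc n) = begin
        _ ≈⟨ +-congˡ (-‿cong (drop1-cong (λ v → trans (G-coeffʳ-T (suc n) v) (∑-pairs-T n _)) w)) ⟩
        _ ≈⟨ h n ⟩
        _ ∎

    data NoLeading0 : List ℕ → Set where
      []  : NoLeading0 []
      suc : ∀ x v → NoLeading0 (suc x ∷ v)

    -- Inserting e₁ among `j` leading 1s yields the same index j+1 times. In every other term an
    -- entry larger than 1 comes after at most i+j leading 1s, and there `X` vanishes. The prefix of
    -- `i` ones is an accumulator for the recursion.
    ∑-H-leading : ∀ (X : List ℕ → Carrier) i j {v} → NoLeading0 v →
      (∀ i′ x w → i′ ≤ i +ℕ j → X (replicate i′ 0 ++ suc x ∷ w) ≈ 0#) →
      ∑ (H (0 ∷ []) (replicate j 0 ++ v)) (λ u → X (replicate i 0 ++ u)) ≈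
      natR R ι (suc j) * X (replicate i 0 ++ replicate (suc j) 0 ++ v)
    ∑-H-leading X i zero    {[]}        []        h = trans (+-identityʳ _) (sym (trans (*-congʳ 1#-homo) (*-identityˡ _)))
    ∑-H-leading X i zero    {suc x ∷ v} (suc x v) h = begin
      _ ≈⟨ ∑-H 0 [] (suc x) v _ ⟩
      _ ≈⟨ +-cong (+-identityʳ _) (+-cong (∑-zero (H (0 ∷ []) v) (λ u → h i x u (m≤m+n i 0)))
             (trans (+-identityʳ _) (h i (suc x) v (m≤m+n i 0)))) ⟩
      _ ≈⟨ trans (+-congˡ (+-identityʳ _)) (+-identityʳ _) ⟩
      _ ≈⟨ trans (*-congʳ 1#-homo) (*-identityˡ _) ⟨
      _ ∎
    ∑-H-leading X i (suc j) {v} nl h = begin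
      _ ≈⟨ ∑-H 0 [] 0 (replicate j 0 ++ v) _ ⟩
      _ ≈⟨ +-cong (+-identityʳ _) (+-cong (∑-cong (H (0 ∷ []) (replicate j 0 ++ v)) (λ u →
             reflexive (≡.cong X (replicate-++-∷ i 0 u))))
             (trans (+-identityʳ _) (h i 0 (replicate j 0 ++ v) (m≤m+n i (suc j))))) ⟩
      _ ≈⟨ +-congˡ (trans (+-identityʳ _) (∑-H-leading X (suc i) j nl (λ i′ x w le →
             h i′ x w (≡.subst (i′ ≤_) (≡.sym (+ℕ-suc i j)) le)))) ⟩
      _ ≈⟨ +-congˡ (*-congˡ (reflexive (≡.cong X (≡.sym (replicate-++-∷ i 0 (replicate (suc j) 0 ++ v)))))) ⟩
      Q + natR R ι (suc j) * Q
        ≈⟨ +-congʳ (*-identityˡ _) ⟨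
      1# * Q + natR R ι (suc j) * Q
        ≈⟨ distribʳ _ _ _ ⟨
      (1# + natR R ι (suc j)) * Q
        ≈⟨ *-congʳ (natR-suc (suc j)) ⟨
      natR R ι (suc (suc j)) * Q ∎
      where Q = X (replicate i 0 ++ replicate (suc (suc j)) 0 ++ v)

    -- The bound `j` makes the induction a strong one, since the step needs all smaller numbers of
    -- leading 1s. Without leading 1s the index is empty or admissible and Z_* is constant;
    -- otherwise one divides by the multiplicity i+1, which is invertible as the image of a rational
    -- number.
    defect-upTo : ∀ j i → i ≤ j → ∀ {v} → NoLeading0 v → ∀ n → defect n (replicate i 0 ++ v) ≈ 0#
    defect-upTo j zero le [] n = begin
      _ ≈⟨ +-cong (trans (*-congˡ (proj₁ isZst (suc n))) (zeroʳ _)) -0#≈0# ⟩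
      _ ≈⟨ +-identityˡ _ ⟩
      _ ∎
    defect-upTo j zero le (suc x v) n = begin
      _ ≈⟨ +-cong (trans (*-congˡ (G-coeffʳ-suc n x v)) (zeroʳ _)) -0#≈0# ⟩
      _ ≈⟨ +-identityˡ _ ⟩
      _ ∎
    defect-upTo (suc j) (suc i) (s≤s le) {v} nl n = natR-suc-cancel i _ (begin
      _ ≈⟨ ∑-H-leading (defect n) 0 i nl (λ i′ x w le′ → defect-upTo j i′ (≤-trans le′ le) (suc x w) n) ⟨
      _ ≈⟨ defect-H (replicate i 0 ++ v) (defect-upTo j i le nl) n ⟩
      _ ∎)

    leading0 : ∀ v → ∃₂ λ i w → NoLeading0 w × v ≡ replicate i 0 ++ w
    leading0 []          = 0 , [] , [] , ≡.refl
    leading0 (suc x ∷ v) = 0 , _ , suc x v , ≡.refl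
    leading0 (zero ∷ v) with leading0 v
    ... | i , w , nl , ≡.refl = suc i , w , nl , ≡.refl

    G-coeffʳ-drop1 : ∀ n v → natR R ι (suc n) * G-coeffʳ (suc n) v ≈ drop1 (G-coeffʳ n) v
    G-coeffʳ-drop1 n v with leading0 v
    ... | i , w , nl , ≡.refl = begin
      _ ≈⟨ +-identityʳ _ ⟨
      _ ≈⟨ +-congˡ (-‿inverseˡ _) ⟨
      _ ≈⟨ +-assoc _ _ _ ⟨
      _ ≈⟨ +-congʳ (defect-upTo i i ≤-refl nl n) ⟩
      _ ≈⟨ +-identityˡ _ ⟩
      _ ∎

    drop1s : ℕ → List ℕ → Carrier
    drop1s zero    v = G-coeffʳ 0 v
    drop1s (suc i) v = drop1 (drop1s i) v

    -- Taylor's formula at T = 0, the derivatives being given by `drop1`.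
    G-coeffʳ-! : ∀ i v → G-coeffʳ i v * natR R ι (i !) ≈ drop1s i v
    G-coeffʳ-! zero    v = trans (*-congˡ 1#-homo) (*-identityʳ _)
    G-coeffʳ-! (suc i) v = begin
      G-coeffʳ (suc i) v * natR R ι (suc i *ℕ i !)
        ≈⟨ *-congˡ (natR-* (suc i) (i !)) ⟩
      G-coeffʳ (suc i) v * (natR R ι (suc i) * natR R ι (i !))
        ≈⟨ *-assoc _ _ _ ⟨
      G-coeffʳ (suc i) v * natR R ι (suc i) * natR R ι (i !)
        ≈⟨ *-congʳ (trans (*-comm _ _) (G-coeffʳ-drop1 i v)) ⟩
      drop1 (G-coeffʳ i) v * natR R ι (i !)
        ≈⟨ dropped v ⟩
      drop1 (drop1s i) v ∎
      where
      dropped : ∀ v → drop1 (G-coeffʳ i) v * natR R ι (i !) ≈ drop1 (drop1s i) v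
      dropped []          = zeroˡ _
      dropped (zero ∷ v)  = G-coeffʳ-! i v
      dropped (suc x ∷ v) = zeroˡ _

    pairing : (ℕ → Carrier) → Poly R ι → Carrier
    pairing φ []      = 0#
    pairing φ (x ∷ p) = x * φ 0 + pairing (φ ∘ suc) p

    -- The convolution with `onOnes a` for an index read from the right: 1s are stripped one at a
    -- time up to the first larger entry.
    overOnes : (ℕ → Carrier) → List ℕ → Carrier
    overOnes a []          = G-coeffʳ 0 [] * a 0 + 0#
    overOnes a (zero ∷ v)  = G-coeffʳ 0 (zero ∷ v) * a 0 + overOnes (a ∘ suc) v
    overOnes a (suc x ∷ v) = G-coeffʳ 0 (suc x ∷ v) * a 0 + 0#

    conv-overOnes : ∀ a v → conv (G-coeff 0) (onOnes a) (reverse v) ≈ overOnes a v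
    conv-overOnes a []          = refl
    conv-overOnes a (x ∷ v) = trans split (rest x)
      where
      tail : ℕ → Carrier
      tail x = ∑ (splits (reverse v)) (λ (p , q) → G-coeff 0 p * onOnes a (q ∷ʳ x))
      split : conv (G-coeff 0) (onOnes a) (reverse (x ∷ v)) ≈ G-coeffʳ 0 (x ∷ v) * a 0 + tail x
      split = begin
        _ ≡⟨ ≡.cong (conv (G-coeff 0) (onOnes a)) (unfold-reverse x v) ⟩
        conv (G-coeff 0) (onOnes a) (reverse v ++ x ∷ [])
          ≈⟨ ∑-splits-++ (reverse v) x [] _ ⟩
        _ ≈⟨ +-comm _ _ ⟩
        _ ≈⟨ +-congʳ (trans (+-identityʳ _) (*-congʳ (reflexive (≡.cong (G-coeff 0) (≡.sym (unfold-reverse x v)))))) ⟩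
        _ ∎
      onOnes-∷ʳ : ∀ a v → onOnes a (v ∷ʳ 0) ≈ onOnes (a ∘ suc) v
      onOnes-∷ʳ a []          = refl
      onOnes-∷ʳ a (zero ∷ v)  = onOnes-∷ʳ (a ∘ suc) v
      onOnes-∷ʳ a (suc _ ∷ v) = refl
      rest : ∀ x → G-coeffʳ 0 (x ∷ v) * a 0 + tail x ≈ overOnes a (x ∷ v)
      rest zero    = +-congˡ (trans (∑-cong (splits (reverse v)) (λ (p , q) → *-congˡ (onOnes-∷ʳ a q))) (conv-overOnes (a ∘ suc) v))
      rest (suc x) = +-congˡ (∑-zero (splits (reverse v)) (λ (p , q) → trans (*-congˡ (onOnes-++-suc a q x [])) (zeroʳ _)))

    pairing-0 : ∀ φ a p → (∀ i → coeff R ι p i * φ i ≈ 0#) → pairing (λ i → φ i * a i) p ≈ 0#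
    pairing-0 φ a []      h = refl
    pairing-0 φ a (x ∷ p) h = begin
      _ ≈⟨ +-cong (trans (sym (*-assoc _ _ _)) (trans (*-congʳ (h 0)) (zeroˡ _))) (pairing-0 (φ ∘ suc) (a ∘ suc) p (h ∘ suc)) ⟩
      _ ≈⟨ +-identityˡ _ ⟩
      _ ∎

    -- The coefficient list and the run of leading 1s may have different lengths; when one runs out,
    -- the hypothesis makes what is left of the other vanish.
    pairing-overOnes : ∀ φ a p v → (∀ i → coeff R ι p i * φ i ≈ drop1s i v) → pairing (λ i → φ i * a i) p ≈ overOnes a v
    pairing-overOnes φ a [] v h = sym (vanish φ a v h)
      where
      vanish : ∀ φ a v → (∀ i → 0# * φ i ≈ drop1s i v) → overOnes a v ≈ 0#
      head : ∀ φ a v → (∀ i → 0# * φ i ≈ drop1s i v) → G-coeffʳ 0 v * a 0 ≈ 0#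
      head φ a v h = trans (*-congʳ (trans (sym (h 0)) (zeroˡ _))) (zeroˡ _)
      vanish φ a []          h = trans (+-congʳ (head φ a [] h)) (+-identityˡ _)
      vanish φ a (zero ∷ v)  h = trans (+-cong (head φ a (zero ∷ v) h) (vanish (φ ∘ suc) (a ∘ suc) v (h ∘ suc))) (+-identityˡ _)
      vanish φ a (suc x ∷ v) h = trans (+-congʳ (head φ a (suc x ∷ v) h)) (+-identityˡ _)
    pairing-overOnes φ a (x ∷ p) []          h =
      +-cong (trans (sym (*-assoc _ _ _)) (*-congʳ (h 0))) (pairing-0 (φ ∘ suc) (a ∘ suc) p (h ∘ suc))
    pairing-overOnes φ a (x ∷ p) (zero ∷ v)  h =
      +-cong (trans (sym (*-assoc _ _ _)) (*-congʳ (h 0))) (pairing-overOnes (φ ∘ suc) (a ∘ suc) p v (h ∘ suc))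
    pairing-overOnes φ a (x ∷ p) (suc y ∷ v) h =
      +-cong (trans (sym (*-assoc _ _ _)) (*-congʳ (h 0))) (pairing-0 (φ ∘ suc) (a ∘ suc) p (h ∘ suc))

    open Rho R ι Z

    -- ρ_Z(T^n) has constant term n! a_n.
    coeff-ρ-from : ∀ φ n p → (∀ i → φ i ≈ natR R ι ((n +ℕ i) Perm (n +ℕ i)) * aCoef R ι Z (n +ℕ i)) →
      coeff R ι (ρ-from n p) 0 ≈ pairing φ p
    coeff-ρ-from φ n []      h = refl
    coeff-ρ-from φ n (x ∷ p) h = begin
      _ ≈⟨ coeff-+ₚ (scaleₚ R ι x (ρT R ι Z n)) (ρ-from (suc n) p) 0 ⟩
      _ ≈⟨ +-cong (trans (coeff-scaleₚ x (ρT R ι Z n) 0) (*-congˡ (sym (trans (h 0) (reflexive (≡.cong term (+ℕ-identityʳ n)))))))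
             (coeff-ρ-from (φ ∘ suc) (suc n) p (λ i → trans (h (suc i)) (reflexive (≡.cong term (+ℕ-suc n i))))) ⟩
      _ ∎
      where
      term : ℕ → Carrier
      term m = natR R ι (m Perm m) * aCoef R ι Z m

    -- i! times the coefficient of T^i in Z_* is the constant term of Z_* after removal of i
    -- trailing 1s, or 0 if there are fewer. Weighting by a_i and summing gives the convolution.
    coeff-ρ : ∀ v → coeff R ι (ρ R ι Z (G (map suc v))) 0 ≈ conv (G-coeff 0) (onOnes (aCoef R ι Z)) v
    coeff-ρ v = begin
      _ ≡⟨ ≡.cong (λ p → coeff R ι p 0) (ρ≡ρ-from (G (map suc v))) ⟩
      _ ≈⟨ coeff-ρ-from (λ i → natR R ι (i Perm i) * aCoef R ι Z i) 0 (G (map suc v)) (λ _ → refl) ⟩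
      _ ≈⟨ pairing-overOnes (λ i → natR R ι (i Perm i)) (aCoef R ι Z) (G (map suc v)) (reverse v) (λ i → begin
             coeff R ι (G (map suc v)) i * natR R ι (i Perm i)
               ≡⟨ ≡.cong₂ (λ u m → coeff R ι (G (map suc u)) i * natR R ι m) (≡.sym (reverse-involutive v)) (nPn≡n! i) ⟩
             G-coeffʳ i (reverse v) * natR R ι (i !)
               ≈⟨ G-coeffʳ-! i (reverse v) ⟩
             _ ∎) ⟩
      _ ≈⟨ conv-overOnes (aCoef R ι Z) (reverse v) ⟨
      _ ≡⟨ ≡.cong (conv (G-coeff 0) (onOnes (aCoef R ι Z))) (reverse-involutive v) ⟩
      _ ∎

-- From the values of Z in the relation to the Kawashima functions

data NonEmpty : List ℕ → Set where
  cons : ∀ k v → NonEmpty (k ∷ v)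

H-NonEmpty : ∀ k v l w → All NonEmpty (H (k ∷ v) (l ∷ w))
H-NonEmpty k v l w = ++⁺ (all-map (H v (l ∷ w)) (cons k)) (++⁺ (all-map (H (k ∷ v) w) (cons l)) (all-map (H v w) (cons (k ⊕ l))))

map-suc-reverse-∷ : ∀ h t → map suc (reverse (h ∷ t)) ≡ map suc (reverse t) ∷ʳ suc h
map-suc-reverse-∷ h t = ≡.trans (≡.cong (map suc) (unfold-reverse h t)) (map-++ suc (reverse t) (h ∷ []))

ones-∷ʳ : ∀ n → ones (suc n) ≡ map suc (reverse (replicate n 0)) ∷ʳ 1
ones-∷ʳ n = ≡.trans (≡.sym (replicate-∷ʳ n 1)) (≡.cong (_∷ʳ 1)
  (≡.trans (≡.sym (map-replicate suc n 0)) (≡.cong (map suc) (≡.sym (reverse-replicate n 0)))))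

module Conclusion {c ℓ : Level} (R : CommutativeRing c ℓ) (ι : ℚ → CommutativeRing.Carrier R)
  (ι-hom : IsRingHomomorphism +-*-rawRing (CommutativeRing.rawRing R) ι)
  (Z : Word → CommutativeRing.Carrier R)
  (duality : (k : Index) → IsAdmissible k → CommutativeRing._≈_ R (Z (toW k)) (Z (dagger (toW k))))
  (F : Word → Poly R ι) (G : Index → Poly R ι) (isZsh : IsZsh R ι Z F) (isZst : IsZst R ι Z G)
  (regularization : (k : Index) → IsIndex k → _≈ₚ_ R ι (F (toW k)) (ρ R ι Z (G k)))
  where
  open Summation R
  open Harmonic R
  open Star R
  open Shuffle R
  open Shift R
  open Series R
  open Evaluation R ι ι-hom
  open Regularization R ι ι-hom
  open Derivative Z G isZst
  open import Relation.Binary.Reasoning.Setoid setoid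

  F₀ : Word → Carrier
  F₀ w = coeff R ι (F w) 0

  F₀-sh : ∀ v w → ∑ (sh (W v) (W w)) F₀ ≈ F₀ (W v) * F₀ (W w)
  F₀-sh v w = ≡.subst₂ (λ x y → ∑ (sh x y) F₀ ≈ F₀ x * F₀ y) (toW-map-suc v) (toW-map-suc w) (begin
    _ ≈⟨ lin-shuffle V V′ F₀ ⟨
    _ ≈⟨ coeff-extP F (shuffle V V′) 0 ⟨
    _ ≈⟨ proj₁ (proj₂ isZsh) (map suc v) (map suc w) (map-suc-IsIndex v) (map-suc-IsIndex w) 0 ⟩
    _ ≈⟨ coeff-*ₚ (F V) (F V′) 0 ⟩
    _ ≈⟨ +-identityʳ _ ⟩
    _ ∎)
    where
    V  = toW (map suc v)
    V′ = toW (map suc w)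

  F₀-W : ∀ v → F₀ (W v) ≈ conv (G-coeff 0) (onOnes (aCoef R ι Z)) v
  F₀-W v = begin
    _ ≡⟨ ≡.cong F₀ (toW-map-suc v) ⟨
    _ ≈⟨ regularization (map suc v) (map-suc-IsIndex v) 0 ⟩
    _ ≈⟨ coeff-ρ v ⟩
    _ ∎

  F₀-Z : ∀ {w} → Start1 w → End0 w → F₀ w ≈ Z w
  F₀-Z s e with admissible-word s e
  ... | k , adm , ≡.refl = proj₂ (proj₂ (proj₂ isZsh)) k adm 0

  F₀-dagger : ∀ w → Start1 w → End0 w → F₀ w ≈ F₀ (dagger w)
  F₀-dagger w s e = begin
    F₀ w           ≈⟨ F₀-Z s e ⟩
    Z w            ≈⟨ dual ⟩
    Z (dagger w)   ≈⟨ F₀-Z (Start1-dagger e) (End0-dagger s) ⟨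
    F₀ (dagger w)  ∎
    where
    dual : Z w ≈ Z (dagger w)
    dual with admissible-word s e
    ... | k , adm , ≡.refl = duality k adm

  open Kawashima F₀ (G-coeff 0) (aCoef R ι Z) (proj₁ isZsh 0) (proj₁ isZst 0) F₀-sh
    (λ v w → trans (G-coeff-H 0 v w) (+-identityʳ _)) F₀-W F₀-dagger

  -- The last entries 1 and h+1 merge into h+2, stored as `suc h`. The result is admissible, so Z
  -- agrees with the constant term of Z_*.
  lin-circ : ∀ n h t → lin (circ (ones (suc n)) (map suc (reverse (h ∷ t)))) (Z ∘ toW) ≈
    ∑ (H (replicate n 0) t) (λ z → Gʳ (suc h ∷ z))
  lin-circ n h t = begin
    _ ≡⟨ ≡.cong₂ (λ x y → lin (circ x y) (Z ∘ toW)) (ones-∷ʳ n) (map-suc-reverse-∷ h t) ⟩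
    _ ≡⟨ ≡.cong (λ x → lin x (Z ∘ toW)) (circ-∷ʳ (map suc (reverse (replicate n 0))) 1 (map suc (reverse t)) (suc h)) ⟩
    _ ≈⟨ lin-mapL _ (harm (map suc (reverse (replicate n 0))) (map suc (reverse t))) (Z ∘ toW) ⟩
    _ ≈⟨ lin-harm (reverse (replicate n 0)) (reverse t) _ ⟩
    _ ≈⟨ ∑-H-reverse (replicate n 0) t _ ⟩
    _ ≈⟨ ∑-cong (H (replicate n 0) t) (λ z → begin
           _ ≡⟨ ≡.cong (Z ∘ toW) (map-suc-reverse-∷ (suc h) z) ⟨
           _ ≈⟨ proj₂ (proj₂ (proj₂ isZst)) _ (map-suc-IsIndex _ , lastOK-reverse h z) 0 ⟨
           _ ∎) ⟩
    _ ∎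

  value : ℕ → Index → Carrier
  value m k = lin (star (hdual k)) (λ u → lin (circ (ones m) u) (Z ∘ toW))

  ZI-value : ∀ m xs → ZI R ι Z (circL [ 1ℚ , ones m ] (starL (hdualL xs))) ≈ lin xs (value m)
  ZI-value m xs = begin
    _ ≈⟨ ZI-lin Z (circL [ 1ℚ , ones m ] (starL (hdualL xs))) ⟩
    _ ≈⟨ lin-ext2L circ (ones m) (starL (hdualL xs)) (Z ∘ toW) ⟩
    _ ≈⟨ lin-extL star (hdualL xs) _ ⟩
    _ ≈⟨ lin-mapL hdual xs _ ⟩
    _ ∎

  -- Reversal brings the entry on which ⊛ acts to the front; the choice of comma or plus behind it
  -- is the choice of strict or equal in `cap`.
  lin-star-capped : ∀ n v {y w} → reverse v ≡ y ∷ w →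
    lin (star (map suc v)) (λ u → lin (circ (ones (suc n)) u) (Z ∘ toW)) ≈ capped (suc y , replicate n 0) w
  lin-star-capped n []      ()
  lin-star-capped n (k ∷ v) {y} {w} eq = begin
    _ ≈⟨ lin-star k v _ ⟩
    _ ≡⟨ ≡.cong (λ z → ∑ (S z) (Φ ∘ map suc)) (≡.trans (≡.sym (reverse-involutive (k ∷ v))) (≡.cong reverse eq)) ⟩
    _ ≈⟨ ∑-S-reverse (y ∷ w) _ ⟩
    _ ≈⟨ ∑-S-∷ y w _ ⟩
    _ ≈⟨ ∑-cong (S w) J-cap ⟩
    _ ∎
    where
    Φ : Index → Carrier
    Φ u = lin (circ (ones (suc n)) u) (Z ∘ toW)
    J-cap : ∀ u → ∑ (J y u) (Φ ∘ map suc ∘ reverse) ≈ ∑ (cap (suc y) (replicate n 0) u) Gʳ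
    J-cap []      = +-congʳ (trans (lin-circ n y []) (∑-H-[]ʳ (replicate n 0) _))
    J-cap (x ∷ u) = trans a+[b+0]≈a+b (trans (+-cong (lin-circ n y (x ∷ u)) (lin-circ n (y ⊕ x) u))
      (sym (∑-cap-∷ (suc y) (replicate n 0) x u Gʳ)))

  value-kaw : ∀ n k v → value (suc n) (map suc (k ∷ v)) ≈ - twist (kaw (suc n)) (reverse (k ∷ v))
  value-kaw n k v with reverse-∷-inv k v | undec-∷ 0 (map not (enc (map suc (k ∷ v))))
  ... | x , u , p | l , z , r = begin
    _ ≡⟨ ≡.cong (λ κ → lin (star κ) (λ u → lin (circ (ones (suc n)) u) (Z ∘ toW))) (dec-undec 0 (map not (enc (map suc (k ∷ v))))) ⟩
    _ ≈⟨ lin-star-capped n (hoffman (k ∷ v)) q ⟩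
    _ ≈⟨ capped-glue n y w ⟩
    _ ≈⟨ glue-dual n (zeros y ++ W w) ⟩
    -- The exchange of letters by duality undoes the Hoffman dual: the zigzag now belongs to
    -- `k ∷ v`.
    _ ≡⟨ ≡.cong (λ z → glue ([] , x1 , zeros (suc n)) z F₀) (W-reverse-hoffman k v p q) ⟩
    _ ≈⟨ glue-kaw n x u ⟩
    _ ≡⟨ ≡.cong (λ z → - twist (kaw (suc n)) z) p ⟨
    _ ∎
    where
    yw = reverse-∷-inv l z
    y = proj₁ yw
    w = proj₁ (proj₂ yw)
    q : reverse (hoffman (k ∷ v)) ≡ y ∷ w
    q = ≡.trans (≡.cong reverse r) (proj₂ (proj₂ yw))

  -- Since `g` vanishes as soon as one argument is 0, the sum over p, q ≥ 1 extends to all pairs.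
  sumPQ-pairs : ∀ n a (f : ℕ → ℕ → Carrier) (g : ℕ × ℕ → Carrier) →
    (∀ i j → f (suc i) (suc j) ≈ a * g (suc i , suc j)) → (∀ j → g (0 , j) ≈ 0#) → (∀ i → g (i , 0) ≈ 0#) →
    sumPQ R ι (suc n) f ≈ a * ∑ (pairs (suc n)) g
  sumPQ-pairs n a f g fg g0ˡ g0ʳ = begin
    _ ≡⟨ ≡.cong (foldr _+_ 0#) (map-applyUpTo suc (λ p → f p (suc n ∸ p)) n) ⟩
    _ ≈⟨ go n (f ∘ suc) (λ (i , j) → g (suc i , j)) fg (λ i → g0ʳ (suc i)) ⟩
    _ ≈⟨ *-congˡ (trans (∑-pairs-suc n g) (trans (+-congʳ (g0ˡ (suc n))) (+-identityˡ _))) ⟨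
    _ ∎
    where
    go : ∀ n (f : ℕ → ℕ → Carrier) (g : ℕ × ℕ → Carrier) → (∀ i j → f i (suc j) ≈ a * g (i , suc j)) → (∀ i → g (i , 0) ≈ 0#) →
      foldr _+_ 0# (applyUpTo (λ i → f i (n ∸ i)) n) ≈ a * ∑ (pairs n) g
    go zero    f g fg g0 = sym (trans (*-congˡ (trans (+-identityʳ _) (g0 0))) (zeroʳ a))
    go (suc n) f g fg g0 = begin
      _ ≈⟨ +-cong (fg 0 n) (go n (f ∘ suc) (λ (i , j) → g (suc i , j)) (fg ∘ suc) (g0 ∘ suc)) ⟩
      _ ≈⟨ distribˡ a _ _ ⟨
      _ ≈⟨ *-congˡ (∑-pairs-suc n g) ⟨
      _ ∎

  sg-reverse : {A : Set} (v : List A) → sg (reverse v) ≈ sg v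
  sg-reverse []      = refl
  sg-reverse (x ∷ v) = begin
    _ ≡⟨ ≡.cong sg (unfold-reverse x v) ⟩
    _ ≈⟨ sg-++ (reverse v) (x ∷ []) ⟩
    _ ≈⟨ *-congʳ (sg-reverse v) ⟩
    _ ≈⟨ -‿distribʳ-* _ _ ⟨
    _ ≈⟨ -‿cong (*-identityʳ _) ⟩
    _ ∎

  kaw-reverse-0 : ∀ k v → kaw 0 (reverse (k ∷ v)) ≈ 0#
  kaw-reverse-0 k v with reverse-∷-inv k v
  ... | x , u , p = trans (reflexive (≡.cong (kaw 0) p)) (kaw-0 x u)

  -- `value-kaw` has one minus sign: two of them cancel on the left and one stays on the right. The
  -- signs of the lengths convert the harmonic product of `kaw-H` into the star-harmonic one.
  kawashima : ∀ k v l w n →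
    sumPQ R ι (suc n) (λ p q →
        ZI R ι Z (circL [ 1ℚ , ones p ] (starL (hdualL [ 1ℚ , map suc (k ∷ v) ])))
      * ZI R ι Z (circL [ 1ℚ , ones q ] (starL (hdualL [ 1ℚ , map suc (l ∷ w) ]))))
    ≈ - ZI R ι Z (circL [ 1ℚ , ones (suc n) ] (starL (hdualL (sharm (map suc (k ∷ v)) (map suc (l ∷ w))))))
  kawashima k v l w n = begin
    _ ≈⟨ sumPQ-pairs n (sg K * sg L) (λ p q → factor p K * factor q L) (λ (i , j) → kaw i (reverse K) * kaw j (reverse L))
           (λ i j → trans (*-cong (single i k v) (single j l w)) (trans (-a*-b≈a*b _ _) (*-interchange _ _ _ _)))
           (λ j → trans (*-congʳ (kaw-reverse-0 k v)) (zeroˡ _))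
           (λ i → trans (*-congˡ (kaw-reverse-0 l w)) (zeroʳ _)) ⟩
    sg K * sg L * ∑ (pairs (suc n)) (λ (i , j) → kaw i (reverse K) * kaw j (reverse L))
      ≈⟨ *-congˡ (kaw-H (suc n) (reverse K) (reverse L)) ⟨
    sg K * sg L * ∑ (H (reverse K) (reverse L)) (kaw (suc n))
      ≈⟨ *-congˡ (∑-H-reverse K L (kaw (suc n))) ⟩
    sg K * sg L * ∑ (H K L) (kaw (suc n) ∘ reverse)
      ≈⟨ *-congˡ (-‿involutive _) ⟨
    sg K * sg L * - - ∑ (H K L) (kaw (suc n) ∘ reverse)
      ≈⟨ -‿distribʳ-* _ _ ⟨
    - (sg K * sg L * - ∑ (H K L) (kaw (suc n) ∘ reverse))
      -- `value-kaw` speaks of non-empty indices, hence `H-NonEmpty`.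
      ≈⟨ -‿cong (*-congˡ (trans (∑-cong-All (H-NonEmpty k v l w) untwist) (∑-neg (H K L) _))) ⟨
    - (sg K * sg L * ∑ (H K L) (twist (value (suc n) ∘ map suc)))
      ≈⟨ -‿cong (lin-sharm K L (value (suc n))) ⟨
    - lin (sharm (map suc K) (map suc L)) (value (suc n))
      ≈⟨ -‿cong (ZI-value (suc n) (sharm (map suc K) (map suc L))) ⟨
    _ ∎
    where
    K = k ∷ v
    L = l ∷ w
    factor : ℕ → List ℕ → Carrier
    factor p K = ZI R ι Z (circL [ 1ℚ , ones p ] (starL (hdualL [ 1ℚ , map suc K ])))
    single : ∀ i k v → factor (suc i) (k ∷ v) ≈
      - (sg (k ∷ v) * kaw (suc i) (reverse (k ∷ v)))
    single i k v = begin
      _ ≈⟨ ZI-value (suc i) [ 1ℚ , map suc (k ∷ v) ] ⟩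
      _ ≈⟨ lin-single (map suc (k ∷ v)) (value (suc i)) ⟩
      _ ≈⟨ value-kaw i k v ⟩
      _ ≈⟨ -‿cong (*-congʳ (sg-reverse (k ∷ v))) ⟩
      _ ∎
    untwist : ∀ u → NonEmpty u → twist (value (suc n) ∘ map suc) u ≈ - kaw (suc n) (reverse u)
    untwist .(x ∷ u) (cons x u) = begin
      _ ≈⟨ *-congˡ (trans (value-kaw n x u) (-‿cong (*-congʳ (sg-reverse (x ∷ u))))) ⟩
      _ ≈⟨ -‿distribʳ-* _ _ ⟨
      _ ≈⟨ -‿cong (trans (sym (*-assoc _ _ _)) (trans (*-congʳ (sg-sq (x ∷ u))) (*-identityˡ _))) ⟩
      _ ∎

theorem6p7 : {c ℓ : Level} (R : CommutativeRing c ℓ) →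
    let open CommutativeRing R in
    (ι : ℚ → Carrier) → IsRingHomomorphism +-*-rawRing rawRing ι →
    (Z : Word → Carrier) →
    ((v w : Index) → IsAdmissible v → IsAdmissible w →
    ZW R ι Z (shuffle (toW v) (toW w)) ≈ Z (toW v) * Z (toW w)) →
    ((v w : Index) → IsAdmissible v → IsAdmissible w →
    ZI R ι Z (harm v w) ≈ Z (toW v) * Z (toW w)) →
    ((k : Index) → IsAdmissible k → Z (toW k) ≈ Z (dagger (toW k))) →
    Σ (Word → Poly R ι) (λ F → Σ (Index → Poly R ι) (λ G →
    IsZsh R ι Z F × IsZst R ι Z G ×
    ((k : Index) → IsIndex k → _≈ₚ_ R ι (F (toW k)) (ρ R ι Z (G k))))) →
    (k l : Index) → IsIndex k → IsIndex l → (k ≡ [] → ⊥) → (l ≡ [] → ⊥) →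
    (m : ℕ) → 1 ≤ m →
    sumPQ R ι m (λ p q →
    ZI R ι Z (circL ((1ℚ , ones p) ∷ []) (starL (hdualL ((1ℚ , k) ∷ []))))
    * ZI R ι Z (circL ((1ℚ , ones q) ∷ []) (starL (hdualL ((1ℚ , l) ∷ [])))))
    ≈ - ZI R ι Z (circL ((1ℚ , ones m) ∷ []) (starL (hdualL (sharm k l))))
theorem6p7 R ι ι-hom Z _ _ duality (F , G , isZsh , isZst , regularization) k l ik il k≢[] l≢[] (suc n) _
  with IsIndex-map-suc ik | IsIndex-map-suc il
... | []    , ≡.refl | _          = ⊥-elim (k≢[] ≡.refl)
... | _ ∷ _ , _      | [] , ≡.refl = ⊥-elim (l≢[] ≡.refl)
... | x ∷ v , ≡.refl | y ∷ w , ≡.refl =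
  Conclusion.kawashima R ι ι-hom Z duality F G isZsh isZst regularization x v y w n
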